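{- Let $n\ge 5$ be an integer with $n\equiv 2,3,4,7,8$ or $9\pmod{10}$. Then the necessary conditions are sufficient for the existence of a near-minimal configuration $(1,5)$ $GDD(n,2,6;\lambda_1,\lambda_2)$; that is, for every such $n$ there exists a configuration $(1,5)$ $GDD(n,2,6;\lambda_1,\lambda_2)$ whose indices are exactly twice the minimal indices, namely $(\lambda_1,\lambda_2)=(10n,5(n-1))$ if $n\equiv 3,7,9\pmod{10}$ and $(\lambda_1,\lambda_2)=(20n,10(n-1))$ if $n\equiv 2,4,8\pmod{10}$.
   Context: A $GDD(n,2,6;\lambda_1,\lambda_2)$ is a finite collection (repetitions allowed) of $6$-element subsets, called blocks, of a $2n$-element set $X$ partitioned into two groups of size $n$, such that every point lies in the same number $r$ of blocks, any two distinct points of the same group lie together in exactly $\lambda_1$ blocks, and any two points from different groups lie together in exactly $\lambda_2$ blocks. It has configuration $(1,5)$ if every block has exactly $1$ point in one of the two groups and $5$ points in the other (which group contains the single point may depend on the block). For the values of $n$ considered here, the minimal indices for configuration $(1,5)$ are the smallest positive integers $\lambda_1,\lambda_2$ satisfying the necessary conditions that $\lambda_2=\frac{\lambda_1(n-1)}{2n}$ and that the number of blocks $\frac{\lambda_1 n(n-1)+\lambda_2n^2}{15}$ and the replication number $r=\frac{\lambda_1(n-1)+\lambda_2 n}{5}$ are integers; these are $\left(5n,\frac{5(n-1)}{2}\right)$ if $n\equiv 3,7,9\pmod{10}$ and $(10n,5(n-1))$ if $n\equiv 2,4,8\pmod{10}$. A configuration $(1,5)$ GDD is near-minimal if its indices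 are exactly twice the minimal indices. -}

module Defs where

open import Data.Nat using (ℕ; _+_; _*_; _∸_; _≤_; _<_)
open import Data.Nat.Divisibility using (_∣_)
open import Data.Fin using (Fin)
open import Data.Fin.Subset using (Subset; _∈_; _∩_; ∁; ∣_∣)
open import Data.Fin.Subset.Properties using (_∈?_)
open import Data.List using (List; length; filter)
open import Data.List.Relation.Unary.All using (All)
open import Data.Product using (_×_; Σ-syntax; ∃₂)
open import Data.Sum using (_⊎_)
open import Relation.Binary.PropositionalEquality using (_≡_; _≢_)
open import Relation.Nullary.Decidable using (_×-dec_)

-- Blocks are counted with multiplicity.
pointCount : ∀ {v} → List (Subset v) → Fin v → ℕ
pointCount bs x = length (filter (x ∈?_) bs)

pairCount : ∀ {v} → List (Subset v) → Fin v → Fin v → ℕ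
pairCount bs x y = length (filter (λ B → (x ∈? B) ×-dec (y ∈? B)) bs)

-- GDD(n,2,k;λ₁,λ₂) on the point set Fin (2 * n).  The two groups are G and
-- its complement; the latter then has size n automatically.
record GDD (n k λ₁ λ₂ : ℕ) : Set where
  field
    G           : Subset (2 * n)
    ∣G∣≡n       : ∣ G ∣ ≡ n
    blocks      : List (Subset (2 * n))
    blockSize   : All (λ B → ∣ B ∣ ≡ k) blocks
    r           : ℕ
    replication : ∀ x → pointCount blocks x ≡ r
    pairs-G     : ∀ {x y} → x ≢ y → x ∈ G → y ∈ G → pairCount blocks x y ≡ λ₁
    pairs-∁G    : ∀ {x y} → x ≢ y → x ∈ ∁ G → y ∈ ∁ G → pairCount blocks x y ≡ λ₁
    pairs-mixed : ∀ {x y} → x ∈ G → y ∈ ∁ G → pairCount blocks x y ≡ λ₂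

HasConfiguration : (s t : ℕ) → ∀ {n k λ₁ λ₂} → GDD n k λ₁ λ₂ → Set
HasConfiguration s t D = All Split blocks
  where
  open GDD D
  Split : Subset _ → Set
  Split B = (∣ B ∩ G ∣ ≡ s × ∣ B ∩ ∁ G ∣ ≡ t)
          ⊎ (∣ B ∩ G ∣ ≡ t × ∣ B ∩ ∁ G ∣ ≡ s)

-- The first condition is λ₂ = λ₁(n-1)/(2n) with the denominator cleared.
-- The other two say that the number of blocks (λ₁n(n-1) + λ₂n²)/15 and the
-- replication number (λ₁(n-1) + λ₂n)/5 are integers.
NecessaryConditions : (n λ₁ λ₂ : ℕ) → Set
NecessaryConditions n λ₁ λ₂ =
    (λ₂ * (2 * n) ≡ λ₁ * (n ∸ 1))
  × (15 ∣ λ₁ * n * (n ∸ 1) + λ₂ * (n * n))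
  × (5 ∣ λ₁ * (n ∸ 1) + λ₂ * n)

PositiveAdmissible : (n λ₁ λ₂ : ℕ) → Set
PositiveAdmissible n λ₁ λ₂ = 0 < λ₁ × 0 < λ₂ × NecessaryConditions n λ₁ λ₂

-- For n ≥ 2 the first necessary condition fixes the ratio λ₁ : λ₂, so λ₁ and
-- λ₂ can be minimised simultaneously.
MinimalIndices : (n λ₁ λ₂ : ℕ) → Set
MinimalIndices n λ₁ λ₂ =
    PositiveAdmissible n λ₁ λ₂
  × (∀ μ₁ μ₂ → PositiveAdmissible n μ₁ μ₂ → λ₁ ≤ μ₁ × λ₂ ≤ μ₂)

NearMinimalIndices : (n λ₁ λ₂ : ℕ) → Set
NearMinimalIndices n λ₁ λ₂ =
  ∃₂ λ μ₁ μ₂ → MinimalIndices n μ₁ μ₂ × λ₁ ≡ 2 * μ₁ × λ₂ ≡ 2 * μ₂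

NearMinimalConfig15GDD : (n λ₁ λ₂ : ℕ) → Set
NearMinimalConfig15GDD n λ₁ λ₂ =
  NearMinimalIndices n λ₁ λ₂ × (Σ[ D ∈ GDD n 6 λ₁ λ₂ ] HasConfiguration 1 5 D)

{-# OPTIONS --safe #-}

-- Take a design with blocks of size 5 and index λ₁ on n points and colour its blocks by the
-- n points so that every point lies in μ blocks of each colour.  Put a copy on each group and
-- add to every block the point of the other group named by its colour: this gives
-- configuration (1,5) and λ₂ = 2μ.
--
-- Since λ₁ = λ₀ n grows with n, the design can be built with many shifts.  Split the n = q k
-- points into q ≤ 3 copies ("fibres") of ℤ/k.  A pattern puts a set T_f on each fibre f, and
-- its blocks are the sets T_f + m_f a + g, where a and g run through ℤ/k and a also serves as
-- the colour.  If the m_f differ by units, every difference between two fibres occurs equally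
-- often, so only the differences within fibres matter: each d ≠ 0 must occur λ₀ times.  The
-- patterns are taken linear in a parameter s ∈ ℤ/k with differences s + e, 3s + e (only where
-- 3 is a unit), and 2s and 2s + 1 equally often, which cover ℤ/k uniformly even when 2 is not
-- a unit.  The few s for which blocks degenerate are left out, and constant patterns supply
-- their differences.  The counts then force the points within each block to be distinct.

module Submission where

open import Defs
open import Data.Bool using (Bool; true; false; not; _∧_; if_then_else_)
open import Data.Bool.Properties using (∧-identityʳ; ∧-zeroʳ)
open import Data.Nat using (ℕ; zero; suc; _+_; _*_; _∸_; _≤_; _<_; z≤n; s≤s; z<s; s<s; NonZero; _/_; _<?_; _%_; >-nonZero)
open import Data.Nat.Properties hiding (_≟_; suc-injective)
open import Data.Nat.DivMod using (m*n/n≡m; m≡m%n+[m/n]*n)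
open import Data.Nat.ListAction using (sum)
open import Data.Nat.ListAction.Properties using (sum-++; sum-↭)
open import Data.Nat.Tactic.RingSolver using (solve-∀)
open import Data.Fin using (Fin; zero; suc; toℕ; combine; remQuot; _↑ˡ_; _↑ʳ_; fromℕ<)
open import Data.Fin.Properties using (_≟_; suc-injective; remQuot-combine; combine-surjective; toℕ<n; toℕ-injective; toℕ-fromℕ<; combine-injective)
open import Data.Fin.Subset using (Subset; _∩_; ∁; ∣_∣) renaming (_∈_ to _∈ˢ_)
open import Data.Fin.Subset.Properties using (_∈?_)
import Data.Vec as Vec
import Data.Vec.Properties as Vec
open import Data.List using (List; []; _∷_; _++_; map; concatMap; length; filter; allFin; upTo; tabulate)
open import Data.List.Properties using (map-++; map-cong; map-∘; map-tabulate; map-applyUpTo; length-tabulate; map-upTo; length-upTo; length-map; length-++)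
open import Data.List.Relation.Unary.All using (All; []; _∷_)
import Data.List.Relation.Unary.All as All
import Data.List.Relation.Unary.All.Properties as All
open import Data.Product using (_×_; _,_; proj₁; proj₂; Σ-syntax)
open import Data.Sum using (_⊎_; inj₁; inj₂)
open import Function using (_∘_; id; const)
open import Relation.Nullary using (Dec; yes; no; does; ¬_; contradiction)
open import Relation.Nullary.Decidable using (_×-dec_; from-yes; from-no)
open import Relation.Binary.PropositionalEquality
import Data.Nat.Divisibility as ℕ
open import Data.Integer as ℤ using (ℤ; +_; -[1+_]; _%ℕ_; _/ℕ_)
import Data.Integer.Properties as ℤ
open import Data.Integer.DivMod using (n%ℕd<d; a≡a%ℕn+[a/ℕn]*n)
open import Data.Integer.Divisibility.Signed as ℤ∣ using (_∣?_; divides) renaming (_∣_ to _∣ᶻ_)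
import Data.Integer.Tactic.RingSolver as ℤ-Solver
open import Data.Vec using (Vec; []; _∷_; lookup; zip)
open import Data.List.Relation.Binary.Permutation.Propositional.Properties using (map⁺)
import Data.List.Sort.InsertionSort.Base as Sort
import Data.List.Sort.InsertionSort.Properties as SortProperties
open import Data.Product.Relation.Binary.Lex.NonStrict using (×-decTotalOrder)
open import Data.Integer as ℤ using (ℤ; +_; -[1+_]; -1ℤ)
open import Data.List.Relation.Binary.Pointwise using (Pointwise; []; _∷_)
open import Data.Nat.Coprimality using (Coprime; coprime-divisor)
open import Data.Nat.Primality using (Prime; prime?; euclidsLemma)
open import Data.List.Membership.Propositional using (_∈_)
open import Data.List.Relation.Unary.Any using (here; there)

open ≡-Reasoning

-- Every pattern is used in all cyclic rotations of its fibres, so μ is five times the number of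
-- patterns up to rotation, and counting pairs makes that number λ₀(n - 1)/20. With λ₀ = 10 for odd
-- n and λ₀ = 20 for even n it is (n - 1)/2 or n - 1. At the minimal indices it would be (n - 1)/4
-- or (n - 1)/2, which is not an integer for n ≡ 3 mod 4 and for even n respectively: doubling is
-- what lets one uniform construction work. The delicate point is the parameter s = 0. Where all
-- forms are multiples of s, only s = 0 degenerates, but leaving out just this value would require a
-- single replacement pattern with cross pairs and no internal differences, which five points on at
-- most three fibres cannot provide. Leaving out s = 1 and s = -1 as well makes room: their
-- differences are redistributed over patterns with other splittings of the five points. That the
-- differences agree is a finite identity between symbolic lists, valid for all k at once.

private variable
  A B : Set

-- Finite sums

∑ : List A → (A → ℕ) → ℕ
∑ xs f = sum (map f xs)

infixr 5 ∑
syntax ∑ xs (λ x → e) = ∑[ x ∈ xs ] e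

∑-cong : (xs : List A) {f g : A → ℕ} → (∀ x → f x ≡ g x) → ∑ xs f ≡ ∑ xs g
∑-cong xs eq = cong sum (map-cong eq xs)

∑-cong-All : {f g : A → ℕ} {xs : List A} → All (λ x → f x ≡ g x) xs → ∑ xs f ≡ ∑ xs g
∑-cong-All []         = refl
∑-cong-All (eq ∷ eqs) = cong₂ _+_ eq (∑-cong-All eqs)

∑-++ : (xs ys : List A) (f : A → ℕ) → ∑ (xs ++ ys) f ≡ ∑ xs f + ∑ ys f
∑-++ xs ys f = trans (cong sum (map-++ f xs ys)) (sum-++ (map f xs) (map f ys))

∑-concatMap : (h : A → List B) (xs : List A) (f : B → ℕ) →
              ∑ (concatMap h xs) f ≡ ∑[ x ∈ xs ] ∑ (h x) f
∑-concatMap h []       f = refl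
∑-concatMap h (x ∷ xs) f =
  trans (∑-++ (h x) (concatMap h xs) f) (cong (λ t → ∑ (h x) f + t) (∑-concatMap h xs f))

∑-map : (h : A → B) (xs : List A) (f : B → ℕ) → ∑ (map h xs) f ≡ ∑ xs (f ∘ h)
∑-map h xs f = cong sum (sym (map-∘ xs))

∑-+ : (xs : List A) (f g : A → ℕ) → (∑[ x ∈ xs ] f x + g x) ≡ ∑ xs f + ∑ xs g
∑-+ []       f g = refl
∑-+ (x ∷ xs) f g rewrite ∑-+ xs f g = interchange (f x) (g x) (∑ xs f) (∑ xs g)
  where
  interchange : ∀ a b c d → a + b + (c + d) ≡ a + c + (b + d)
  interchange = solve-∀

∑-*ˡ : (xs : List A) (c : ℕ) (f : A → ℕ) → (∑[ x ∈ xs ] c * f x) ≡ c * ∑ xs f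
∑-*ˡ []       c f = sym (*-zeroʳ c)
∑-*ˡ (x ∷ xs) c f rewrite ∑-*ˡ xs c f = sym (*-distribˡ-+ c (f x) (∑ xs f))

∑-*ʳ : (xs : List A) (c : ℕ) (f : A → ℕ) → (∑[ x ∈ xs ] f x * c) ≡ ∑ xs f * c
∑-*ʳ xs c f = trans (∑-cong xs (λ x → *-comm (f x) c)) (trans (∑-*ˡ xs c f) (*-comm c _))

∑-const : (xs : List A) (c : ℕ) → ∑ xs (const c) ≡ length xs * c
∑-const []       c = refl
∑-const (x ∷ xs) c = cong (λ t → c + t) (∑-const xs c)

∑-const-All : (xs : List A) (f : A → ℕ) {c : ℕ} → All (λ x → f x ≡ c) xs → ∑ xs f ≡ length xs * c
∑-const-All xs f {c} eqs = trans (∑-cong-All eqs) (∑-const xs c)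

∑-swap : (xs : List A) (ys : List B) (f : A → B → ℕ) →
         (∑[ x ∈ xs ] ∑[ y ∈ ys ] f x y) ≡ (∑[ y ∈ ys ] ∑[ x ∈ xs ] f x y)
∑-swap []       ys f = sym (trans (∑-const ys 0) (*-zeroʳ (length ys)))
∑-swap (x ∷ xs) ys f rewrite ∑-swap xs ys f = sym (∑-+ ys (f x) (λ y → ∑[ x ∈ xs ] f x y))

∑-*-∑ : (xs : List A) (ys : List B) (f : A → ℕ) (g : B → ℕ) →
        ∑ xs f * ∑ ys g ≡ (∑[ x ∈ xs ] ∑[ y ∈ ys ] f x * g y)
∑-*-∑ xs ys f g =
  trans (sym (∑-*ʳ xs (∑ ys g) f)) (∑-cong xs (λ x → sym (∑-*ˡ ys (f x) g)))

∑-upTo-suc : ∀ n (f : ℕ → ℕ) → ∑ (upTo (suc n)) f ≡ f 0 + ∑ (upTo n) (f ∘ suc)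
∑-upTo-suc n f = cong (λ xs → f 0 + sum xs)
  (trans (map-applyUpTo suc f n) (sym (map-upTo (f ∘ suc) n)))

∑-upTo-+ : ∀ m n (f : ℕ → ℕ) → ∑ (upTo (m + n)) f ≡ ∑ (upTo m) f + ∑ (upTo n) (λ i → f (m + i))
∑-upTo-+ zero    n f = refl
∑-upTo-+ (suc m) n f
  rewrite ∑-upTo-suc (m + n) f | ∑-upTo-suc m f | ∑-upTo-+ m n (f ∘ suc) =
  sym (+-assoc (f 0) (∑ (upTo m) (f ∘ suc)) (∑[ i ∈ upTo n ] f (suc (m + i))))

∑-upTo-cong : ∀ n {f g : ℕ → ℕ} → (∀ {i} → i < n → f i ≡ g i) → ∑ (upTo n) f ≡ ∑ (upTo n) g
∑-upTo-cong zero    eq = refl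
∑-upTo-cong (suc n) {f} {g} eq = begin
  ∑ (upTo (suc n)) f               ≡⟨ ∑-upTo-suc n f ⟩
  f 0 + ∑ (upTo n) (f ∘ suc)       ≡⟨ cong₂ _+_ (eq z<s) (∑-upTo-cong n (eq ∘ s<s)) ⟩
  g 0 + ∑ (upTo n) (g ∘ suc)       ≡⟨ ∑-upTo-suc n g ⟨
  ∑ (upTo (suc n)) g               ∎

∑-upTo-last : ∀ n (f : ℕ → ℕ) → ∑ (upTo (suc n)) f ≡ ∑ (upTo n) f + f n
∑-upTo-last n f = begin
  ∑ (upTo (suc n)) f                    ≡⟨ cong (λ m → ∑ (upTo m) f) (+-comm 1 n) ⟩
  ∑ (upTo (n + 1)) f                    ≡⟨ ∑-upTo-+ n 1 f ⟩
  ∑ (upTo n) f + (f (n + 0) + 0)        ≡⟨ cong (λ t → ∑ (upTo n) f + t) (trans (+-identityʳ _) (cong f (+-identityʳ n))) ⟩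
  ∑ (upTo n) f + f n                    ∎

∑-allFin-suc : ∀ n (f : Fin (suc n) → ℕ) → ∑ (allFin (suc n)) f ≡ f zero + ∑ (allFin n) (f ∘ suc)
∑-allFin-suc n f = cong (λ xs → f zero + sum xs)
  (trans (map-tabulate suc f) (sym (map-tabulate id (f ∘ suc))))

∑-allFin-const : ∀ n c → ∑ (allFin n) (const c) ≡ n * c
∑-allFin-const n c = trans (∑-const (allFin n) c) (cong (λ m → m * c) (length-tabulate {n = n} id))

∑-allFin-toℕ : ∀ n (f : ℕ → ℕ) → ∑ (allFin n) (f ∘ toℕ) ≡ ∑ (upTo n) f
∑-allFin-toℕ zero    f = refl
∑-allFin-toℕ (suc n) f = begin
  ∑ (allFin (suc n)) (f ∘ toℕ)            ≡⟨ ∑-allFin-suc n (f ∘ toℕ) ⟩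
  f 0 + ∑ (allFin n) (f ∘ suc ∘ toℕ)      ≡⟨ cong (λ t → f 0 + t) (∑-allFin-toℕ n (f ∘ suc)) ⟩
  f 0 + ∑ (upTo n) (f ∘ suc)              ≡⟨ ∑-upTo-suc n f ⟨
  ∑ (upTo (suc n)) f                      ∎

∑-allFin-+ : ∀ m n (f : Fin (m + n) → ℕ) →
             ∑ (allFin (m + n)) f ≡ (∑[ i ∈ allFin m ] f (i ↑ˡ n)) + (∑[ j ∈ allFin n ] f (m ↑ʳ j))
∑-allFin-+ zero    n f = refl
∑-allFin-+ (suc m) n f
  rewrite ∑-allFin-suc (m + n) f | ∑-allFin-suc m (λ i → f (i ↑ˡ n)) | ∑-allFin-+ m n (f ∘ suc) =
  sym (+-assoc (f zero) _ _)

∑-allFin-combine : ∀ m n (f : Fin (m * n) → ℕ) →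
                   ∑ (allFin (m * n)) f ≡ (∑[ i ∈ allFin m ] ∑[ j ∈ allFin n ] f (combine i j))
∑-allFin-combine zero    n f = refl
∑-allFin-combine (suc m) n f = begin
  ∑ (allFin (n + m * n)) f
    ≡⟨ ∑-allFin-+ n (m * n) f ⟩
  F zero + ∑ (allFin (m * n)) (f ∘ (n ↑ʳ_))
    ≡⟨ cong (λ t → F zero + t) (∑-allFin-combine m n (f ∘ (n ↑ʳ_))) ⟩
  F zero + ∑ (allFin m) (F ∘ suc)
    ≡⟨ ∑-allFin-suc m F ⟨
  ∑ (allFin (suc m)) F ∎
  where
  F : Fin (suc m) → ℕ
  F i = ∑[ j ∈ allFin n ] f (combine i j)

-- Indicators

ind : {P : Set} → Dec P → ℕ
ind P? = if does P? then 1 else 0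

ind-yes : {P : Set} (P? : Dec P) → P → ind P? ≡ 1
ind-yes (yes _) p = refl
ind-yes (no ¬p) p = contradiction p ¬p

ind-no : {P : Set} (P? : Dec P) → ¬ P → ind P? ≡ 0
ind-no (yes p) ¬p = contradiction p ¬p
ind-no (no _)  ¬p = refl

ind-cong : {P Q : Set} (P? : Dec P) (Q? : Dec Q) → (P → Q) → (Q → P) → ind P? ≡ ind Q?
ind-cong (yes p) Q? f g = sym (ind-yes Q? (f p))
ind-cong (no ¬p) Q? f g = sym (ind-no Q? (¬p ∘ g))

ind-× : {P Q : Set} (P? : Dec P) (Q? : Dec Q) → ind (P? ×-dec Q?) ≡ ind P? * ind Q?
ind-× (yes _) (yes _) = refl
ind-× (yes _) (no _)  = refl
ind-× (no _)  _       = refl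

length-filter : {P : A → Set} (P? : ∀ x → Dec (P x)) (xs : List A) →
                length (filter P? xs) ≡ ∑[ x ∈ xs ] ind (P? x)
length-filter P? []       = refl
length-filter P? (x ∷ xs) with P? x
... | yes _ = cong suc (length-filter P? xs)
... | no  _ = length-filter P? xs

∑-ind : ∀ {n} (t : Fin n) (h : Fin n → ℕ) → (∑[ x ∈ allFin n ] ind (x ≟ t) * h x) ≡ h t
∑-ind {suc n} zero h = begin
  (∑[ x ∈ allFin (suc n) ] ind (x ≟ zero) * h x)
    ≡⟨ ∑-allFin-suc n (λ x → ind (x ≟ zero) * h x) ⟩
  h zero + 0 + ∑ (allFin n) (const 0)
    ≡⟨ cong₂ _+_ (+-identityʳ (h zero)) (trans (∑-allFin-const n 0) (*-zeroʳ n)) ⟩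
  h zero + 0
    ≡⟨ +-identityʳ (h zero) ⟩
  h zero ∎
∑-ind {suc n} (suc t) h = trans
  (∑-allFin-suc n (λ x → ind (x ≟ suc t) * h x))
  (trans (∑-cong (allFin n) λ x → cong (_* h (suc x)) (ind-cong (suc x ≟ suc t) (x ≟ t) suc-injective (cong suc)))
         (∑-ind t (h ∘ suc)))

∑-ind′ : ∀ {n} (t : Fin n) → (∑[ x ∈ allFin n ] ind (x ≟ t)) ≡ 1
∑-ind′ {n} t = trans (∑-cong (allFin n) (λ x → sym (*-identityʳ _))) (∑-ind t (const 1))

-- The summand `c` on the left stands in for the exceptional term at `x`, so that no truncated
-- subtraction is needed.
∑-allFin-except : ∀ {n} (x : Fin n) {f : Fin n → ℕ} {c : ℕ} → (∀ y → x ≢ y → f y ≡ c) →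
                  ∑ (allFin n) f + c ≡ f x + n * c
∑-allFin-except {n} x {f} {c} eq = begin
  ∑ (allFin n) f + c
    ≡⟨ cong (λ t → ∑ (allFin n) f + t) (∑-ind x (const c)) ⟨
  ∑ (allFin n) f + (∑[ y ∈ allFin n ] ind (y ≟ x) * c)
    ≡⟨ ∑-+ (allFin n) f _ ⟨
  (∑[ y ∈ allFin n ] f y + ind (y ≟ x) * c)
    ≡⟨ ∑-cong (allFin n) pointwise ⟩
  (∑[ y ∈ allFin n ] ind (y ≟ x) * f y + c)
    ≡⟨ ∑-+ (allFin n) _ (const c) ⟩
  (∑[ y ∈ allFin n ] ind (y ≟ x) * f y) + ∑ (allFin n) (const c)
    ≡⟨ cong₂ _+_ (∑-ind x f) (∑-allFin-const n c) ⟩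
  f x + n * c ∎
  where
  pointwise : ∀ y → f y + ind (y ≟ x) * c ≡ ind (y ≟ x) * f y + c
  pointwise y with y ≟ x
  ... | yes _   = trans (cong (λ t → f y + t) (+-identityʳ c)) (cong (_+ c) (sym (+-identityʳ (f y))))
  ... | no y≢x  = trans (+-identityʳ (f y)) (eq y (y≢x ∘ sym))

-- Subsets of Fin (m * n) given by a decidable predicate on rows and columns

⟨_⟩ : ∀ {m n} → (Fin m → Fin n → Bool) → Subset (m * n)
⟨_⟩ {m} {n} b = Vec.tabulate λ z → b (proj₁ (remQuot {m} n z)) (proj₂ (remQuot {m} n z))

bit : Bool → ℕ
bit b = if b then 1 else 0

∣tabulate∣ : ∀ {n} (b : Fin n → Bool) → ∣ Vec.tabulate b ∣ ≡ ∑ (allFin n) (bit ∘ b)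
∣tabulate∣ {zero}  b = refl
∣tabulate∣ {suc n} b rewrite ∑-allFin-suc n (bit ∘ b) with b zero
... | true  = cong suc (∣tabulate∣ (b ∘ suc))
... | false = ∣tabulate∣ (b ∘ suc)

module _ {m n : ℕ} (b : Fin m → Fin n → Bool) where

  lookup-⟨⟩ : ∀ i x → Vec.lookup ⟨ b ⟩ (combine i x) ≡ b i x
  lookup-⟨⟩ i x = trans (Vec.lookup∘tabulate _ (combine i x))
    (cong (λ p → b (proj₁ p) (proj₂ p)) (remQuot-combine i x))

  ind-∈-⟨⟩ : ∀ i x → ind (combine i x ∈? ⟨ b ⟩) ≡ bit (b i x)
  ind-∈-⟨⟩ i x with b i x in eq
  ... | true  = ind-yes (_ ∈? ⟨ b ⟩) (Vec.lookup⇒[]= _ _ (trans (lookup-⟨⟩ i x) eq))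
  ... | false = ind-no (_ ∈? ⟨ b ⟩) λ z∈ →
    contradiction (trans (sym (Vec.[]=⇒lookup z∈)) (trans (lookup-⟨⟩ i x) eq)) λ ()

  ∣⟨⟩∣ : ∣ ⟨ b ⟩ ∣ ≡ ∑[ i ∈ allFin m ] ∑[ x ∈ allFin n ] bit (b i x)
  ∣⟨⟩∣ = begin
    ∣ ⟨ b ⟩ ∣
      ≡⟨ ∣tabulate∣ (λ z → b (proj₁ (remQuot {m} n z)) (proj₂ (remQuot {m} n z))) ⟩
    (∑[ z ∈ allFin (m * n) ] bit (b (proj₁ (remQuot {m} n z)) (proj₂ (remQuot {m} n z))))
      ≡⟨ ∑-allFin-combine m n _ ⟩
    (∑[ i ∈ allFin m ] ∑[ x ∈ allFin n ]
      bit (b (proj₁ (remQuot {m} n (combine i x))) (proj₂ (remQuot {m} n (combine i x)))))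
      ≡⟨ ∑-cong (allFin m) (λ i → ∑-cong (allFin n) λ x →
           cong (λ p → bit (b (proj₁ p) (proj₂ p))) (remQuot-combine i x)) ⟩
    (∑[ i ∈ allFin m ] ∑[ x ∈ allFin n ] bit (b i x)) ∎

tabulate-∩ : ∀ {m} (f g : Fin m → Bool) →
             Vec.tabulate f ∩ Vec.tabulate g ≡ Vec.tabulate (λ x → f x ∧ g x)
tabulate-∩ {zero}  f g = refl
tabulate-∩ {suc m} f g = cong (f zero ∧ g zero Vec.∷_) (tabulate-∩ (f ∘ suc) (g ∘ suc))

-- Configuration (1,5) from one group

occ : ∀ {n} → List (Fin n) → Fin n → ℕ
occ p x = ∑[ t ∈ p ] ind (x ≟ t)

∑-occ : ∀ {n} (p : List (Fin n)) → ∑ (allFin n) (occ p) ≡ length p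
∑-occ {n} p = begin
  (∑[ x ∈ allFin n ] ∑[ t ∈ p ] ind (x ≟ t)) ≡⟨ ∑-swap (allFin n) p _ ⟩
  (∑[ t ∈ p ] ∑[ x ∈ allFin n ] ind (x ≟ t)) ≡⟨ ∑-cong p ∑-ind′ ⟩
  ∑ p (const 1)                              ≡⟨ ∑-const p 1 ⟩
  length p * 1                               ≡⟨ *-identityʳ (length p) ⟩
  length p                                   ∎

m≤m² : ∀ m → m ≤ m * m
m≤m² zero    = z≤n
m≤m² (suc m) = m≤m+n (suc m) (m * suc m)

≤-∑ : {f g : A → ℕ} (xs : List A) → (∀ x → f x ≤ g x) → ∑ xs f ≤ ∑ xs g
≤-∑ []       f≤g = z≤n
≤-∑ (x ∷ xs) f≤g = +-mono-≤ (f≤g x) (≤-∑ xs f≤g)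

∑-≡⇒All-≡ : {f g : A → ℕ} (xs : List A) → (∀ x → f x ≤ g x) → ∑ xs f ≡ ∑ xs g →
            All (λ x → f x ≡ g x) xs
∑-≡⇒All-≡ []       f≤g eq = []
∑-≡⇒All-≡ {f = f} {g} (x ∷ xs) f≤g eq = fx≡gx ∷ ∑-≡⇒All-≡ xs f≤g
  (+-cancelˡ-≡ (f x) _ _ (trans eq (cong (_+ ∑ xs g) (sym fx≡gx))))
  where
  fx≡gx : f x ≡ g x
  fx≡gx = ≤-antisym (f≤g x) (+-cancelʳ-≤ (∑ xs g) (g x) (f x)
    (≤-trans (≤-reflexive (sym eq)) (+-monoʳ-≤ (f x) (≤-∑ xs f≤g))))

All-∀ : ∀ {n} {P : Fin n → A → Set} {xs : List A} → (∀ i → All (P i) xs) → All (λ x → ∀ i → P i x) xs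
All-∀ {xs = []}     h = []
All-∀ {xs = x ∷ xs} h = (λ i → All.head (h i)) ∷ All-∀ (All.tail ∘ h)

module Mirror
  (n λ₁ μ : ℕ) (bs : List (Fin n × List (Fin n)))
  (five  : All (λ B → length (proj₂ B) ≡ 5) bs)
  (pair  : ∀ x y → x ≢ y → (∑[ B ∈ bs ] occ (proj₂ B) x * occ (proj₂ B) y) ≡ λ₁)
  (cross : ∀ x b → (∑[ B ∈ bs ] occ (proj₂ B) x * ind (b ≟ proj₁ B)) ≡ μ)
  -- The identity r(5 - 1) = λ₁(n - 1) for a design with blocks of size 5 and r = nμ, cleared of
  -- subtraction.
  (λ₁-μ  : 4 * (n * μ) + λ₁ ≡ n * λ₁)
  where

  pt : Fin 2 → Fin n → Fin (2 * n)
  pt = combine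

  subset : (Fin 2 → Fin n → Bool) → Subset (2 * n)
  subset = ⟨_⟩

  pts : Fin n × List (Fin n) → List (Fin n)
  pts = proj₂

  single : Fin n × List (Fin n) → Fin n
  single = proj₁

  ∑-occ≡nμ : ∀ x → (∑[ B ∈ bs ] occ (pts B) x) ≡ n * μ
  ∑-occ≡nμ x = begin
    (∑[ B ∈ bs ] occ (pts B) x)
      ≡⟨ ∑-cong bs (λ B → trans (cong (occ (pts B) x *_) (∑-ind′ (single B))) (*-identityʳ _)) ⟨
    (∑[ B ∈ bs ] occ (pts B) x * (∑[ b ∈ allFin n ] ind (b ≟ single B)))
      ≡⟨ ∑-cong bs (λ B → sym (∑-*ˡ (allFin n) (occ (pts B) x) _)) ⟩
    (∑[ B ∈ bs ] ∑[ b ∈ allFin n ] occ (pts B) x * ind (b ≟ single B))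
      ≡⟨ ∑-swap bs (allFin n) _ ⟩
    (∑[ b ∈ allFin n ] ∑[ B ∈ bs ] occ (pts B) x * ind (b ≟ single B))
      ≡⟨ ∑-cong (allFin n) (cross x) ⟩
    ∑ (allFin n) (const μ)
      ≡⟨ ∑-allFin-const n μ ⟩
    n * μ ∎

  -- Double counting of incidences between points and blocks of colour `b`: five for each block, μ
  -- for each point.
  5∑-single≡nμ : ∀ b → 5 * (∑[ B ∈ bs ] ind (b ≟ single B)) ≡ n * μ
  5∑-single≡nμ b = begin
    5 * (∑[ B ∈ bs ] ind (b ≟ single B))
      ≡⟨ ∑-*ˡ bs 5 _ ⟨
    (∑[ B ∈ bs ] 5 * ind (b ≟ single B))
      ≡⟨ ∑-cong-All (All.map (λ {B} eq → cong (_* ind (b ≟ single B)) (sym (trans (∑-occ (pts B)) eq))) five) ⟩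
    (∑[ B ∈ bs ] ∑ (allFin n) (occ (pts B)) * ind (b ≟ single B))
      ≡⟨ ∑-cong bs (λ B → sym (∑-*ʳ (allFin n) (ind (b ≟ single B)) (occ (pts B)))) ⟩
    (∑[ B ∈ bs ] ∑[ x ∈ allFin n ] occ (pts B) x * ind (b ≟ single B))
      ≡⟨ ∑-swap bs (allFin n) _ ⟩
    (∑[ x ∈ allFin n ] ∑[ B ∈ bs ] occ (pts B) x * ind (b ≟ single B))
      ≡⟨ ∑-cong (allFin n) (λ x → cross x b) ⟩
    ∑ (allFin n) (const μ)
      ≡⟨ ∑-allFin-const n μ ⟩
    n * μ ∎

  5∑-occ : ∀ x → (∑[ y ∈ allFin n ] ∑[ B ∈ bs ] occ (pts B) x * occ (pts B) y) ≡ 5 * (n * μ)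
  5∑-occ x = begin
    (∑[ y ∈ allFin n ] ∑[ B ∈ bs ] occ (pts B) x * occ (pts B) y)
      ≡⟨ ∑-swap (allFin n) bs _ ⟩
    (∑[ B ∈ bs ] ∑[ y ∈ allFin n ] occ (pts B) x * occ (pts B) y)
      ≡⟨ ∑-cong bs (λ B → ∑-*ˡ (allFin n) (occ (pts B) x) (occ (pts B))) ⟩
    (∑[ B ∈ bs ] occ (pts B) x * ∑ (allFin n) (occ (pts B)))
      ≡⟨ ∑-cong-All (All.map (λ {B} eq → cong (occ (pts B) x *_) (trans (∑-occ (pts B)) eq)) five) ⟩
    (∑[ B ∈ bs ] occ (pts B) x * 5)
      ≡⟨ ∑-*ʳ bs 5 _ ⟩
    (∑[ B ∈ bs ] occ (pts B) x) * 5
      ≡⟨ cong (_* 5) (∑-occ≡nμ x) ⟩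
    n * μ * 5
      ≡⟨ *-comm (n * μ) 5 ⟩
    5 * (n * μ) ∎

  -- The pair counts leave no room for a point to be repeated within a block.
  ∑-occ² : ∀ x → (∑[ B ∈ bs ] occ (pts B) x) ≡ (∑[ B ∈ bs ] occ (pts B) x * occ (pts B) x)
  ∑-occ² x = +-cancelʳ-≡ (n * λ₁) _ _ (begin
    (∑[ B ∈ bs ] occ (pts B) x) + n * λ₁
      ≡⟨ cong₂ _+_ (∑-occ≡nμ x) (sym λ₁-μ) ⟩
    n * μ + (4 * (n * μ) + λ₁)
      ≡⟨ +-assoc (n * μ) (4 * (n * μ)) λ₁ ⟨
    5 * (n * μ) + λ₁
      ≡⟨ cong (_+ λ₁) (5∑-occ x) ⟨
    (∑[ y ∈ allFin n ] ∑[ B ∈ bs ] occ (pts B) x * occ (pts B) y) + λ₁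
      ≡⟨ ∑-allFin-except x (pair x) ⟩
    (∑[ B ∈ bs ] occ (pts B) x * occ (pts B) x) + n * λ₁ ∎)

  -- A multiplicity m satisfies m ≤ m², and the totals of m and m² agree, so equality holds in every
  -- block and m is 0 or 1.
  simple : All (λ B → ∀ x → occ (pts B) x ≡ occ (pts B) x * occ (pts B) x) bs
  simple = All-∀ (λ x → ∑-≡⇒All-≡ bs (λ B → m≤m² (occ (pts B) x)) (∑-occ² x))

  _∋_ : List (Fin n) → Fin n → Bool
  p ∋ x = does (0 <? occ p x)

  bit-∋ : ∀ p x → occ p x ≡ occ p x * occ p x → bit (p ∋ x) ≡ occ p x
  bit-∋ p x eq with occ p x
  ... | zero        = refl
  ... | suc zero    = refl
  ... | suc (suc m) = contradiction (*-cancelˡ-≡ 1 (2 + m) (2 + m) (trans (*-identityʳ (2 + m)) eq)) λ ()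

  member : (i : Fin 2) → Fin n × List (Fin n) → Fin 2 → Fin n → Bool
  member zero       B zero       x = pts B ∋ x
  member zero       B (suc zero) x = does (x ≟ single B)
  member (suc zero) B zero       x = does (x ≟ single B)
  member (suc zero) B (suc zero) x = pts B ∋ x

  block : Fin 2 → Fin n × List (Fin n) → Subset (2 * n)
  block i B = subset (member i B)

  blocks : List (Subset (2 * n))
  blocks = map (block zero) bs ++ map (block (suc zero)) bs

  inG : Fin 2 → Bool
  inG zero    = true
  inG (suc _) = false

  G : Subset (2 * n)
  G = subset (λ i _ → inG i)

  ∑-bit-∋ : ∀ {B} → length (pts B) ≡ 5 → (∀ x → occ (pts B) x ≡ occ (pts B) x * occ (pts B) x) →
            (∑[ x ∈ allFin n ] bit (pts B ∋ x)) ≡ 5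
  ∑-bit-∋ {B} len simp =
    trans (∑-cong (allFin n) (λ x → bit-∋ (pts B) x (simp x))) (trans (∑-occ (pts B)) len)

  subset-∩ : ∀ b c → subset b ∩ subset c ≡ subset (λ i x → b i x ∧ c i x)
  subset-∩ b c = tabulate-∩ {2 * n} _ _

  ∁-subset : ∀ b → ∁ (subset b) ≡ subset (λ i x → not (b i x))
  ∁-subset b = sym (Vec.tabulate-∘ {n = 2 * n} not _)

  ∑0 : (xs : List A) → ∑ xs (const 0) ≡ 0
  ∑0 xs = trans (∑-const xs 0) (*-zeroʳ (length xs))

  ∑-if : (c : Bool) (xs : List A) (f : A → Bool) → (∑[ x ∈ xs ] bit (f x ∧ c)) ≡ (if c then ∑ xs (bit ∘ f) else 0)
  ∑-if true  xs f = ∑-cong xs (λ x → cong bit (∧-identityʳ (f x)))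
  ∑-if false xs f = trans (∑-cong xs (λ x → cong bit (∧-zeroʳ (f x)))) (∑0 xs)

  ∣∩G∣ : (b : Fin 2 → Fin n → Bool) → ∣ subset b ∩ G ∣ ≡ ∑[ x ∈ allFin n ] bit (b zero x)
  ∣∩G∣ b = begin
    ∣ subset b ∩ G ∣
      ≡⟨ cong ∣_∣ (subset-∩ b λ i _ → inG i) ⟩
    ∣ subset (λ i x → b i x ∧ inG i) ∣
      ≡⟨ ∣⟨⟩∣ {2} {n} (λ i x → b i x ∧ inG i) ⟩
    (∑[ x ∈ allFin n ] bit (b zero x ∧ true)) + ((∑[ x ∈ allFin n ] bit (b (suc zero) x ∧ false)) + 0)
      ≡⟨ cong₂ (λ u v → u + (v + 0)) (∑-if true (allFin n) (b zero)) (∑-if false (allFin n) (b (suc zero))) ⟩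
    (∑[ x ∈ allFin n ] bit (b zero x)) + 0
      ≡⟨ +-identityʳ _ ⟩
    (∑[ x ∈ allFin n ] bit (b zero x)) ∎

  ∣∩∁G∣ : (b : Fin 2 → Fin n → Bool) → ∣ subset b ∩ ∁ G ∣ ≡ ∑[ x ∈ allFin n ] bit (b (suc zero) x)
  ∣∩∁G∣ b = begin
    ∣ subset b ∩ ∁ G ∣
      ≡⟨ cong (λ H → ∣ subset b ∩ H ∣) (∁-subset λ i _ → inG i) ⟩
    ∣ subset b ∩ subset (λ i _ → not (inG i)) ∣
      ≡⟨ cong ∣_∣ (subset-∩ b λ i _ → not (inG i)) ⟩
    ∣ subset (λ i x → b i x ∧ not (inG i)) ∣
      ≡⟨ ∣⟨⟩∣ {2} {n} (λ i x → b i x ∧ not (inG i)) ⟩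
    (∑[ x ∈ allFin n ] bit (b zero x ∧ false)) + ((∑[ x ∈ allFin n ] bit (b (suc zero) x ∧ true)) + 0)
      ≡⟨ cong₂ (λ u v → u + (v + 0)) (∑-if false (allFin n) (b zero)) (∑-if true (allFin n) (b (suc zero))) ⟩
    (∑[ x ∈ allFin n ] bit (b (suc zero) x)) + 0
      ≡⟨ +-identityʳ _ ⟩
    (∑[ x ∈ allFin n ] bit (b (suc zero) x)) ∎

  All-blocks : {P : Subset (2 * n) → Set} →
    (∀ i B → length (pts B) ≡ 5 → (∀ x → occ (pts B) x ≡ occ (pts B) x * occ (pts B) x) → P (block i B)) →
    All P blocks
  All-blocks h = All.++⁺ (All.map⁺ (side zero)) (All.map⁺ (side (suc zero)))
    where
    side : ∀ i → All (λ B → _) bs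
    side i = All.zipWith (λ {B} (len , simp) → h i B len simp) (five , simple)

  split-block : ∀ i B → length (pts B) ≡ 5 → (∀ x → occ (pts B) x ≡ occ (pts B) x * occ (pts B) x) →
    (∣ block i B ∩ G ∣ ≡ 1 × ∣ block i B ∩ ∁ G ∣ ≡ 5) ⊎ (∣ block i B ∩ G ∣ ≡ 5 × ∣ block i B ∩ ∁ G ∣ ≡ 1)
  split-block zero B len simp = inj₂
    ( trans (∣∩G∣ (member zero B)) (∑-bit-∋ {B} len simp)
    , trans (∣∩∁G∣ (member zero B)) (∑-ind′ (single B)) )
  split-block (suc zero) B len simp = inj₁
    ( trans (∣∩G∣ (member (suc zero) B)) (∑-ind′ (single B))
    , trans (∣∩∁G∣ (member (suc zero) B)) (∑-bit-∋ {B} len simp) )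

  size-block : ∀ i B → length (pts B) ≡ 5 → (∀ x → occ (pts B) x ≡ occ (pts B) x * occ (pts B) x) →
               ∣ block i B ∣ ≡ 6
  size-block zero B len simp = trans (∣⟨⟩∣ {2} {n} (member zero B))
    (cong₂ (λ u v → u + (v + 0)) (∑-bit-∋ {B} len simp) (∑-ind′ (single B)))
  size-block (suc zero) B len simp = trans (∣⟨⟩∣ {2} {n} (member (suc zero) B))
    (cong₂ (λ u v → u + (v + 0)) (∑-ind′ (single B)) (∑-bit-∋ {B} len simp))

  side-weight : Fin 2 → Fin n × List (Fin n) → Fin 2 → Fin n → ℕ
  side-weight zero       B zero       x = occ (pts B) x
  side-weight zero       B (suc zero) x = ind (x ≟ single B)
  side-weight (suc zero) B zero       x = ind (x ≟ single B)
  side-weight (suc zero) B (suc zero) x = occ (pts B) x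

  ind-∈-block : ∀ i B → (∀ x → occ (pts B) x ≡ occ (pts B) x * occ (pts B) x) →
                ∀ j x → ind (pt j x ∈? block i B) ≡ side-weight i B j x
  ind-∈-block i B simp j x = trans (ind-∈-⟨⟩ {2} {n} (member i B) j x) (weight i j)
    where
    weight : ∀ i j → bit (member i B j x) ≡ side-weight i B j x
    weight zero       zero       = bit-∋ (pts B) x (simp x)
    weight zero       (suc zero) = refl
    weight (suc zero) zero       = refl
    weight (suc zero) (suc zero) = bit-∋ (pts B) x (simp x)

  pointCount-blocks : ∀ j x → pointCount blocks (pt j x) ≡
    (∑[ B ∈ bs ] side-weight zero B j x) + (∑[ B ∈ bs ] side-weight (suc zero) B j x)
  pointCount-blocks j x = begin
    pointCount blocks (pt j x)
      ≡⟨ length-filter (pt j x ∈?_) blocks ⟩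
    (∑[ S ∈ blocks ] ind (pt j x ∈? S))
      ≡⟨ ∑-++ (map (block zero) bs) _ _ ⟩
    ∑ (map (block zero) bs) (λ S → ind (pt j x ∈? S)) + ∑ (map (block (suc zero)) bs) (λ S → ind (pt j x ∈? S))
      ≡⟨ cong₂ _+_ (side zero) (side (suc zero)) ⟩
    (∑[ B ∈ bs ] side-weight zero B j x) + (∑[ B ∈ bs ] side-weight (suc zero) B j x) ∎
    where
    side : ∀ i → ∑ (map (block i) bs) (λ S → ind (pt j x ∈? S)) ≡ ∑[ B ∈ bs ] side-weight i B j x
    side i = trans (∑-map (block i) bs _)
      (∑-cong-All (All.map (λ {B} simp → ind-∈-block i B simp j x) simple))

  pairCount-blocks : ∀ j x k y → pairCount blocks (pt j x) (pt k y) ≡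
    (∑[ B ∈ bs ] side-weight zero B j x * side-weight zero B k y)
    + (∑[ B ∈ bs ] side-weight (suc zero) B j x * side-weight (suc zero) B k y)
  pairCount-blocks j x k y = begin
    pairCount blocks (pt j x) (pt k y)
      ≡⟨ length-filter (λ S → (pt j x ∈? S) ×-dec (pt k y ∈? S)) blocks ⟩
    (∑[ S ∈ blocks ] ind ((pt j x ∈? S) ×-dec (pt k y ∈? S)))
      ≡⟨ ∑-++ (map (block zero) bs) _ _ ⟩
    ∑ (map (block zero) bs) (λ S → ind ((pt j x ∈? S) ×-dec (pt k y ∈? S)))
    + ∑ (map (block (suc zero)) bs) (λ S → ind ((pt j x ∈? S) ×-dec (pt k y ∈? S)))
      ≡⟨ cong₂ _+_ (side zero) (side (suc zero)) ⟩
    (∑[ B ∈ bs ] side-weight zero B j x * side-weight zero B k y)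
    + (∑[ B ∈ bs ] side-weight (suc zero) B j x * side-weight (suc zero) B k y) ∎
    where
    side : ∀ i → ∑ (map (block i) bs) (λ S → ind ((pt j x ∈? S) ×-dec (pt k y ∈? S)))
                 ≡ ∑[ B ∈ bs ] side-weight i B j x * side-weight i B k y
    side i = trans (∑-map (block i) bs _)
      (∑-cong-All (All.map (λ {B} simp → trans (ind-× (pt j x ∈? block i B) (pt k y ∈? block i B))
        (cong₂ _*_ (ind-∈-block i B simp j x) (ind-∈-block i B simp k y))) simple))

  single-single : ∀ {x y} → x ≢ y → (∑[ B ∈ bs ] ind (x ≟ single B) * ind (y ≟ single B)) ≡ 0
  single-single {x} {y} x≢y = trans (∑-cong bs zero-product) (∑0 bs)
    where
    zero-product : ∀ B → ind (x ≟ single B) * ind (y ≟ single B) ≡ 0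
    zero-product B with x ≟ single B
    ... | yes refl = cong (_+ 0) (ind-no (y ≟ single B) (x≢y ∘ sym))
    ... | no _     = refl

  -- The division by 5 is exact by `5∑-single≡nμ`. It gives a value that does not depend on a chosen
  -- point: nμ blocks through the point as one of five, nμ/5 through it as the single point.
  replication-number : ℕ
  replication-number = n * μ + n * μ / 5

  ∑-single : ∀ x → (∑[ B ∈ bs ] ind (x ≟ single B)) ≡ n * μ / 5
  ∑-single x = sym (trans (cong (_/ 5) (trans (sym (5∑-single≡nμ x)) (*-comm 5 (∑[ B ∈ bs ] ind (x ≟ single B))))) (m*n/n≡m _ 5))

  rows : ∀ z → Σ[ j ∈ Fin 2 ] Σ[ x ∈ Fin n ] pt j x ≡ z
  rows z = combine-surjective {2} {n} z

  replicate-blocks : ∀ z → pointCount blocks z ≡ replication-number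
  replicate-blocks z with rows z
  ... | zero , x , refl = trans (pointCount-blocks zero x) (cong₂ _+_ (∑-occ≡nμ x) (∑-single x))
  ... | suc zero , x , refl = trans (pointCount-blocks (suc zero) x)
    (trans (cong₂ _+_ (∑-single x) (∑-occ≡nμ x)) (+-comm (n * μ / 5) (n * μ)))

  lookup-G : ∀ j x → Vec.lookup G (pt j x) ≡ inG j
  lookup-G j x = lookup-⟨⟩ {2} {n} (λ i _ → inG i) j x

  ∉G : ∀ {x} → ¬ (pt (suc zero) x ∈ˢ G)
  ∉G {x} z∈G with () ← trans (sym (Vec.[]=⇒lookup z∈G)) (lookup-G (suc zero) x)

  ∉∁G : ∀ {x} → ¬ (pt zero x ∈ˢ ∁ G)
  ∉∁G {x} z∈∁G with () ← trans (sym (Vec.[]=⇒lookup z∈∁G))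
    (trans (Vec.lookup-map {n = 2 * n} (pt zero x) not G) (cong not (lookup-G zero x)))

  design : ∀ {λ₂} → λ₂ ≡ 2 * μ → Σ[ D ∈ GDD n 6 λ₁ λ₂ ] HasConfiguration 1 5 D
  design {λ₂} refl = record
    { G           = G
    ; ∣G∣≡n       = trans (∣⟨⟩∣ {2} {n} (λ i _ → inG i)) ∣G∣
    ; blocks      = blocks
    ; blockSize   = All-blocks size-block
    ; r           = replication-number
    ; replication = replicate-blocks
    ; pairs-G     = pairs-G
    ; pairs-∁G    = pairs-∁G
    ; pairs-mixed = pairs-mixed
    } , All-blocks split-block
    where
    ∣G∣ : ∑ (allFin n) (const 1) + (∑ (allFin n) (const 0) + 0) ≡ n
    ∣G∣ rewrite ∑-allFin-const n 1 | ∑0 (allFin n) | *-identityʳ n = +-identityʳ n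

    pairs-G : ∀ {x y} → x ≢ y → x ∈ˢ G → y ∈ˢ G → pairCount blocks x y ≡ λ₁
    pairs-G {x} {y} x≢y x∈G y∈G with rows x | rows y
    ... | suc zero , _ , refl | _                   = contradiction x∈G ∉G
    ... | zero , _ , refl     | suc zero , _ , refl = contradiction y∈G ∉G
    ... | zero , u , refl     | zero , v , refl     = trans (pairCount-blocks zero u zero v)
      (trans (cong₂ _+_ (pair u v (x≢y ∘ cong (pt zero))) (single-single (x≢y ∘ cong (pt zero))))
             (+-identityʳ λ₁))

    pairs-∁G : ∀ {x y} → x ≢ y → x ∈ˢ ∁ G → y ∈ˢ ∁ G → pairCount blocks x y ≡ λ₁
    pairs-∁G {x} {y} x≢y x∈ y∈ with rows x | rows y
    ... | zero , _ , refl     | _                   = contradiction x∈ ∉∁G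
    ... | suc zero , _ , refl | zero , _ , refl     = contradiction y∈ ∉∁G
    ... | suc zero , u , refl | suc zero , v , refl = trans (pairCount-blocks (suc zero) u (suc zero) v)
      (cong₂ _+_ (single-single (x≢y ∘ cong (pt (suc zero)))) (pair u v (x≢y ∘ cong (pt (suc zero)))))

    pairs-mixed : ∀ {x y} → x ∈ˢ G → y ∈ˢ ∁ G → pairCount blocks x y ≡ 2 * μ
    pairs-mixed {x} {y} x∈G y∈∁G with rows x | rows y
    ... | suc zero , _ , refl | _               = contradiction x∈G ∉G
    ... | zero , _ , refl     | zero , _ , refl = contradiction y∈∁G ∉∁G
    ... | zero , u , refl     | suc zero , v , refl = trans (pairCount-blocks zero u (suc zero) v)
      (cong₂ _+_ (cross u v) (trans (∑-cong bs (λ B → *-comm (ind (u ≟ single B)) (occ (pts B) v)))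
                                    (trans (cross v u) (sym (+-identityʳ μ)))))

-- Congruence modulo k as an indicator on ℤ.

module Residues (k : ℕ) .{{_ : NonZero k}} where

  opaque
    I : ℤ → ℕ
    I z = ind (+ k ∣? z)

    ind≡I : {P : Set} (P? : Dec P) {z : ℤ} → (P → + k ∣ᶻ z) → (+ k ∣ᶻ z → P) → ind P? ≡ I z
    ind≡I P? {z} = ind-cong P? (+ k ∣? z)

  I-iff : ∀ {z w} → (+ k ∣ᶻ z → + k ∣ᶻ w) → (+ k ∣ᶻ w → + k ∣ᶻ z) → I z ≡ I w
  I-iff {z} f g = trans (sym (ind≡I (+ k ∣? z) id id)) (ind≡I (+ k ∣? z) f g)

  I-∤ : ∀ {z} → ¬ (+ k ∣ᶻ z) → I z ≡ 0
  I-∤ {z} k∤z = trans (sym (ind≡I (+ k ∣? z) id id)) (ind-no (+ k ∣? z) k∤z)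

  ∣-resp-diff : ∀ {z w} → + k ∣ᶻ w ℤ.- z → + k ∣ᶻ z → + k ∣ᶻ w
  ∣-resp-diff {z} {w} k∣w-z k∣z = subst (+ k ∣ᶻ_) (eq w z) (ℤ∣.∣m∣n⇒∣m+n k∣w-z k∣z)
    where
    eq : ∀ w z → w ℤ.- z ℤ.+ z ≡ w
    eq = ℤ-Solver.solve-∀

  I-cong : ∀ {z w} → + k ∣ᶻ w ℤ.- z → I z ≡ I w
  I-cong {z} {w} k∣w-z = I-iff (∣-resp-diff k∣w-z)
    (∣-resp-diff (subst (+ k ∣ᶻ_) (eq w z) (ℤ∣.∣m⇒∣-m k∣w-z)))
    where
    eq : ∀ w z → ℤ.- (w ℤ.- z) ≡ z ℤ.- w
    eq = ℤ-Solver.solve-∀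

  I-neg : ∀ z → I (ℤ.- z) ≡ I z
  I-neg z = I-iff
    (subst (+ k ∣ᶻ_) (ℤ.neg-involutive z) ∘ ℤ∣.∣m⇒∣-m) ℤ∣.∣m⇒∣-m

  I-neg-≡ : ∀ {z w} → ℤ.- z ≡ w → I z ≡ I w
  I-neg-≡ {z} refl = sym (I-neg z)

  I-*-I : ∀ z w → I z * I w ≡ I z * I (w ℤ.- z)
  I-*-I z w with + k ∣? z
  ... | no k∤z  = trans (cong (_* I w) (I-∤ k∤z)) (cong (_* I (w ℤ.- z)) (sym (I-∤ k∤z)))
  ... | yes k∣z = cong (I z *_) (I-cong (subst (+ k ∣ᶻ_) (eq z w) (ℤ∣.∣m⇒∣-m k∣z)))
    where
    eq : ∀ z w → ℤ.- z ≡ w ℤ.- z ℤ.- w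
    eq = ℤ-Solver.solve-∀

  residue : ℤ → Fin k
  residue z = fromℕ< (n%ℕd<d z k)

  toℕ-residue : ∀ z → + toℕ (residue z) ≡ z ℤ.- (z /ℕ k) ℤ.* + k
  toℕ-residue z = begin
    + toℕ (residue z)              ≡⟨ cong +_ (toℕ-fromℕ< (n%ℕd<d z k)) ⟩
    + (z %ℕ k)                     ≡⟨ eq (+ (z %ℕ k)) qk ⟩
    + (z %ℕ k) ℤ.+ qk ℤ.- qk       ≡⟨ cong (ℤ._- qk) (a≡a%ℕn+[a/ℕn]*n z k) ⟨
    z ℤ.- qk                       ∎
    where
    qk : ℤ
    qk = (z /ℕ k) ℤ.* + k
    eq : ∀ a b → a ≡ a ℤ.+ b ℤ.- b
    eq = ℤ-Solver.solve-∀

  small-≡ : ∀ {u r} → u < k → r ≤ u → + k ∣ᶻ + u ℤ.- + r → u ≡ r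
  small-≡ {u} {r} u<k r≤u k∣u-r = ≤-antisym (m∸n≡0⇒m≤n (u∸r≡0 (u ∸ r) (≤-<-trans (m∸n≤m u r) u<k) k∣u∸r)) r≤u
    where
    k∣u∸r : k ℕ.∣ u ∸ r
    k∣u∸r = ℤ∣.∣⇒∣ᵤ (subst (+ k ∣ᶻ_) (trans (ℤ.[+m]-[+n]≡m⊖n u r) (ℤ.⊖-≥ r≤u)) k∣u-r)
    u∸r≡0 : ∀ m → m < k → k ℕ.∣ m → m ≡ 0
    u∸r≡0 zero    _   _   = refl
    u∸r≡0 (suc m) m<k k∣m = contradiction k∣m (ℕ.>⇒∤ m<k)

  Fin-≡ : (u r : Fin k) → + k ∣ᶻ + toℕ u ℤ.- + toℕ r → u ≡ r
  Fin-≡ u r k∣u-r with ≤-total (toℕ r) (toℕ u)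
  ... | inj₁ r≤u = toℕ-injective (small-≡ (toℕ<n u) r≤u k∣u-r)
  ... | inj₂ u≤r = sym (toℕ-injective (small-≡ (toℕ<n r) u≤r
    (subst (+ k ∣ᶻ_) (eq (+ toℕ u) (+ toℕ r)) (ℤ∣.∣m⇒∣-m k∣u-r))))
    where
    eq : ∀ w z → ℤ.- (w ℤ.- z) ≡ z ℤ.- w
    eq = ℤ-Solver.solve-∀

  -- The bridge from equality in `Fin k` to divisibility in ℤ, where all later identities can be
  -- settled by ring solving.
  ind-residue : ∀ u z → ind (u ≟ residue z) ≡ I (+ toℕ u ℤ.- z)
  ind-residue u z = ind≡I (u ≟ residue z) to from
    where
    qk : ℤ
    qk = (z /ℕ k) ℤ.* + k
    to : u ≡ residue z → + k ∣ᶻ + toℕ u ℤ.- z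
    to refl = divides (ℤ.- (z /ℕ k)) (trans (cong (ℤ._- z) (toℕ-residue z)) (eq z (z /ℕ k) (+ k)))
      where
      eq : ∀ z a b → z ℤ.- a ℤ.* b ℤ.- z ≡ ℤ.- a ℤ.* b
      eq = ℤ-Solver.solve-∀
    from : + k ∣ᶻ + toℕ u ℤ.- z → u ≡ residue z
    from k∣u-z = Fin-≡ u (residue z) (subst (+ k ∣ᶻ_)
      (trans (eq (+ toℕ u) z qk) (cong (λ r → + toℕ u ℤ.- r) (sym (toℕ-residue z))))
      (ℤ∣.∣m∣n⇒∣m+n k∣u-z (divides (z /ℕ k) refl)))
      where
      eq : ∀ u z qk → u ℤ.- z ℤ.+ qk ≡ u ℤ.- (z ℤ.- qk)
      eq = ℤ-Solver.solve-∀

  ∑-I : ∀ z → (∑[ a ∈ upTo k ] I (z ℤ.- + a)) ≡ 1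
  ∑-I z = begin
    (∑[ a ∈ upTo k ] I (z ℤ.- + a))          ≡⟨ ∑-allFin-toℕ k (λ a → I (z ℤ.- + a)) ⟨
    (∑[ a ∈ allFin k ] I (z ℤ.- + toℕ a))    ≡⟨ ∑-cong (allFin k) (λ a → trans (I-neg-≡ (eq z (+ toℕ a))) (sym (ind-residue a z))) ⟩
    (∑[ a ∈ allFin k ] ind (a ≟ residue z))  ≡⟨ ∑-ind′ (residue z) ⟩
    1                                        ∎
    where
    eq : ∀ z a → ℤ.- (z ℤ.- a) ≡ a ℤ.- z
    eq = ℤ-Solver.solve-∀

  ∑-I-affine : ∀ {f : ℕ → ℤ} z → (∀ a → f a ≡ z ℤ.- + a) → (∑[ a ∈ upTo k ] I (f a)) ≡ 1
  ∑-I-affine z eq = trans (∑-cong (upTo k) (λ a → cong I (eq a))) (∑-I z)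

  -- A translation by g matches both entries only if they are congruent, and then exactly one g
  -- does. This is how developing over all translates turns pair counts into difference counts.
  ∑-I-I : ∀ z w → (∑[ g ∈ upTo k ] I (z ℤ.- + g) * I (w ℤ.- + g)) ≡ I (w ℤ.- z)
  ∑-I-I z w = begin
    (∑[ g ∈ upTo k ] I (z ℤ.- + g) * I (w ℤ.- + g))
      ≡⟨ ∑-cong (upTo k) (λ g → trans (I-*-I (z ℤ.- + g) (w ℤ.- + g))
           (cong (λ e → I (z ℤ.- + g) * I e) (eq z w (+ g)))) ⟩
    (∑[ g ∈ upTo k ] I (z ℤ.- + g) * I (w ℤ.- z))
      ≡⟨ ∑-*ʳ (upTo k) (I (w ℤ.- z)) _ ⟩
    (∑[ g ∈ upTo k ] I (z ℤ.- + g)) * I (w ℤ.- z)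
      ≡⟨ cong (_* I (w ℤ.- z)) (∑-I z) ⟩
    1 * I (w ℤ.- z)
      ≡⟨ *-identityˡ _ ⟩
    I (w ℤ.- z) ∎
    where
    eq : ∀ z w g → w ℤ.- g ℤ.- (z ℤ.- g) ≡ w ℤ.- z
    eq = ℤ-Solver.solve-∀

-- The part (m , T) of a pattern with shift a consists of the points T + m a.
Part : Set
Part = ℤ × List ℤ

∣_∣ₚ : Part → ℕ
∣ X ∣ₚ = length (proj₂ X)

-- Difference counts within and between fibres.

module Differences (k : ℕ) .{{_ : NonZero k}} where

  open Residues k

  inner : List ℤ → ℤ → ℕ
  inner T d = ∑[ v ∈ T ] ∑[ w ∈ T ] I (d ℤ.- (w ℤ.- v))

  -- As the shift a varies, the two parts move relative to each other with speed m′ - m; the count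
  -- runs over all shifts, since each of them produces its own blocks.
  mixed : Part → Part → ℤ → ℕ
  mixed (m , T) (m′ , T′) d =
    ∑[ v ∈ T ] ∑[ w ∈ T′ ] ∑[ a ∈ upTo k ] I (d ℤ.- (w ℤ.- v ℤ.+ (m′ ℤ.- m) ℤ.* + a))

  -- Within one fibre the relative speed is 0, so each of the k shifts repeats the same internal
  -- differences.
  mixed-self : ∀ m T d → mixed (m , T) (m , T) d ≡ inner T d * k
  mixed-self m T d = begin
    mixed (m , T) (m , T) d
      ≡⟨ ∑-cong T (λ v → ∑-cong T (λ w → begin
           (∑[ a ∈ upTo k ] I (d ℤ.- (w ℤ.- v ℤ.+ (m ℤ.- m) ℤ.* + a)))
             ≡⟨ ∑-cong (upTo k) (λ a → cong I (eq d v w m (+ a))) ⟩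
           (∑[ a ∈ upTo k ] I (d ℤ.- (w ℤ.- v)))
             ≡⟨ trans (∑-const (upTo k) _) (cong (_* I (d ℤ.- (w ℤ.- v))) (length-upTo k)) ⟩
           k * I (d ℤ.- (w ℤ.- v))
             ≡⟨ *-comm k _ ⟩
           I (d ℤ.- (w ℤ.- v)) * k ∎)) ⟩
    (∑[ v ∈ T ] ∑[ w ∈ T ] I (d ℤ.- (w ℤ.- v)) * k)
      ≡⟨ trans (∑-cong T (λ v → ∑-*ʳ T k _)) (∑-*ʳ T k _) ⟩
    inner T d * k ∎
    where
    eq : ∀ d v w m a → d ℤ.- (w ℤ.- v ℤ.+ (m ℤ.- m) ℤ.* a) ≡ d ℤ.- (w ℤ.- v)
    eq = ℤ-Solver.solve-∀

  mixed-sym : ∀ X Y d → mixed X Y d ≡ mixed Y X (ℤ.- d)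
  mixed-sym (m , T) (m′ , T′) d = trans (∑-swap T T′ _)
    (∑-cong T′ (λ w → ∑-cong T (λ v → ∑-cong (upTo k) (λ a → I-neg-≡ (eq d v w m m′ (+ a))))))
    where
    eq : ∀ d v w m m′ a → ℤ.- (d ℤ.- (w ℤ.- v ℤ.+ (m′ ℤ.- m) ℤ.* a))
                          ≡ ℤ.- d ℤ.- (v ℤ.- w ℤ.+ (m ℤ.- m′) ℤ.* a)
    eq = ℤ-Solver.solve-∀

-- Developing patterns into a coloured design.

module Development (q k : ℕ) .{{_ : NonZero k}} (Π : List (Vec Part q)) where

  open Residues k
  open Differences k

  offset : Part → ℕ → ℤ → ℤ
  offset (m , _) a v = v ℤ.+ m ℤ.* + a

  points : Vec Part q → ℕ → ℕ → List (Fin (q * k))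
  points π a g = concatMap
    (λ f → map (λ v → combine f (residue (offset (lookup π f) a v ℤ.+ + g))) (proj₂ (lookup π f)))
    (allFin q)

  -- The colour is the point (i , a), but the block depends on a only: each block is repeated q
  -- times, once for each fibre i, so that all qk points occur as colours. The factor q k in λ₁ = q
  -- k λ₀ comes from this repetition and from the k shifts.
  bs : List (Fin (q * k) × List (Fin (q * k)))
  bs = concatMap (λ π → concatMap (λ i → concatMap (λ a → map (λ g →
         (combine i a , points π (toℕ a) (toℕ g))) (allFin k)) (allFin k)) (allFin q)) Π

  ∑-bs : (F : Fin (q * k) × List (Fin (q * k)) → ℕ) →
    ∑ bs F ≡ (∑[ π ∈ Π ] ∑[ i ∈ allFin q ] ∑[ a ∈ allFin k ] ∑[ g ∈ allFin k ]
      F (combine i a , points π (toℕ a) (toℕ g)))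
  ∑-bs F = trans (∑-concatMap _ Π F) (∑-cong Π (λ π →
    trans (∑-concatMap _ (allFin q) F) (∑-cong (allFin q) (λ i →
    trans (∑-concatMap _ (allFin k) F) (∑-cong (allFin k) (λ a →
    ∑-map _ (allFin k) F))))))

  ind-combine : ∀ (f f′ : Fin q) (u u′ : Fin k) →
    ind (combine f u ≟ combine f′ u′) ≡ ind (f′ ≟ f) * ind (u ≟ u′)
  ind-combine f f′ u u′ = trans
    (ind-cong (combine f u ≟ combine f′ u′) ((f′ ≟ f) ×-dec (u ≟ u′))
      (λ eq → sym (proj₁ (combine-injective f u f′ u′ eq)) , proj₂ (combine-injective f u f′ u′ eq))
      (λ { (refl , refl) → refl }))
    (ind-× (f′ ≟ f) (u ≟ u′))

  occ-points : ∀ π a g f u → occ (points π a g) (combine f u) ≡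
    (∑[ v ∈ proj₂ (lookup π f) ] I (+ toℕ u ℤ.- offset (lookup π f) a v ℤ.- + g))
  occ-points π a g f u = begin
    occ (points π a g) (combine f u)
      ≡⟨ ∑-concatMap _ (allFin q) (λ t → ind (combine f u ≟ t)) ⟩
    (∑[ f′ ∈ allFin q ] ∑ (map _ (proj₂ (lookup π f′))) (λ t → ind (combine f u ≟ t)))
      ≡⟨ ∑-cong (allFin q) (λ f′ → begin
           ∑ (map _ (proj₂ (lookup π f′))) (λ t → ind (combine f u ≟ t))
             ≡⟨ ∑-map _ (proj₂ (lookup π f′)) _ ⟩
           (∑[ v ∈ proj₂ (lookup π f′) ] ind (combine f u ≟ combine f′ (residue (offset (lookup π f′) a v ℤ.+ + g))))
             ≡⟨ ∑-cong (proj₂ (lookup π f′)) (λ v → trans (ind-combine f f′ u _) (cong (ind (f′ ≟ f) *_)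
                  (trans (ind-residue u (offset (lookup π f′) a v ℤ.+ + g)) (cong I (eq (+ toℕ u) (offset (lookup π f′) a v) (+ g)))))) ⟩
           (∑[ v ∈ proj₂ (lookup π f′) ] ind (f′ ≟ f) * I (+ toℕ u ℤ.- offset (lookup π f′) a v ℤ.- + g))
             ≡⟨ ∑-*ˡ (proj₂ (lookup π f′)) (ind (f′ ≟ f)) _ ⟩
           ind (f′ ≟ f) * (∑[ v ∈ proj₂ (lookup π f′) ] I (+ toℕ u ℤ.- offset (lookup π f′) a v ℤ.- + g)) ∎) ⟩
    (∑[ f′ ∈ allFin q ] ind (f′ ≟ f) * (∑[ v ∈ proj₂ (lookup π f′) ] I (+ toℕ u ℤ.- offset (lookup π f′) a v ℤ.- + g)))
      ≡⟨ ∑-ind f _ ⟩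
    (∑[ v ∈ proj₂ (lookup π f) ] I (+ toℕ u ℤ.- offset (lookup π f) a v ℤ.- + g)) ∎
    where
    eq : ∀ u v g → u ℤ.- (v ℤ.+ g) ≡ u ℤ.- v ℤ.- g
    eq = ℤ-Solver.solve-∀

  length-points : ∀ π a g → length (points π a g) ≡ ∑[ f ∈ allFin q ] ∣ lookup π f ∣ₚ
  length-points π a g = begin
    length (points π a g)           ≡⟨ *-identityʳ _ ⟨
    length (points π a g) * 1       ≡⟨ ∑-const (points π a g) 1 ⟨
    ∑ (points π a g) (const 1)      ≡⟨ ∑-concatMap _ (allFin q) _ ⟩
    (∑[ f ∈ allFin q ] ∑ (map _ (proj₂ (lookup π f))) (const 1))
      ≡⟨ ∑-cong (allFin q) (λ f → trans (∑-map _ (proj₂ (lookup π f)) _) (trans (∑-const (proj₂ (lookup π f)) 1) (*-identityʳ _))) ⟩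
    (∑[ f ∈ allFin q ] ∣ lookup π f ∣ₚ) ∎

  ∑-occ-occ : ∀ π f u f′ u′ →
    (∑[ a ∈ allFin k ] ∑[ g ∈ allFin k ]
      occ (points π (toℕ a) (toℕ g)) (combine f u) * occ (points π (toℕ a) (toℕ g)) (combine f′ u′))
    ≡ mixed (lookup π f) (lookup π f′) (+ toℕ u′ ℤ.- + toℕ u)
  ∑-occ-occ π f u f′ u′ = begin
    (∑[ a ∈ allFin k ] ∑[ g ∈ allFin k ]
      occ (points π (toℕ a) (toℕ g)) (combine f u) * occ (points π (toℕ a) (toℕ g)) (combine f′ u′))
      ≡⟨ ∑-cong (allFin k) (λ a → ∑-allFin-toℕ k (λ g →
           occ (points π (toℕ a) g) (combine f u) * occ (points π (toℕ a) g) (combine f′ u′))) ⟩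
    (∑[ a ∈ allFin k ] ∑[ g ∈ upTo k ]
      occ (points π (toℕ a) g) (combine f u) * occ (points π (toℕ a) g) (combine f′ u′))
      ≡⟨ ∑-allFin-toℕ k (λ a → ∑[ g ∈ upTo k ] occ (points π a g) (combine f u) * occ (points π a g) (combine f′ u′)) ⟩
    (∑[ a ∈ upTo k ] ∑[ g ∈ upTo k ] occ (points π a g) (combine f u) * occ (points π a g) (combine f′ u′))
      ≡⟨ ∑-cong (upTo k) at-shift ⟩
    (∑[ a ∈ upTo k ] ∑[ v ∈ T ] ∑[ w ∈ T′ ] Δ a v w)
      ≡⟨ ∑-swap (upTo k) T _ ⟩
    (∑[ v ∈ T ] ∑[ a ∈ upTo k ] ∑[ w ∈ T′ ] Δ a v w)
      ≡⟨ ∑-cong T (λ v → ∑-swap (upTo k) T′ _) ⟩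
    mixed (m , T) (m′ , T′) (+ toℕ u′ ℤ.- + toℕ u) ∎
    where
    m m′ : ℤ
    m  = proj₁ (lookup π f)
    m′ = proj₁ (lookup π f′)
    T T′ : List ℤ
    T  = proj₂ (lookup π f)
    T′ = proj₂ (lookup π f′)
    Δ : ℕ → ℤ → ℤ → ℕ
    Δ a v w = I (+ toℕ u′ ℤ.- + toℕ u ℤ.- (w ℤ.- v ℤ.+ (m′ ℤ.- m) ℤ.* + a))
    eq : ∀ u u′ v w m m′ a → u′ ℤ.- (w ℤ.+ m′ ℤ.* a) ℤ.- (u ℤ.- (v ℤ.+ m ℤ.* a))
                             ≡ u′ ℤ.- u ℤ.- (w ℤ.- v ℤ.+ (m′ ℤ.- m) ℤ.* a)
    eq = ℤ-Solver.solve-∀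
    at-shift : ∀ a → (∑[ g ∈ upTo k ] occ (points π a g) (combine f u) * occ (points π a g) (combine f′ u′))
                     ≡ (∑[ v ∈ T ] ∑[ w ∈ T′ ] Δ a v w)
    at-shift a = begin
      (∑[ g ∈ upTo k ] occ (points π a g) (combine f u) * occ (points π a g) (combine f′ u′))
        ≡⟨ ∑-cong (upTo k) (λ g → cong₂ _*_ (occ-points π a g f u) (occ-points π a g f′ u′)) ⟩
      (∑[ g ∈ upTo k ] ∑ T (P g) * ∑ T′ (P′ g))
        ≡⟨ ∑-cong (upTo k) (λ g → ∑-*-∑ T T′ (P g) (P′ g)) ⟩
      (∑[ g ∈ upTo k ] ∑[ v ∈ T ] ∑[ w ∈ T′ ] P g v * P′ g w)
        ≡⟨ ∑-swap (upTo k) T _ ⟩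
      (∑[ v ∈ T ] ∑[ g ∈ upTo k ] ∑[ w ∈ T′ ] P g v * P′ g w)
        ≡⟨ ∑-cong T (λ v → ∑-swap (upTo k) T′ _) ⟩
      (∑[ v ∈ T ] ∑[ w ∈ T′ ] ∑[ g ∈ upTo k ] P g v * P′ g w)
        ≡⟨ ∑-cong T (λ v → ∑-cong T′ (λ w → trans (∑-I-I (+ toℕ u ℤ.- (v ℤ.+ m ℤ.* + a)) (+ toℕ u′ ℤ.- (w ℤ.+ m′ ℤ.* + a)))
             (cong I (eq (+ toℕ u) (+ toℕ u′) v w m m′ (+ a))))) ⟩
      (∑[ v ∈ T ] ∑[ w ∈ T′ ] Δ a v w) ∎
      where
      P P′ : ℕ → ℤ → ℕ
      P  g v = I (+ toℕ u  ℤ.- (v ℤ.+ m ℤ.* + a) ℤ.- + g)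
      P′ g w = I (+ toℕ u′ ℤ.- (w ℤ.+ m′ ℤ.* + a) ℤ.- + g)

  -- The colour `b` determines i and a. For a fixed shift, each entry of the part on fibre `f`
  -- reaches the given point under exactly one translation g.
  ∑-occ-ind : ∀ π f u b →
    (∑[ i ∈ allFin q ] ∑[ a ∈ allFin k ] ∑[ g ∈ allFin k ]
      occ (points π (toℕ a) (toℕ g)) (combine f u) * ind (b ≟ combine i a))
    ≡ ∣ lookup π f ∣ₚ
  ∑-occ-ind π f u b = begin
    (∑[ i ∈ allFin q ] ∑[ a ∈ allFin k ] ∑[ g ∈ allFin k ]
      occ (points π (toℕ a) (toℕ g)) (combine f u) * ind (b ≟ combine i a))
      ≡⟨ ∑-cong (allFin q) (λ i → ∑-cong (allFin k) (λ a →
           trans (∑-*ʳ (allFin k) (ind (b ≟ combine i a)) _) (cong (_* ind (b ≟ combine i a)) (incidences (toℕ a))))) ⟩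
    (∑[ i ∈ allFin q ] ∑[ a ∈ allFin k ] ∣ lookup π f ∣ₚ * ind (b ≟ combine i a))
      ≡⟨ ∑-allFin-combine q k (λ z → ∣ lookup π f ∣ₚ * ind (b ≟ z)) ⟨
    (∑[ z ∈ allFin (q * k) ] ∣ lookup π f ∣ₚ * ind (b ≟ z))
      ≡⟨ ∑-*ˡ (allFin (q * k)) ∣ lookup π f ∣ₚ _ ⟩
    ∣ lookup π f ∣ₚ * (∑[ z ∈ allFin (q * k) ] ind (b ≟ z))
      ≡⟨ cong (∣ lookup π f ∣ₚ *_) (trans (∑-cong (allFin (q * k)) (λ z → ind-cong (b ≟ z) (z ≟ b) sym sym)) (∑-ind′ b)) ⟩
    ∣ lookup π f ∣ₚ * 1
      ≡⟨ *-identityʳ _ ⟩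
    ∣ lookup π f ∣ₚ ∎
    where
    T : List ℤ
    T = proj₂ (lookup π f)
    incidences : ∀ a → (∑[ g ∈ allFin k ] occ (points π a (toℕ g)) (combine f u)) ≡ length T
    incidences a = begin
      (∑[ g ∈ allFin k ] occ (points π a (toℕ g)) (combine f u))
        ≡⟨ ∑-allFin-toℕ k (λ g → occ (points π a g) (combine f u)) ⟩
      (∑[ g ∈ upTo k ] occ (points π a g) (combine f u))
        ≡⟨ ∑-cong (upTo k) (λ g → occ-points π a g f u) ⟩
      (∑[ g ∈ upTo k ] ∑[ v ∈ T ] I (+ toℕ u ℤ.- offset (lookup π f) a v ℤ.- + g))
        ≡⟨ ∑-swap (upTo k) T _ ⟩
      (∑[ v ∈ T ] ∑[ g ∈ upTo k ] I (+ toℕ u ℤ.- offset (lookup π f) a v ℤ.- + g))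
        ≡⟨ ∑-cong T (λ v → ∑-I (+ toℕ u ℤ.- offset (lookup π f) a v)) ⟩
      ∑ T (const 1)
        ≡⟨ trans (∑-const T 1) (*-identityʳ _) ⟩
      length T ∎

  module _
    {λ₀ μ : ℕ}
    (five  : All (λ π → (∑[ f ∈ allFin q ] ∣ lookup π f ∣ₚ) ≡ 5) Π)
    (same  : ∀ f d → I d ≡ 0 → (∑[ π ∈ Π ] inner (proj₂ (lookup π f)) d) ≡ λ₀)
    (cross : ∀ f f′ → f ≢ f′ → ∀ d → (∑[ π ∈ Π ] mixed (lookup π f) (lookup π f′) d) ≡ λ₀ * k)
    (size  : ∀ f → (∑[ π ∈ Π ] ∣ lookup π f ∣ₚ) ≡ μ)
    (λ₀-μ  : 4 * μ + λ₀ ≡ q * k * λ₀)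
    where

    mixed-total : ∀ f u f′ u′ → combine f u ≢ combine f′ u′ →
      (∑[ π ∈ Π ] mixed (lookup π f) (lookup π f′) (+ toℕ u′ ℤ.- + toℕ u)) ≡ λ₀ * k
    mixed-total f u f′ u′ x≢y with f ≟ f′
    ... | no f≢f′  = cross f f′ f≢f′ (+ toℕ u′ ℤ.- + toℕ u)
    ... | yes refl = begin
      (∑[ π ∈ Π ] mixed (lookup π f) (lookup π f) d)
        ≡⟨ ∑-cong Π (λ π → mixed-self (proj₁ (lookup π f)) (proj₂ (lookup π f)) d) ⟩
      (∑[ π ∈ Π ] inner (proj₂ (lookup π f)) d * k)
        ≡⟨ ∑-*ʳ Π k _ ⟩
      (∑[ π ∈ Π ] inner (proj₂ (lookup π f)) d) * k
        ≡⟨ cong (_* k) (same f d (I-∤ λ k∣d → x≢y (cong (combine f) (sym (Fin-≡ u′ u k∣d))))) ⟩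
      λ₀ * k ∎
      where
      d : ℤ
      d = + toℕ u′ ℤ.- + toℕ u

    pair-bs : ∀ x y → x ≢ y → (∑[ B ∈ bs ] occ (proj₂ B) x * occ (proj₂ B) y) ≡ q * k * λ₀
    pair-bs x y x≢y with combine-surjective {q} {k} x | combine-surjective {q} {k} y
    ... | f , u , refl | f′ , u′ , refl = begin
      (∑[ B ∈ bs ] occ (proj₂ B) (combine f u) * occ (proj₂ B) (combine f′ u′))
        ≡⟨ ∑-bs _ ⟩
      (∑[ π ∈ Π ] ∑[ i ∈ allFin q ] ∑[ a ∈ allFin k ] ∑[ g ∈ allFin k ]
        occ (points π (toℕ a) (toℕ g)) (combine f u) * occ (points π (toℕ a) (toℕ g)) (combine f′ u′))
        ≡⟨ ∑-cong Π (λ π → trans (∑-allFin-const q _) (cong (q *_) (∑-occ-occ π f u f′ u′))) ⟩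
      (∑[ π ∈ Π ] q * mixed (lookup π f) (lookup π f′) (+ toℕ u′ ℤ.- + toℕ u))
        ≡⟨ ∑-*ˡ Π q _ ⟩
      q * (∑[ π ∈ Π ] mixed (lookup π f) (lookup π f′) (+ toℕ u′ ℤ.- + toℕ u))
        ≡⟨ cong (q *_) (mixed-total f u f′ u′ x≢y) ⟩
      q * (λ₀ * k)
        ≡⟨ trans (cong (q *_) (*-comm λ₀ k)) (sym (*-assoc q k λ₀)) ⟩
      q * k * λ₀ ∎

    cross-bs : ∀ x b → (∑[ B ∈ bs ] occ (proj₂ B) x * ind (b ≟ proj₁ B)) ≡ μ
    cross-bs x b with combine-surjective {q} {k} x
    ... | f , u , refl = trans (∑-bs _) (trans (∑-cong Π (λ π → ∑-occ-ind π f u b)) (size f))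

    five-bs : All (λ B → length (proj₂ B) ≡ 5) bs
    five-bs = All.concat⁺ (All.map⁺ (All.map (λ {π} eq →
      All.concat⁺ (All.map⁺ (All.universal (λ i →
      All.concat⁺ (All.map⁺ (All.universal (λ a →
      All.map⁺ (All.universal (λ g → trans (length-points π (toℕ a) (toℕ g)) eq) (allFin k)))
      (allFin k)))) (allFin q)))) five))

    developed-design : ∀ {λ₂} → λ₂ ≡ 2 * μ → Σ[ D ∈ GDD (q * k) 6 (q * k * λ₀) λ₂ ] HasConfiguration 1 5 D
    developed-design = Mirror.design (q * k) (q * k * λ₀) μ bs five-bs pair-bs cross-bs
      (trans (eq (q * k) μ λ₀) (cong (q * k *_) λ₀-μ))
      where
      eq : ∀ n μ λ₀ → 4 * (n * μ) + n * λ₀ ≡ n * (4 * μ + λ₀)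
      eq = solve-∀

-- Linear forms c s + e

Lin : Set
Lin = ℤ × ℤ

⟦_⟧ : Lin → ℤ → ℤ
⟦ c , e ⟧ s = c ℤ.* s ℤ.+ e

_⊝_ : Lin → Lin → Lin
(c , e) ⊝ (c′ , e′) = c ℤ.- c′ , e ℤ.- e′

_⊚_ : Lin → Lin → Lin
(c , e) ⊚ (a , b) = c ℤ.* a , c ℤ.* b ℤ.+ e

⟦⊝⟧ : ∀ L M s → ⟦ L ⟧ s ℤ.- ⟦ M ⟧ s ≡ ⟦ L ⊝ M ⟧ s
⟦⊝⟧ (c , e) (c′ , e′) s = eq c e c′ e′ s
  where
  eq : ∀ c e c′ e′ s → c ℤ.* s ℤ.+ e ℤ.- (c′ ℤ.* s ℤ.+ e′) ≡ (c ℤ.- c′) ℤ.* s ℤ.+ (e ℤ.- e′)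
  eq = ℤ-Solver.solve-∀

⟦⊚⟧ : ∀ L M s → ⟦ L ⟧ (⟦ M ⟧ s) ≡ ⟦ L ⊚ M ⟧ s
⟦⊚⟧ (c , e) (a , b) s = eq c e a b s
  where
  eq : ∀ c e a b s → c ℤ.* (a ℤ.* s ℤ.+ b) ℤ.+ e ≡ c ℤ.* a ℤ.* s ℤ.+ (c ℤ.* b ℤ.+ e)
  eq = ℤ-Solver.solve-∀

differences : List Lin → List Lin
differences []      = []
differences (L ∷ T) = map (_⊝ L) T ++ differences T

at : ℤ → List Lin → List ℤ
at s = map (λ L → ⟦ L ⟧ s)

-- Up to sign and modulo k, a form at j with 2j ≡ 0 depends only on this code.
code : Lin → ℕ × ℕ
code (c , e) = c %ℕ 2 , ℤ.∣ e ∣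

nonzeros : List (ℕ × ℕ) → List (ℕ × ℕ)
nonzeros []                  = []
nonzeros ((0 , 0) ∷ xs)      = nonzeros xs
nonzeros ((0 , suc m) ∷ xs)  = (0 , suc m) ∷ nonzeros xs
nonzeros ((suc r , m) ∷ xs)  = (suc r , m) ∷ nonzeros xs

∑-nonzeros : {f : ℕ × ℕ → ℕ} → f (0 , 0) ≡ 0 → ∀ xs → ∑ (nonzeros xs) f ≡ ∑ xs f
∑-nonzeros f0 []                 = refl
∑-nonzeros {f} f0 ((0 , 0) ∷ xs) = trans (∑-nonzeros f0 xs) (cong (_+ ∑ xs f) (sym f0))
∑-nonzeros {f} f0 ((0 , suc m) ∷ xs) = cong (λ t → f (0 , suc m) + t) (∑-nonzeros f0 xs)
∑-nonzeros {f} f0 ((suc r , m) ∷ xs) = cong (λ t → f (suc r , m) + t) (∑-nonzeros f0 xs)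

open Sort (×-decTotalOrder ≤-decTotalOrder ≤-decTotalOrder) using (sort)
open SortProperties (×-decTotalOrder ≤-decTotalOrder ≤-decTotalOrder) using (sort-↭)

-- Zero codes are dropped because a zero difference never equals d ≢ 0. Sorting the rest lets `refl`
-- decide whether two lists of forms give the same multiset of differences.
canonical : List Lin → List (ℕ × ℕ)
canonical Ls = sort (nonzeros (map code Ls))

∑-canonical : {f : ℕ × ℕ → ℕ} → f (0 , 0) ≡ 0 → ∀ Ls → ∑ (canonical Ls) f ≡ ∑[ L ∈ Ls ] f (code L)
∑-canonical {f} f0 Ls = begin
  ∑ (canonical Ls) f                ≡⟨ sum-↭ (map⁺ f (sort-↭ (nonzeros (map code Ls)))) ⟩
  ∑ (nonzeros (map code Ls)) f      ≡⟨ ∑-nonzeros f0 (map code Ls) ⟩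
  ∑ (map code Ls) f                 ≡⟨ ∑-map code Ls f ⟩
  (∑[ L ∈ Ls ] f (code L))          ∎

-- Units modulo k and uniform differences between fibres.

module Units (k : ℕ) .{{_ : NonZero k}} where

  open Residues k
  open Differences k

  record Unit (c : ℕ) : Set where
    constructor has-inverse
    field
      inverse quotient : ℕ
      equation         : c * inverse ≡ 1 + quotient * k

  -- Multiplying by the inverse c′ turns c a ≡ z into a ≡ c′ z, which has one solution in a full
  -- range.
  ∑-I-unit : ∀ {c} → Unit c → ∀ z → (∑[ a ∈ upTo k ] I (z ℤ.- + c ℤ.* + a)) ≡ 1
  ∑-I-unit {c} (has-inverse c′ w cc′) z = trans
    (∑-cong (upTo k) (λ a → I-iff (to (+ a)) (from (+ a))))
    (∑-I (+ c′ ℤ.* z))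
    where
    unit : + c ℤ.* + c′ ≡ + 1 ℤ.+ + w ℤ.* + k
    unit = trans (sym (ℤ.pos-* c c′)) (trans (cong +_ cc′)
      (trans (ℤ.pos-+ 1 (w * k)) (cong (λ x → + 1 ℤ.+ x) (ℤ.pos-* w k))))
    to : ∀ a → + k ∣ᶻ z ℤ.- + c ℤ.* a → + k ∣ᶻ + c′ ℤ.* z ℤ.- a
    to a k∣ = subst (+ k ∣ᶻ_)
      (trans (cong (λ u → + c′ ℤ.* z ℤ.- u ℤ.* a ℤ.+ + w ℤ.* a ℤ.* + k) unit) (eq (+ c′ ℤ.* z) (+ w) (+ k) a))
      (ℤ∣.∣m∣n⇒∣m+n
        (subst (+ k ∣ᶻ_) (eq′ (+ c) (+ c′) z a) (ℤ∣.∣n⇒∣m*n (+ c′) k∣))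
        (divides (+ w ℤ.* a) refl))
      where
      eq : ∀ y w k a → y ℤ.- (+ 1 ℤ.+ w ℤ.* k) ℤ.* a ℤ.+ w ℤ.* a ℤ.* k ≡ y ℤ.- a
      eq = ℤ-Solver.solve-∀
      eq′ : ∀ c c′ z a → c′ ℤ.* (z ℤ.- c ℤ.* a) ≡ c′ ℤ.* z ℤ.- c ℤ.* c′ ℤ.* a
      eq′ = ℤ-Solver.solve-∀
    from : ∀ a → + k ∣ᶻ + c′ ℤ.* z ℤ.- a → + k ∣ᶻ z ℤ.- + c ℤ.* a
    from a k∣ = subst (+ k ∣ᶻ_)
      (trans (cong (λ u → u ℤ.* z ℤ.- + c ℤ.* a ℤ.- + w ℤ.* z ℤ.* + k) unit) (eq (+ c ℤ.* a) z (+ w) (+ k)))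
      (ℤ∣.∣m∣n⇒∣m-n
        (subst (+ k ∣ᶻ_) (eq′ (+ c) (+ c′) z a) (ℤ∣.∣n⇒∣m*n (+ c) k∣))
        (divides (+ w ℤ.* z) refl))
      where
      eq : ∀ y z w k → (+ 1 ℤ.+ w ℤ.* k) ℤ.* z ℤ.- y ℤ.- w ℤ.* z ℤ.* k ≡ z ℤ.- y
      eq = ℤ-Solver.solve-∀
      eq′ : ∀ c c′ z a → c ℤ.* (c′ ℤ.* z ℤ.- a) ≡ c ℤ.* c′ ℤ.* z ℤ.- c ℤ.* a
      eq′ = ℤ-Solver.solve-∀

  1-unit : Unit 1
  1-unit = has-inverse 1 0 refl

  ∑-upTo-shift : ∀ n {f : ℕ → ℕ} → f n ≡ f 0 → ∑ (upTo n) (f ∘ suc) ≡ ∑ (upTo n) f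
  ∑-upTo-shift n {f} fn≡f0 = +-cancelˡ-≡ (f 0) _ _ (begin
    f 0 + ∑ (upTo n) (f ∘ suc) ≡⟨ ∑-upTo-suc n f ⟨
    ∑ (upTo (suc n)) f         ≡⟨ ∑-upTo-last n f ⟩
    ∑ (upTo n) f + f n         ≡⟨ cong (λ x → ∑ (upTo n) f + x) fn≡f0 ⟩
    ∑ (upTo n) f + f 0         ≡⟨ +-comm _ (f 0) ⟩
    f 0 + ∑ (upTo n) f         ∎)

  ∑-upTo-double : ∀ n (f : ℕ → ℕ) → ∑ (upTo (n + n)) f ≡ (∑[ a ∈ upTo n ] f (a + a) + f (suc (a + a)))
  ∑-upTo-double zero    f = refl
  ∑-upTo-double (suc n) f rewrite +-suc n n = begin
    ∑ (upTo (2 + (n + n))) f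
      ≡⟨ trans (∑-upTo-suc (suc (n + n)) f) (cong (λ x → f 0 + x) (∑-upTo-suc (n + n) (λ b → f (suc b)))) ⟩
    f 0 + (f 1 + ∑ (upTo (n + n)) (λ b → f (2 + b)))
      ≡⟨ +-assoc (f 0) (f 1) _ ⟨
    f 0 + f 1 + ∑ (upTo (n + n)) (λ b → f (2 + b))
      ≡⟨ cong (λ x → f 0 + f 1 + x) (trans (∑-upTo-double n (λ b → f (2 + b))) (∑-cong (upTo n) (λ a →
           cong (λ b → f (suc b) + f (suc (suc b))) (sym (+-suc a a))))) ⟩
    f 0 + f 1 + (∑[ a ∈ upTo n ] f (suc a + suc a) + f (suc (suc a + suc a)))
      ≡⟨ ∑-upTo-suc n (λ a → f (a + a) + f (suc (a + a))) ⟨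
    (∑[ a ∈ upTo (suc n) ] f (a + a) + f (suc (a + a))) ∎

  -- For a = 0, ..., k - 1 the numbers 2a and 2a + 1 together run through 0, ..., 2k - 1, which is
  -- two full periods whatever the parity of k.
  ∑-I-even-odd : ∀ z → (∑[ a ∈ upTo k ] I (z ℤ.- + 2 ℤ.* + a) + I (z ℤ.- + 1 ℤ.- + 2 ℤ.* + a)) ≡ 2
  ∑-I-even-odd z = begin
    (∑[ a ∈ upTo k ] I (z ℤ.- + 2 ℤ.* + a) + I (z ℤ.- + 1 ℤ.- + 2 ℤ.* + a))
      ≡⟨ ∑-cong (upTo k) (λ a → cong₂ _+_
           (cong I (trans (eq₀ z (+ a)) (cong (λ x → z ℤ.- x) (sym (ℤ.pos-+ a a)))))
           (cong I (trans (eq₁ z (+ a)) (cong (λ x → z ℤ.- (+ 1 ℤ.+ x)) (sym (ℤ.pos-+ a a)))))) ⟩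
    (∑[ a ∈ upTo k ] I (z ℤ.- + (a + a)) + I (z ℤ.- + suc (a + a)))
      ≡⟨ ∑-upTo-double k (λ b → I (z ℤ.- + b)) ⟨
    (∑[ b ∈ upTo (k + k) ] I (z ℤ.- + b))
      ≡⟨ ∑-upTo-+ k k (λ b → I (z ℤ.- + b)) ⟩
    (∑[ b ∈ upTo k ] I (z ℤ.- + b)) + (∑[ b ∈ upTo k ] I (z ℤ.- + (k + b)))
      ≡⟨ cong₂ _+_ (∑-I z) (∑-I-affine (z ℤ.- + k) (λ b → trans (cong (λ x → z ℤ.- x) (ℤ.pos-+ k b)) (eq z (+ k) (+ b)))) ⟩
    2 ∎
    where
    eq₀ : ∀ z a → z ℤ.- + 2 ℤ.* a ≡ z ℤ.- (a ℤ.+ a)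
    eq₀ = ℤ-Solver.solve-∀
    eq₁ : ∀ z a → z ℤ.- + 1 ℤ.- + 2 ℤ.* a ≡ z ℤ.- (+ 1 ℤ.+ (a ℤ.+ a))
    eq₁ = ℤ-Solver.solve-∀
    eq : ∀ z k b → z ℤ.- (k ℤ.+ b) ≡ z ℤ.- k ℤ.- b
    eq = ℤ-Solver.solve-∀

  mixed-unit : ∀ {c} m m′ → m′ ℤ.- m ≡ + c → Unit c → ∀ T T′ d →
               mixed (m , T) (m′ , T′) d ≡ length T * length T′
  mixed-unit {c} m m′ m′-m≡c unit T T′ d = begin
    mixed (m , T) (m′ , T′) d
      ≡⟨ ∑-cong T (λ v → ∑-cong T′ (λ w → trans
           (∑-cong (upTo k) (λ a → cong I (trans (cong (λ x → d ℤ.- (w ℤ.- v ℤ.+ x ℤ.* + a)) m′-m≡c) (eq d (w ℤ.- v) (+ c) (+ a)))))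
           (∑-I-unit unit (d ℤ.- (w ℤ.- v))))) ⟩
    (∑[ v ∈ T ] ∑[ w ∈ T′ ] 1)
      ≡⟨ trans (∑-cong T (λ v → trans (∑-const T′ 1) (*-identityʳ (length T′)))) (∑-const T (length T′)) ⟩
    length T * length T′ ∎
    where
    eq : ∀ d u c a → d ℤ.- (u ℤ.+ c ℤ.* a) ≡ d ℤ.- u ℤ.- c ℤ.* a
    eq = ℤ-Solver.solve-∀

  mixed-unit-sym : ∀ {c} m m′ → m′ ℤ.- m ≡ + c → Unit c → ∀ T T′ d →
                   mixed (m′ , T′) (m , T) d ≡ length T * length T′
  mixed-unit-sym m m′ m′-m≡c unit T T′ d =
    trans (mixed-sym (m′ , T′) (m , T) d) (mixed-unit m m′ m′-m≡c unit T T′ (ℤ.- d))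

-- Differences up to sign.

module Circulant (k : ℕ) .{{_ : NonZero k}} (d : ℤ) (d≢0 : Residues.I k d ≡ 0) where

  open Residues k
  open Differences k
  open Units k

  -- The contribution to d of an unordered pair with difference e: its two orders have differences e
  -- and -e.
  K : ℤ → ℕ
  K e = I (d ℤ.- e) + I (d ℤ.+ e)

  K-0 : K (+ 0) ≡ 0
  K-0 rewrite ℤ.+-identityʳ d = cong₂ _+_ d≢0 d≢0

  K-cong : ∀ {e e′} → + k ∣ᶻ e′ ℤ.- e → K e ≡ K e′
  K-cong {e} {e′} k∣ = cong₂ _+_
    (I-cong (subst (+ k ∣ᶻ_) (eq₁ d e e′) (ℤ∣.∣m⇒∣-m k∣)))
    (I-cong (subst (+ k ∣ᶻ_) (eq₂ d e e′) k∣))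
    where
    eq₁ : ∀ d e e′ → ℤ.- (e′ ℤ.- e) ≡ d ℤ.- e′ ℤ.- (d ℤ.- e)
    eq₁ = ℤ-Solver.solve-∀
    eq₂ : ∀ d e e′ → e′ ℤ.- e ≡ d ℤ.+ e′ ℤ.- (d ℤ.+ e)
    eq₂ = ℤ-Solver.solve-∀

  K-neg : ∀ e → K (ℤ.- e) ≡ K e
  K-neg e = trans (+-comm (I (d ℤ.- ℤ.- e)) (I (d ℤ.+ ℤ.- e)))
    (cong (λ x → I (d ℤ.- e) + I (d ℤ.+ x)) (ℤ.neg-involutive e))

  K-cong⁻ : ∀ {e e′} → + k ∣ᶻ e′ ℤ.+ e → K e ≡ K e′
  K-cong⁻ {e} {e′} k∣ = trans (sym (K-neg e))
    (K-cong (subst (λ x → + k ∣ᶻ e′ ℤ.+ x) (sym (ℤ.neg-involutive e)) k∣))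

  H : List ℤ → ℕ
  H []      = 0
  H (v ∷ T) = (∑[ w ∈ T ] K (w ℤ.- v)) + H T

  -- The diagonal pairs have difference 0 and drop out because d ≢ 0; the other ordered pairs are
  -- collected in twos.
  inner≡H : ∀ T → inner T d ≡ H T
  inner≡H []      = refl
  inner≡H (v ∷ T) = begin
    I (d ℤ.- (v ℤ.- v)) + (∑[ w ∈ T ] I (d ℤ.- (w ℤ.- v)))
      + (∑[ u ∈ T ] I (d ℤ.- (v ℤ.- u)) + (∑[ w ∈ T ] I (d ℤ.- (w ℤ.- u))))
      ≡⟨ cong₂ (λ x y → x + (∑[ w ∈ T ] I (d ℤ.- (w ℤ.- v))) + y) (trans (cong I (eq₀ d v)) d≢0)
           (trans (∑-+ T _ _) (cong₂ _+_ (∑-cong T (λ u → cong I (eq₁ d u v))) (inner≡H T))) ⟩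
    (∑[ w ∈ T ] I (d ℤ.- (w ℤ.- v))) + ((∑[ u ∈ T ] I (d ℤ.+ (u ℤ.- v))) + H T)
      ≡⟨ +-assoc (∑[ w ∈ T ] I (d ℤ.- (w ℤ.- v))) _ (H T) ⟨
    (∑[ w ∈ T ] I (d ℤ.- (w ℤ.- v))) + (∑[ u ∈ T ] I (d ℤ.+ (u ℤ.- v))) + H T
      ≡⟨ cong (_+ H T) (∑-+ T _ _) ⟨
    (∑[ w ∈ T ] K (w ℤ.- v)) + H T ∎
    where
    eq₀ : ∀ d v → d ℤ.- (v ℤ.- v) ≡ d
    eq₀ = ℤ-Solver.solve-∀
    eq₁ : ∀ d u v → d ℤ.- (v ℤ.- u) ≡ d ℤ.+ (u ℤ.- v)
    eq₁ = ℤ-Solver.solve-∀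

  H-at : ∀ s T → H (at s T) ≡ ∑[ L ∈ differences T ] K (⟦ L ⟧ s)
  H-at s []      = refl
  H-at s (L ∷ T) = begin
    (∑[ w ∈ at s T ] K (w ℤ.- ⟦ L ⟧ s)) + H (at s T)
      ≡⟨ cong₂ _+_ (trans (∑-map (λ M → ⟦ M ⟧ s) T _) (trans (∑-cong T (λ M → cong K (⟦⊝⟧ M L s)))
           (sym (∑-map (_⊝ L) T _)))) (H-at s T) ⟩
    (∑[ M ∈ map (_⊝ L) T ] K (⟦ M ⟧ s)) + (∑[ M ∈ differences T ] K (⟦ M ⟧ s))
      ≡⟨ ∑-++ (map (_⊝ L) T) (differences T) _ ⟨
    (∑[ M ∈ differences (L ∷ T) ] K (⟦ M ⟧ s)) ∎

  ∑-K-unit : ∀ {c} → Unit c → ∀ e → (∑[ s ∈ upTo k ] K (⟦ + c , e ⟧ (+ s))) ≡ 2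
  ∑-K-unit {c} unit e = trans (∑-+ (upTo k) _ _) (cong₂ _+_
    (trans (∑-cong (upTo k) (λ s → cong I (eq₁ d (+ c) e (+ s)))) (∑-I-unit unit (d ℤ.- e)))
    (trans (∑-cong (upTo k) (λ s → I-neg-≡ (eq₂ d (+ c) e (+ s)))) (∑-I-unit unit (ℤ.- d ℤ.- e))))
    where
    eq₁ : ∀ d c e s → d ℤ.- (c ℤ.* s ℤ.+ e) ≡ d ℤ.- e ℤ.- c ℤ.* s
    eq₁ = ℤ-Solver.solve-∀
    eq₂ : ∀ d c e s → ℤ.- (d ℤ.+ (c ℤ.* s ℤ.+ e)) ≡ ℤ.- d ℤ.- e ℤ.- c ℤ.* s
    eq₂ = ℤ-Solver.solve-∀

  ∑-K-even-odd : (∑[ s ∈ upTo k ] K (⟦ + 2 , + 0 ⟧ (+ s))) + (∑[ s ∈ upTo k ] K (⟦ + 2 , + 1 ⟧ (+ s))) ≡ 4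
  ∑-K-even-odd = begin
    (∑[ s ∈ upTo k ] K (⟦ + 2 , + 0 ⟧ (+ s))) + (∑[ s ∈ upTo k ] K (⟦ + 2 , + 1 ⟧ (+ s)))
      ≡⟨ ∑-+ (upTo k) _ _ ⟨
    (∑[ s ∈ upTo k ] K (⟦ + 2 , + 0 ⟧ (+ s)) + K (⟦ + 2 , + 1 ⟧ (+ s)))
      ≡⟨ ∑-cong (upTo k) (λ s → rearrange s) ⟩
    (∑[ s ∈ upTo k ] (I (d ℤ.- + 2 ℤ.* + s) + I (d ℤ.- + 1 ℤ.- + 2 ℤ.* + s))
      + (I (ℤ.- d ℤ.- + 2 ℤ.* + s) + I (ℤ.- d ℤ.- + 1 ℤ.- + 2 ℤ.* + s)))
      ≡⟨ ∑-+ (upTo k) _ _ ⟩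
    (∑[ s ∈ upTo k ] I (d ℤ.- + 2 ℤ.* + s) + I (d ℤ.- + 1 ℤ.- + 2 ℤ.* + s))
      + (∑[ s ∈ upTo k ] I (ℤ.- d ℤ.- + 2 ℤ.* + s) + I (ℤ.- d ℤ.- + 1 ℤ.- + 2 ℤ.* + s))
      ≡⟨ cong₂ _+_ (∑-I-even-odd d) (∑-I-even-odd (ℤ.- d)) ⟩
    4 ∎
    where
    eq₁ : ∀ d e s → d ℤ.- (+ 2 ℤ.* s ℤ.+ e) ≡ d ℤ.- e ℤ.- + 2 ℤ.* s
    eq₁ = ℤ-Solver.solve-∀
    eq₂ : ∀ d e s → ℤ.- (d ℤ.+ (+ 2 ℤ.* s ℤ.+ e)) ≡ ℤ.- d ℤ.- e ℤ.- + 2 ℤ.* s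
    eq₂ = ℤ-Solver.solve-∀
    interchange : ∀ a b c d → a + b + (c + d) ≡ a + c + (b + d)
    interchange = solve-∀
    minus-0 : ∀ x y → x ℤ.- + 0 ℤ.- y ≡ x ℤ.- y
    minus-0 = ℤ-Solver.solve-∀
    rearrange : ∀ s → K (⟦ + 2 , + 0 ⟧ (+ s)) + K (⟦ + 2 , + 1 ⟧ (+ s))
      ≡ (I (d ℤ.- + 2 ℤ.* + s) + I (d ℤ.- + 1 ℤ.- + 2 ℤ.* + s))
        + (I (ℤ.- d ℤ.- + 2 ℤ.* + s) + I (ℤ.- d ℤ.- + 1 ℤ.- + 2 ℤ.* + s))
    rearrange s = trans
      (cong₂ _+_
        (cong₂ _+_ (cong I (trans (eq₁ d (+ 0) (+ s)) (minus-0 d (+ 2 ℤ.* + s))))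
                   (I-neg-≡ (trans (eq₂ d (+ 0) (+ s)) (minus-0 (ℤ.- d) (+ 2 ℤ.* + s)))))
        (cong₂ _+_ (cong I (eq₁ d (+ 1) (+ s))) (I-neg-≡ (eq₂ d (+ 1) (+ s)))))
      (interchange (I (d ℤ.- + 2 ℤ.* + s)) (I (ℤ.- d ℤ.- + 2 ℤ.* + s)) _ _)

  module Half {j : ℤ} (k∣2j : + k ∣ᶻ + 2 ℤ.* j) where

    -- From 2j ≡ 0 the coefficient of j matters only modulo 2. Moreover r j ≡ -r j, so changing the
    -- sign of the constant changes the form only by a sign, and `K` is even.
    K-code : ∀ L → K (⟦ L ⟧ j) ≡ K (⟦ + proj₁ (code L) , + proj₂ (code L) ⟧ j)
    K-code (c , e) = trans (K-cong (reduce c e)) (K-abs (+ (c %ℕ 2)) e)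
      where
      reduce : ∀ c e → + k ∣ᶻ ⟦ + (c %ℕ 2) , e ⟧ j ℤ.- ⟦ c , e ⟧ j
      reduce c e = subst (+ k ∣ᶻ_)
        (trans (eq (+ (c %ℕ 2)) (c /ℕ 2) e j) (cong (λ x → ⟦ + (c %ℕ 2) , e ⟧ j ℤ.- ⟦ x , e ⟧ j) (sym (a≡a%ℕn+[a/ℕn]*n c 2))))
        (ℤ∣.∣n⇒∣m*n (ℤ.- (c /ℕ 2)) k∣2j)
        where
        eq : ∀ r q e j → ℤ.- q ℤ.* (+ 2 ℤ.* j) ≡ r ℤ.* j ℤ.+ e ℤ.- ((r ℤ.+ q ℤ.* + 2) ℤ.* j ℤ.+ e)
        eq = ℤ-Solver.solve-∀
      K-abs : ∀ r e → K (⟦ r , e ⟧ j) ≡ K (⟦ r , + ℤ.∣ e ∣ ⟧ j)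
      K-abs r (+ n)    = refl
      K-abs r -[1+ n ] = K-cong⁻ (subst (+ k ∣ᶻ_) (eq r (+ suc n) j) (ℤ∣.∣n⇒∣m*n r k∣2j))
        where
        eq : ∀ r m j → r ℤ.* (+ 2 ℤ.* j) ≡ r ℤ.* j ℤ.+ m ℤ.+ (r ℤ.* j ℤ.+ ℤ.- m)
        eq = ℤ-Solver.solve-∀

    ∑-K-canonical : ∀ Ls Ms → canonical Ls ≡ canonical Ms →
                    (∑[ L ∈ Ls ] K (⟦ L ⟧ j)) ≡ (∑[ L ∈ Ms ] K (⟦ L ⟧ j))
    ∑-K-canonical Ls Ms eq = begin
      (∑[ L ∈ Ls ] K (⟦ L ⟧ j))         ≡⟨ ∑-cong Ls K-code ⟩
      (∑[ L ∈ Ls ] θ (code L))          ≡⟨ ∑-canonical θ0 Ls ⟨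
      ∑ (canonical Ls) θ                ≡⟨ cong (λ xs → ∑ xs θ) eq ⟩
      ∑ (canonical Ms) θ                ≡⟨ ∑-canonical θ0 Ms ⟩
      (∑[ L ∈ Ms ] θ (code L))          ≡⟨ ∑-cong Ms K-code ⟨
      (∑[ L ∈ Ms ] K (⟦ L ⟧ j))         ∎
      where
      θ : ℕ × ℕ → ℕ
      θ (r , m) = K (⟦ + r , + m ⟧ j)
      θ0 : θ (0 , 0) ≡ 0
      θ0 = K-0

-- Designs from families of patterns.

GDD₁₅ : (n λ₁ λ₂ : ℕ) → Set
GDD₁₅ n λ₁ λ₂ = Σ[ D ∈ GDD n 6 λ₁ λ₂ ] HasConfiguration 1 5 D

Shape : ℕ → Set
Shape q = Vec (List Lin) q

-- (S , shapes) stands for all instances of the shapes at all s ∈ S.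
Segment : ℕ → Set
Segment q = List ℤ × List (Shape q)

forms : ∀ {q} → List (Shape q) → List Lin
forms {q} = concatMap (λ σ → concatMap (λ f → differences (lookup σ f)) (allFin q))

module Plan
  {q : ℕ} (k : ℕ) .{{_ : NonZero k}}
  (mults : Vec ℤ q)
  (rotations : ∀ {A : Set} → Vec A q → List (Vec A q))
  (rotations-lookup : ∀ {A : Set} (g : A → ℕ) v f →
    (∑[ w ∈ rotations v ] g (lookup w f)) ≡ (∑[ f ∈ allFin q ] g (lookup v f)))
  (rotations-total : ∀ {A : Set} (g : A → ℕ) v →
    All (λ w → (∑[ f ∈ allFin q ] g (lookup w f)) ≡ (∑[ f ∈ allFin q ] g (lookup v f))) (rotations v))
  (pairs : Shape q → ℕ)
  where

  open Residues k
  open Differences k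

  -- The multipliers are attached before rotating and travel with their parts. Hence a shape meets
  -- the same relative speeds in all its rotations, and only its own pairs of parts have to be
  -- examined.
  instantiate : ℤ → Shape q → Vec Part q
  instantiate s σ = zip mults (Vec.map (at s) σ)

  lookup-instantiate : ∀ s σ f → proj₂ (lookup (instantiate s σ) f) ≡ at s (lookup σ f)
  lookup-instantiate s σ f =
    trans (cong proj₂ (Vec.lookup-zip f mults (Vec.map (at s) σ))) (Vec.lookup-map f (at s) σ)

  Five : Shape q → Set
  Five σ = (∑[ f ∈ allFin q ] length (lookup σ f)) ≡ 5

  record Balanced (σ : Shape q) : Set where
    constructor balance
    field
      mixed-pairs : ∀ s f f′ → f ≢ f′ → ∀ d →
        (∑[ π ∈ rotations (instantiate s σ) ] mixed (lookup π f) (lookup π f′) d) ≡ pairs σ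

  open Balanced

  module _ (segments : List (Segment q)) where

    patterns : List (Vec Part q)
    patterns = concatMap (λ seg → concatMap (λ s → concatMap (λ σ →
      rotations (instantiate s σ)) (proj₂ seg)) (proj₁ seg)) segments

    ∑-patterns : ∀ F → ∑ patterns F ≡ (∑[ seg ∈ segments ] ∑[ s ∈ proj₁ seg ] ∑[ σ ∈ proj₂ seg ]
      ∑ (rotations (instantiate s σ)) F)
    ∑-patterns F = trans (∑-concatMap _ segments F) (∑-cong segments (λ seg →
      trans (∑-concatMap _ (proj₁ seg) F) (∑-cong (proj₁ seg) (λ s → ∑-concatMap _ (proj₂ seg) F))))

    -- Patterns are counted up to rotation. Over all rotations of one pattern every fibre receives
    -- each of the parts once, hence five points, so μ is five times this number.
    base-count : ℕ
    base-count = ∑[ seg ∈ segments ] length (proj₁ seg) * length (proj₂ seg)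

    module _
      {λ₀ : ℕ}
      (five     : All (λ seg → All Five (proj₂ seg)) segments)
      (balanced : All (λ seg → All Balanced (proj₂ seg)) segments)
      (inner-total : ∀ d (d≢0 : I d ≡ 0) →
        (∑[ seg ∈ segments ] ∑[ s ∈ proj₁ seg ] ∑[ L ∈ forms (proj₂ seg) ] Circulant.K k d d≢0 (⟦ L ⟧ s)) ≡ λ₀)
      (pairs-total : ∀ (f f′ : Fin q) → f ≢ f′ →
        (∑[ seg ∈ segments ] length (proj₁ seg) * ∑ (proj₂ seg) pairs) ≡ λ₀ * k)
      (count       : 4 * (5 * base-count) + λ₀ ≡ q * k * λ₀)
      where

      part-sizes : ∀ s {σ} → Five σ → (∑[ f ∈ allFin q ] ∣ lookup (instantiate s σ) f ∣ₚ) ≡ 5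
      part-sizes s {σ} five-σ = trans (∑-cong (allFin q) (λ f →
        trans (cong length (lookup-instantiate s σ f)) (length-map _ (lookup σ f)))) five-σ

      five-patterns : All (λ π → (∑[ f ∈ allFin q ] ∣ lookup π f ∣ₚ) ≡ 5) patterns
      five-patterns = All.concat⁺ (All.map⁺ (All.map (λ {seg} five-seg →
        All.concat⁺ (All.map⁺ (All.universal (λ s →
        All.concat⁺ (All.map⁺ (All.map (λ {σ} five-σ →
        All.map (λ eq → trans eq (part-sizes s {σ} five-σ)) (rotations-total ∣_∣ₚ (instantiate s σ)))
        five-seg))) (proj₁ seg)))) five))

      size-patterns : ∀ f → (∑[ π ∈ patterns ] ∣ lookup π f ∣ₚ) ≡ 5 * base-count
      size-patterns f = begin
        (∑[ π ∈ patterns ] ∣ lookup π f ∣ₚ)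
          ≡⟨ ∑-patterns _ ⟩
        (∑[ seg ∈ segments ] ∑[ s ∈ proj₁ seg ] ∑[ σ ∈ proj₂ seg ] ∑[ π ∈ rotations (instantiate s σ) ] ∣ lookup π f ∣ₚ)
          ≡⟨ ∑-cong-All (All.map (λ {seg} five-seg → begin
               (∑[ s ∈ proj₁ seg ] ∑[ σ ∈ proj₂ seg ] ∑[ π ∈ rotations (instantiate s σ) ] ∣ lookup π f ∣ₚ)
                 ≡⟨ ∑-cong (proj₁ seg) (λ s → trans (∑-const-All (proj₂ seg) _ (All.map (λ {σ} five-σ →
                      trans (rotations-lookup ∣_∣ₚ (instantiate s σ) f) (part-sizes s {σ} five-σ)) five-seg))
                      (*-comm (length (proj₂ seg)) 5)) ⟩
               (∑[ s ∈ proj₁ seg ] 5 * length (proj₂ seg))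
                 ≡⟨ ∑-*ˡ (proj₁ seg) 5 _ ⟩
               5 * (∑[ s ∈ proj₁ seg ] length (proj₂ seg))
                 ≡⟨ cong (5 *_) (∑-const (proj₁ seg) (length (proj₂ seg))) ⟩
               5 * (length (proj₁ seg) * length (proj₂ seg)) ∎) five) ⟩
        (∑[ seg ∈ segments ] 5 * (length (proj₁ seg) * length (proj₂ seg)))
          ≡⟨ ∑-*ˡ segments 5 _ ⟩
        5 * base-count ∎

      same-patterns : ∀ f d → I d ≡ 0 → (∑[ π ∈ patterns ] inner (proj₂ (lookup π f)) d) ≡ λ₀
      same-patterns f d d≢0 = begin
        (∑[ π ∈ patterns ] inner (proj₂ (lookup π f)) d)
          ≡⟨ ∑-patterns _ ⟩
        (∑[ seg ∈ segments ] ∑[ s ∈ proj₁ seg ] ∑[ σ ∈ proj₂ seg ]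
          ∑[ π ∈ rotations (instantiate s σ) ] inner (proj₂ (lookup π f)) d)
          ≡⟨ ∑-cong segments (λ seg → ∑-cong (proj₁ seg) (λ s → trans
               (∑-cong (proj₂ seg) (λ σ → trans
                 (rotations-lookup (λ X → inner (proj₂ X) d) (instantiate s σ) f) (shape-forms s σ)))
               (sym (∑-concatMap _ (proj₂ seg) _)))) ⟩
        (∑[ seg ∈ segments ] ∑[ s ∈ proj₁ seg ] ∑[ L ∈ forms (proj₂ seg) ] K (⟦ L ⟧ s))
          ≡⟨ inner-total d d≢0 ⟩
        λ₀ ∎
        where
        open Circulant k d d≢0
        shape-forms : ∀ s σ → (∑[ f ∈ allFin q ] inner (proj₂ (lookup (instantiate s σ) f)) d)
          ≡ (∑[ L ∈ concatMap (λ f → differences (lookup σ f)) (allFin q) ] K (⟦ L ⟧ s))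
        shape-forms s σ = trans
          (∑-cong (allFin q) (λ f → trans (cong (λ T → inner T d) (lookup-instantiate s σ f))
            (trans (inner≡H (at s (lookup σ f))) (H-at s (lookup σ f)))))
          (sym (∑-concatMap _ (allFin q) _))

      cross-patterns : ∀ f f′ → f ≢ f′ → ∀ d →
        (∑[ π ∈ patterns ] mixed (lookup π f) (lookup π f′) d) ≡ λ₀ * k
      cross-patterns f f′ f≢f′ d = begin
        (∑[ π ∈ patterns ] mixed (lookup π f) (lookup π f′) d)
          ≡⟨ ∑-patterns _ ⟩
        (∑[ seg ∈ segments ] ∑[ s ∈ proj₁ seg ] ∑[ σ ∈ proj₂ seg ]
          ∑[ π ∈ rotations (instantiate s σ) ] mixed (lookup π f) (lookup π f′) d)
          ≡⟨ ∑-cong-All (All.map (λ {seg} bal → trans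
               (∑-cong (proj₁ seg) (λ s → ∑-cong-All (All.map (λ bal-σ → mixed-pairs bal-σ s f f′ f≢f′ d) bal)))
               (∑-const (proj₁ seg) (∑ (proj₂ seg) pairs))) balanced) ⟩
        (∑[ seg ∈ segments ] length (proj₁ seg) * ∑ (proj₂ seg) pairs)
          ≡⟨ pairs-total f f′ f≢f′ ⟩
        λ₀ * k ∎

      planned-design : ∀ {n λ₁ λ₂} → n ≡ q * k → λ₁ ≡ λ₀ * n → 2 * λ₂ ≡ λ₀ * (n ∸ 1) → GDD₁₅ n λ₁ λ₂
      planned-design {n} {λ₁} {λ₂} refl refl 2λ₂ = subst (λ λ₁ → GDD₁₅ n λ₁ λ₂) (*-comm n λ₀)
        (Development.developed-design q k patterns five-patterns same-patterns cross-patterns size-patterns count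
          (*-cancelˡ-≡ λ₂ (2 * (5 * base-count)) 2 (+-cancelʳ-≡ λ₀ (2 * λ₂) _ (begin
            2 * λ₂ + λ₀                            ≡⟨ cong (_+ λ₀) 2λ₂ ⟩
            λ₀ * (n ∸ 1) + λ₀                      ≡⟨ lemma n count ⟩
            n * λ₀                                 ≡⟨ count ⟨
            4 * (5 * base-count) + λ₀              ≡⟨ cong (_+ λ₀) (*-assoc 2 2 (5 * base-count)) ⟩
            2 * (2 * (5 * base-count)) + λ₀        ∎))))
        where
        lemma : ∀ n {m} → m + λ₀ ≡ n * λ₀ → λ₀ * (n ∸ 1) + λ₀ ≡ n * λ₀
        -- Here `n ∸ 1` truncates; the count then forces λ₀ = 0.
        lemma zero    {m} eq = trans (cong (_+ λ₀) (*-zeroʳ λ₀)) (m+n≡0⇒n≡0 m eq)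
        lemma (suc n) eq = trans (+-comm (λ₀ * n) λ₀) (cong (λ x → λ₀ + x) (*-comm λ₀ n))

-- Sums over almost all residues

module Exceptions (k : ℕ) .{{_ : NonZero k}} (j : ℤ) (k∣2j : + k ∣ᶻ + 2 ℤ.* j) where

  open Residues k

  Periodic : (ℤ → ℕ) → Set
  Periodic Φ = ∀ z → Φ (z ℤ.+ + k) ≡ Φ z

  -- A function of period k is a function on ℤ/k. The left-out parameters are given as forms
  -- evaluated at `j`, so that 0, 1, -1 and k/2 can be treated symbolically for all k at once.
  Partition : List ℤ → List Lin → Set
  Partition S E = ∀ Φ → Periodic Φ → ∑ S Φ + (∑[ σ ∈ E ] Φ (⟦ σ ⟧ j)) ≡ (∑[ s ∈ upTo k ] Φ (+ s))

  substituted : List Lin → List Lin → List Lin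
  substituted Fs E = concatMap (λ M → map (_⊚ M) Fs) E

  module _ (d : ℤ) (d≢0 : I d ≡ 0) where

    open Circulant k d d≢0
    open Half k∣2j

    -- What is missing are the forms `Fs` composed with the left-out parameters. Forms `Cs` with the
    -- same canonical list contribute the same at `j`, so adding them completes the sum to all of
    -- ℤ/k.
    ∑-except : ∀ S E Fs Cs → Partition S E → canonical Cs ≡ canonical (substituted Fs E) →
      (∑[ s ∈ S ] ∑[ L ∈ Fs ] K (⟦ L ⟧ s)) + (∑[ L ∈ Cs ] K (⟦ L ⟧ j))
      ≡ (∑[ L ∈ Fs ] ∑[ s ∈ upTo k ] K (⟦ L ⟧ (+ s)))
    ∑-except S E Fs Cs partition eq = begin
      (∑[ s ∈ S ] ∑[ L ∈ Fs ] K (⟦ L ⟧ s)) + (∑[ L ∈ Cs ] K (⟦ L ⟧ j))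
        ≡⟨ cong (λ x → (∑[ s ∈ S ] ∑[ L ∈ Fs ] K (⟦ L ⟧ s)) + x) (begin
             (∑[ L ∈ Cs ] K (⟦ L ⟧ j))
               ≡⟨ ∑-K-canonical Cs (substituted Fs E) eq ⟩
             (∑[ L ∈ substituted Fs E ] K (⟦ L ⟧ j))
               ≡⟨ ∑-concatMap _ E _ ⟩
             (∑[ M ∈ E ] ∑[ L ∈ map (_⊚ M) Fs ] K (⟦ L ⟧ j))
               ≡⟨ ∑-cong E (λ M → trans (∑-map (_⊚ M) Fs _) (∑-cong Fs (λ L → cong K (sym (⟦⊚⟧ L M j))))) ⟩
             (∑[ M ∈ E ] ∑[ L ∈ Fs ] K (⟦ L ⟧ (⟦ M ⟧ j))) ∎) ⟩
      (∑[ s ∈ S ] ∑[ L ∈ Fs ] K (⟦ L ⟧ s)) + (∑[ M ∈ E ] ∑[ L ∈ Fs ] K (⟦ L ⟧ (⟦ M ⟧ j)))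
        ≡⟨ partition (λ s → ∑[ L ∈ Fs ] K (⟦ L ⟧ s)) periodic ⟩
      (∑[ s ∈ upTo k ] ∑[ L ∈ Fs ] K (⟦ L ⟧ (+ s)))
        ≡⟨ ∑-swap (upTo k) Fs _ ⟩
      (∑[ L ∈ Fs ] ∑[ s ∈ upTo k ] K (⟦ L ⟧ (+ s))) ∎
      where
      periodic : Periodic (λ s → ∑[ L ∈ Fs ] K (⟦ L ⟧ s))
      periodic z = ∑-cong Fs (λ (c , e) → K-cong (divides (ℤ.- c) (period c e z (+ k))))
        where
        period : ∀ c e z k → c ℤ.* z ℤ.+ e ℤ.- (c ℤ.* (z ℤ.+ k) ℤ.+ e) ≡ ℤ.- c ℤ.* k
        period = ℤ-Solver.solve-∀

from-two : ℕ → List ℤ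
from-two l = map (λ i → + (2 + i)) (upTo l)

0,±1 : List Lin
0,±1 = (+ 0 , + 0) ∷ (+ 0 , + 1) ∷ (+ 0 , -1ℤ) ∷ []

-- The representatives 2, ..., k - 2 miss 0, 1 and k - 1 ≡ -1. None of these involves k/2, so j = 0
-- serves as the solution of 2j ≡ 0.
partition-odd : ∀ l → Exceptions.Partition (3 + l) (+ 0) (divides (+ 0) refl) (from-two l) 0,±1
partition-odd l Φ periodic = begin
  ∑ (from-two l) Φ + (Φ (+ 0) + (Φ (+ 1) + (Φ -1ℤ + 0)))
    ≡⟨ cong₂ (λ x y → x + (Φ (+ 0) + (Φ (+ 1) + (y + 0)))) (∑-map _ (upTo l) Φ) (sym (periodic -1ℤ)) ⟩
  (∑[ i ∈ upTo l ] Φ (+ (2 + i))) + (Φ (+ 0) + (Φ (+ 1) + (Φ (+ (2 + l)) + 0)))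
    ≡⟨ rearrange (∑[ i ∈ upTo l ] Φ (+ (2 + i))) (Φ (+ 0)) (Φ (+ 1)) (Φ (+ (2 + l))) ⟩
  Φ (+ 0) + (Φ (+ 1) + ((∑[ i ∈ upTo l ] Φ (+ (2 + i))) + Φ (+ (2 + l))))
    ≡⟨ cong (λ x → Φ (+ 0) + (Φ (+ 1) + x)) (∑-upTo-last l (λ i → Φ (+ (2 + i)))) ⟨
  Φ (+ 0) + (Φ (+ 1) + (∑[ i ∈ upTo (1 + l) ] Φ (+ (2 + i))))
    ≡⟨ trans (∑-upTo-suc (2 + l) (λ s → Φ (+ s)))
         (cong (λ x → Φ (+ 0) + x) (∑-upTo-suc (1 + l) (λ s → Φ (+ suc s)))) ⟨
  (∑[ s ∈ upTo (3 + l) ] Φ (+ s)) ∎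
  where
  rearrange : ∀ s a b c → s + (a + (b + (c + 0))) ≡ a + (b + (s + c))
  rearrange = solve-∀

-- For k = 2(l + 2) these are 2, ..., k - 2 without k/2 = l + 2.
from-two-even : ℕ → List ℤ
from-two-even l = from-two l ++ map (λ i → + (2 + l + suc i)) (upTo l)

0,±1,j : List Lin
0,±1,j = (+ 0 , + 0) ∷ (+ 0 , + 1) ∷ (+ 0 , -1ℤ) ∷ (+ 1 , + 0) ∷ []

n+n∣2n : ∀ n → + (n + n) ∣ᶻ + 2 ℤ.* + n
n+n∣2n n = divides (+ 1) (trans (eq (+ n)) (cong (λ x → + 1 ℤ.* x) (sym (ℤ.pos-+ n n))))
  where
  eq : ∀ n → + 2 ℤ.* n ≡ + 1 ℤ.* (n ℤ.+ n)
  eq = ℤ-Solver.solve-∀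

partition-even : ∀ l → Exceptions.Partition (2 + l + (2 + l)) (+ (2 + l)) (n+n∣2n (2 + l)) (from-two-even l) 0,±1,j
partition-even l Φ periodic = begin
  ∑ (from-two-even l) Φ + (Φ (+ 0) + (Φ (+ 1) + (Φ -1ℤ + (Φ (⟦ + 1 , + 0 ⟧ (+ j)) + 0))))
    ≡⟨ cong₂ _+_ (trans (∑-++ (from-two l) _ Φ) (cong₂ _+_ (∑-map _ (upTo l) Φ) (∑-map _ (upTo l) Φ)))
         (cong₂ (λ x y → Φ (+ 0) + (Φ (+ 1) + (x + (y + 0)))) last (cong Φ (⟦j⟧ (+ j)))) ⟩
  P + Q + (Φ (+ 0) + (Φ (+ 1) + (Φ (+ (j + suc l)) + (Φ (+ j) + 0))))
    ≡⟨ rearrange P Q (Φ (+ 0)) (Φ (+ 1)) (Φ (+ (j + suc l))) (Φ (+ j)) ⟩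
  Φ (+ 0) + (Φ (+ 1) + P) + (Φ (+ j) + (Q + Φ (+ (j + suc l))))
    ≡⟨ cong₂ _+_ (trans (∑-upTo-suc (1 + l) (λ s → Φ (+ s))) (cong (λ x → Φ (+ 0) + x) (∑-upTo-suc l (λ s → Φ (+ suc s)))))
         (trans (∑-upTo-suc (1 + l) (λ i → Φ (+ (j + i)))) (cong₂ _+_ (cong (λ i → Φ (+ i)) (+-identityʳ j)) (∑-upTo-last l (λ i → Φ (+ (j + suc i)))))) ⟨
  (∑[ s ∈ upTo j ] Φ (+ s)) + (∑[ s ∈ upTo j ] Φ (+ (j + s)))
    ≡⟨ ∑-upTo-+ j j (λ s → Φ (+ s)) ⟨
  (∑[ s ∈ upTo (j + j) ] Φ (+ s)) ∎
  where
  j P Q : ℕ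
  j = 2 + l
  P = ∑[ i ∈ upTo l ] Φ (+ (2 + i))
  Q = ∑[ i ∈ upTo l ] Φ (+ (j + suc i))
  last : Φ -1ℤ ≡ Φ (+ (j + suc l))
  last = trans (sym (periodic -1ℤ)) (cong (λ i → Φ (+ suc i)) (+-suc l (suc l)))
  ⟦j⟧ : ∀ j → + 1 ℤ.* j ℤ.+ + 0 ≡ j
  ⟦j⟧ = ℤ-Solver.solve-∀
  rearrange : ∀ p q a b c d → p + q + (a + (b + (c + (d + 0)))) ≡ a + (b + p) + (d + (q + c))
  rearrange = solve-∀

-- Sums over half of the nonzero residues for odd k.

half-range : ℕ → List ℤ
half-range v = map (λ i → + suc i) (upTo v)

∑-upTo-reverse : ∀ v (f : ℕ → ℕ) → (∑[ i ∈ upTo v ] f (v ∸ suc i)) ≡ ∑ (upTo v) f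
∑-upTo-reverse zero    f = refl
∑-upTo-reverse (suc v) f = begin
  (∑[ i ∈ upTo (suc v) ] f (v ∸ i))        ≡⟨ ∑-upTo-suc v (λ i → f (v ∸ i)) ⟩
  f v + (∑[ i ∈ upTo v ] f (v ∸ suc i))    ≡⟨ cong (λ x → f v + x) (∑-upTo-reverse v f) ⟩
  f v + ∑ (upTo v) f                       ≡⟨ +-comm (f v) _ ⟩
  ∑ (upTo v) f + f v                       ≡⟨ ∑-upTo-last v f ⟨
  ∑ (upTo (suc v)) f                       ∎

module HalfRange (k v : ℕ) .{{_ : NonZero k}} (k≡1+2v : k ≡ 1 + (v + v)) where

  open Residues k
  open Units k

  2-unit : Unit 2
  2-unit = has-inverse (suc v) 1 (trans (eq v) (cong (λ x → 1 + 1 * x) (sym k≡1+2v)))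
    where
    eq : ∀ v → 2 * suc v ≡ 1 + 1 * (1 + (v + v))
    eq = solve-∀

  module _ (d : ℤ) (d≢0 : I d ≡ 0) where

    open Circulant k d d≢0

    K-reflect : ∀ c {i} → i < v → K (⟦ c , + 0 ⟧ (+ suc (v + i))) ≡ K (⟦ c , + 0 ⟧ (+ suc (v ∸ suc i)))
    K-reflect c {i} i<v = K-cong⁻ (divides c (trans (eq c (+ suc (v ∸ suc i)) (+ suc (v + i))) (cong (λ x → c ℤ.* x) sum≡k)))
      where
      eq : ∀ c a b → c ℤ.* a ℤ.+ + 0 ℤ.+ (c ℤ.* b ℤ.+ + 0) ≡ c ℤ.* (a ℤ.+ b)
      eq = ℤ-Solver.solve-∀
      sum≡k : + suc (v ∸ suc i) ℤ.+ + suc (v + i) ≡ + k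
      sum≡k = trans (sym (ℤ.pos-+ (suc (v ∸ suc i)) (suc (v + i)))) (cong +_ (begin
        suc (v ∸ suc i) + suc (v + i)     ≡⟨ rearrange (v ∸ suc i) v i ⟩
        1 + ((v ∸ suc i + suc i) + v)     ≡⟨ cong (λ x → 1 + (x + v)) (m∸n+n≡m i<v) ⟩
        1 + (v + v)                       ≡⟨ k≡1+2v ⟨
        k                                 ∎))
        where
        rearrange : ∀ u v i → suc u + suc (v + i) ≡ 1 + ((u + suc i) + v)
        rearrange = solve-∀

    -- The reflection s ↦ k - s negates c s and `K` is even, so the half range carries half of the
    -- full sum 2; the term at s = 0 vanishes.
    ∑-K-half : ∀ {c} → Unit c → (∑[ s ∈ half-range v ] K (⟦ + c , + 0 ⟧ s)) ≡ 1
    ∑-K-half {c} unit = trans (∑-map _ (upTo v) f) (*-cancelˡ-≡ (∑ (upTo v) g) 1 2 (begin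
      ∑ (upTo v) g + (∑ (upTo v) g + 0)
        ≡⟨ cong (λ x → ∑ (upTo v) g + x) (trans (+-identityʳ _) (sym (∑-upTo-reverse v g))) ⟩
      ∑ (upTo v) g + (∑[ i ∈ upTo v ] g (v ∸ suc i))
        ≡⟨ cong (λ x → ∑ (upTo v) g + x) (∑-upTo-cong v (λ i<v → K-reflect (+ c) i<v)) ⟨
      ∑ (upTo v) g + (∑[ i ∈ upTo v ] g (v + i))
        ≡⟨ ∑-upTo-+ v v g ⟨
      ∑ (upTo (v + v)) g
        ≡⟨ cong (_+ ∑ (upTo (v + v)) g) (trans (cong K (zero-form (+ c))) K-0) ⟨
      f (+ 0) + ∑ (upTo (v + v)) g
        ≡⟨ ∑-upTo-suc (v + v) (λ s → f (+ s)) ⟨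
      (∑[ s ∈ upTo (1 + (v + v)) ] f (+ s))
        ≡⟨ cong (λ m → ∑[ s ∈ upTo m ] f (+ s)) k≡1+2v ⟨
      (∑[ s ∈ upTo k ] f (+ s))
        ≡⟨ ∑-K-unit unit (+ 0) ⟩
      2 ∎))
      where
      f : ℤ → ℕ
      f s = K (⟦ + c , + 0 ⟧ s)
      g : ℕ → ℕ
      g i = f (+ suc i)
      zero-form : ∀ c → c ℤ.* + 0 ℤ.+ + 0 ≡ + 0
      zero-form = ℤ-Solver.solve-∀

-- Cyclic rotations of one, two and three fibres

rotations₁ : Vec A 1 → List (Vec A 1)
rotations₁ v = v ∷ []

rotations₂ : Vec A 2 → List (Vec A 2)
rotations₂ (x ∷ y ∷ []) = (x ∷ y ∷ []) ∷ (y ∷ x ∷ []) ∷ []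

rotations₃ : Vec A 3 → List (Vec A 3)
rotations₃ (x ∷ y ∷ z ∷ []) = (x ∷ y ∷ z ∷ []) ∷ (y ∷ z ∷ x ∷ []) ∷ (z ∷ x ∷ y ∷ []) ∷ []

swap₂ : ∀ x y → y + (x + 0) ≡ x + (y + 0)
swap₂ = solve-∀

rotate₃ : ∀ x y z → y + (z + (x + 0)) ≡ x + (y + (z + 0))
rotate₃ = solve-∀

rotations₁-lookup : (g : A → ℕ) (v : Vec A 1) (f : Fin 1) →
  (∑[ w ∈ rotations₁ v ] g (lookup w f)) ≡ (∑[ f ∈ allFin 1 ] g (lookup v f))
rotations₁-lookup g (x ∷ []) zero  = refl

rotations₂-lookup : (g : A → ℕ) (v : Vec A 2) (f : Fin 2) →
  (∑[ w ∈ rotations₂ v ] g (lookup w f)) ≡ (∑[ f ∈ allFin 2 ] g (lookup v f))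
rotations₂-lookup g (x ∷ y ∷ []) zero        = refl
rotations₂-lookup g (x ∷ y ∷ []) (suc zero)  = swap₂ (g x) (g y)

rotations₃-lookup : (g : A → ℕ) (v : Vec A 3) (f : Fin 3) →
  (∑[ w ∈ rotations₃ v ] g (lookup w f)) ≡ (∑[ f ∈ allFin 3 ] g (lookup v f))
rotations₃-lookup g (x ∷ y ∷ z ∷ []) zero              = refl
rotations₃-lookup g (x ∷ y ∷ z ∷ []) (suc zero)        = rotate₃ (g x) (g y) (g z)
rotations₃-lookup g (x ∷ y ∷ z ∷ []) (suc (suc zero))  = sym (rotate₃ (g z) (g x) (g y))

rotations₁-total : (g : A → ℕ) (v : Vec A 1) →
  All (λ w → (∑[ f ∈ allFin 1 ] g (lookup w f)) ≡ (∑[ f ∈ allFin 1 ] g (lookup v f))) (rotations₁ v)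
rotations₁-total g v = refl ∷ []

rotations₂-total : (g : A → ℕ) (v : Vec A 2) →
  All (λ w → (∑[ f ∈ allFin 2 ] g (lookup w f)) ≡ (∑[ f ∈ allFin 2 ] g (lookup v f))) (rotations₂ v)
rotations₂-total g (x ∷ y ∷ []) = refl ∷ swap₂ (g x) (g y) ∷ []

rotations₃-total : (g : A → ℕ) (v : Vec A 3) →
  All (λ w → (∑[ f ∈ allFin 3 ] g (lookup w f)) ≡ (∑[ f ∈ allFin 3 ] g (lookup v f))) (rotations₃ v)
rotations₃-total g (x ∷ y ∷ z ∷ []) =
  refl ∷ rotate₃ (g x) (g y) (g z) ∷ sym (rotate₃ (g z) (g x) (g y)) ∷ []

pairs₁ : Shape 1 → ℕ
pairs₁ _ = 0

pairs₂ : Shape 2 → ℕ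
pairs₂ (X ∷ Y ∷ []) = 2 * (length X * length Y)

pairs₃ : Shape 3 → ℕ
pairs₃ (X ∷ Y ∷ Z ∷ []) = length X * length Y + (length Y * length Z + (length X * length Z + 0))

-- Uniform cross differences on one, two and three fibres.

module One-fibre (k : ℕ) .{{_ : NonZero k}} where

  open Plan k (+ 0 ∷ []) rotations₁ rotations₁-lookup rotations₁-total pairs₁ public

  balanced₁ : ∀ σ → Balanced σ
  balanced₁ σ = balance λ { s zero zero 0≢0 → contradiction refl 0≢0 }

module Two-fibres (k : ℕ) .{{_ : NonZero k}} where

  open Plan k (+ 0 ∷ + 1 ∷ []) rotations₂ rotations₂-lookup rotations₂-total pairs₂ public
  open Differences k
  open Units k

  balanced₂ : ∀ σ → Balanced σ
  balanced₂ (X ∷ Y ∷ []) = balance λ s f f′ f≢f′ d → cases s d f f′ f≢f′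
    where
    module _ (s d : ℤ) where
      lengths : ∀ {n} → n ≡ length (at s X) * length (at s Y) → n ≡ length X * length Y
      lengths eq = trans eq (cong₂ _*_ (length-map _ X) (length-map _ Y))
      xy : mixed (+ 0 , at s X) (+ 1 , at s Y) d ≡ length X * length Y
      xy = lengths (mixed-unit (+ 0) (+ 1) refl 1-unit (at s X) (at s Y) d)
      yx : mixed (+ 1 , at s Y) (+ 0 , at s X) d ≡ length X * length Y
      yx = lengths (mixed-unit-sym (+ 0) (+ 1) refl 1-unit (at s X) (at s Y) d)
      cases : ∀ f f′ → f ≢ f′ →
        (∑[ π ∈ rotations₂ (instantiate s (X ∷ Y ∷ [])) ] mixed (lookup π f) (lookup π f′) d) ≡ pairs₂ (X ∷ Y ∷ [])
      cases zero       zero       0≢0 = contradiction refl 0≢0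
      cases zero       (suc zero) _   = cong₂ (λ a b → a + (b + 0)) xy yx
      cases (suc zero) zero       _   = cong₂ (λ a b → a + (b + 0)) yx xy
      cases (suc zero) (suc zero) 1≢1 = contradiction refl 1≢1

module Three-fibres (k : ℕ) .{{_ : NonZero k}} where

  -- The multipliers 0, 1, -1 differ by 1, 1 and 2, so for even k only the parts with multipliers 1
  -- and -1 need care.
  open Plan k (+ 0 ∷ + 1 ∷ -1ℤ ∷ []) rotations₃ rotations₃-lookup rotations₃-total pairs₃ public
  open Differences k
  open Residues k
  open Units k

  Good : List Lin → List Lin → Set
  Good Y Z = ∀ s d → mixed (+ 1 , at s Y) (-1ℤ , at s Z) d ≡ length (at s Y) * length (at s Z)

  balanced₃ : ∀ {X Y Z} → Good Y Z → Balanced (X ∷ Y ∷ Z ∷ [])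
  balanced₃ {X} {Y} {Z} good = balance λ s f f′ f≢f′ d → cases s d f f′ f≢f′
    where
    module _ (s d : ℤ) where
      lengths : ∀ (S T : List Lin) {n} → n ≡ length (at s S) * length (at s T) → n ≡ length S * length T
      lengths S T eq = trans eq (cong₂ _*_ (length-map _ S) (length-map _ T))
      xy : mixed (+ 0 , at s X) (+ 1 , at s Y) d ≡ length X * length Y
      xy = lengths X Y (mixed-unit (+ 0) (+ 1) refl 1-unit (at s X) (at s Y) d)
      yx : mixed (+ 1 , at s Y) (+ 0 , at s X) d ≡ length X * length Y
      yx = lengths X Y (mixed-unit-sym (+ 0) (+ 1) refl 1-unit (at s X) (at s Y) d)
      zx : mixed (-1ℤ , at s Z) (+ 0 , at s X) d ≡ length X * length Z
      zx = trans (lengths Z X (mixed-unit -1ℤ (+ 0) refl 1-unit (at s Z) (at s X) d)) (*-comm (length Z) (length X))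
      xz : mixed (+ 0 , at s X) (-1ℤ , at s Z) d ≡ length X * length Z
      xz = trans (lengths Z X (mixed-unit-sym -1ℤ (+ 0) refl 1-unit (at s Z) (at s X) d)) (*-comm (length Z) (length X))
      yz : mixed (+ 1 , at s Y) (-1ℤ , at s Z) d ≡ length Y * length Z
      yz = lengths Y Z (good s d)
      zy : mixed (-1ℤ , at s Z) (+ 1 , at s Y) d ≡ length Y * length Z
      zy = lengths Y Z (trans (mixed-sym (-1ℤ , at s Z) (+ 1 , at s Y) d) (good s (ℤ.- d)))
      a₁ a₂ a₃ : ℕ
      a₁ = length X * length Y
      a₂ = length Y * length Z
      a₃ = length X * length Z
      cases : ∀ f f′ → f ≢ f′ →
        (∑[ π ∈ rotations₃ (instantiate s (X ∷ Y ∷ Z ∷ [])) ] mixed (lookup π f) (lookup π f′) d) ≡ pairs₃ (X ∷ Y ∷ Z ∷ [])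
      cases zero zero 0≢0 = contradiction refl 0≢0
      cases zero (suc zero) _ = cong₂ _+_ xy (cong₂ _+_ yz (cong (_+ 0) zx))
      cases zero (suc (suc zero)) _ = trans (cong₂ _+_ xz (cong₂ _+_ yx (cong (_+ 0) zy))) (sym (rotate₃ a₃ a₁ a₂))
      cases (suc zero) zero _ = cong₂ _+_ yx (cong₂ _+_ zy (cong (_+ 0) xz))
      cases (suc zero) (suc zero) 1≢1 = contradiction refl 1≢1
      cases (suc zero) (suc (suc zero)) _ = trans (cong₂ _+_ yz (cong₂ _+_ zx (cong (_+ 0) xy))) (rotate₃ a₁ a₂ a₃)
      cases (suc (suc zero)) zero _ = trans (cong₂ _+_ zx (cong₂ _+_ xy (cong (_+ 0) yz))) (sym (rotate₃ a₃ a₁ a₂))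
      cases (suc (suc zero)) (suc zero) _ = trans (cong₂ _+_ zy (cong₂ _+_ xz (cong (_+ 0) yx))) (rotate₃ a₁ a₂ a₃)
      cases (suc (suc zero)) (suc (suc zero)) 2≢2 = contradiction refl 2≢2

  good-unit : Unit 2 → ∀ Y Z → Good Y Z
  good-unit unit Y Z s d = trans (mixed-unit-sym -1ℤ (+ 1) refl unit (at s Z) (at s Y) d)
    (*-comm (length (at s Z)) (length (at s Y)))

  good-[] : ∀ Y → Good Y []
  good-[] Y s d = trans (∑-const (at s Y) 0) refl

  evens : ℤ → ℕ
  evens x = ∑[ a ∈ upTo k ] I (x ℤ.- + 2 ℤ.* + a)

  -- Raising x by 2 amounts to a cyclic shift of the summation index a.
  evens-suc : ∀ x → evens (x ℤ.+ + 2) ≡ evens x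
  evens-suc x = sym (trans
    (∑-cong (upTo k) (λ a → cong I (eq x (+ a))))
    (∑-upTo-shift k {λ a → I (x ℤ.+ + 2 ℤ.- + 2 ℤ.* + a)} (I-cong (divides (+ 2) (eq′ x (+ k))))))
    where
    eq : ∀ x a → x ℤ.- + 2 ℤ.* a ≡ x ℤ.+ + 2 ℤ.- + 2 ℤ.* (+ 1 ℤ.+ a)
    eq = ℤ-Solver.solve-∀
    eq′ : ∀ x k → x ℤ.+ + 2 ℤ.- + 2 ℤ.* + 0 ℤ.- (x ℤ.+ + 2 ℤ.- + 2 ℤ.* k) ≡ + 2 ℤ.* k
    eq′ = ℤ-Solver.solve-∀

  evens-+ : ∀ x n → evens (x ℤ.+ + 2 ℤ.* + n) ≡ evens x
  evens-+ x zero    = cong evens (ℤ.+-identityʳ x)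
  evens-+ x (suc n) = trans (cong evens (eq x (+ n))) (trans (evens-suc (x ℤ.+ + 2 ℤ.* + n)) (evens-+ x n))
    where
    eq : ∀ x n → x ℤ.+ + 2 ℤ.* (+ 1 ℤ.+ n) ≡ x ℤ.+ + 2 ℤ.* n ℤ.+ + 2
    eq = ℤ-Solver.solve-∀

  evens-shift : ∀ x t → evens (x ℤ.+ + 2 ℤ.* t) ≡ evens x
  evens-shift x (+ n)    = evens-+ x n
  evens-shift x -[1+ n ] = trans (sym (evens-+ (x ℤ.+ + 2 ℤ.* -[1+ n ]) (suc n))) (cong evens (eq x (+ suc n)))
    where
    eq : ∀ x m → x ℤ.+ + 2 ℤ.* (ℤ.- m) ℤ.+ + 2 ℤ.* m ≡ x
    eq = ℤ-Solver.solve-∀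

  -- A pair at odd distance on the second fibre makes up for 2 not being a unit.
  good-odd : ∀ c e Z → Good ((+ 0 , + 0) ∷ (+ 2 ℤ.* c , + 1 ℤ.+ + 2 ℤ.* e) ∷ []) Z
  good-odd c e Z s d = begin
    mixed (+ 1 , y ∷ y′ ∷ []) (-1ℤ , at s Z) d
      ≡⟨ cong (λ x → M y + x) (+-identityʳ (M y′)) ⟩
    M y + M y′
      ≡⟨ ∑-+ (at s Z) _ _ ⟨
    (∑[ w ∈ at s Z ] N y w + N y′ w)
      ≡⟨ ∑-cong (at s Z) odd-pair ⟩
    ∑ (at s Z) (const 2)
      ≡⟨ trans (∑-const (at s Z) 2) (*-comm (length (at s Z)) 2) ⟩
    2 * length (at s Z) ∎
    where
    y y′ : ℤ
    y  = ⟦ + 0 , + 0 ⟧ s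
    y′ = ⟦ + 2 ℤ.* c , + 1 ℤ.+ + 2 ℤ.* e ⟧ s
    N : ℤ → ℤ → ℕ
    N v w = ∑[ a ∈ upTo k ] I (d ℤ.- (w ℤ.- v ℤ.+ (-1ℤ ℤ.- + 1) ℤ.* + a))
    M : ℤ → ℕ
    M v = ∑[ w ∈ at s Z ] N v w
    odd-pair : ∀ w → N y w + N y′ w ≡ 2
    odd-pair w = begin
      N y w + N y′ w
        ≡⟨ cong₂ _+_ (∑-cong (upTo k) (λ a → I-neg-≡ (eq d w (+ a))))
             (trans (∑-cong (upTo k) (λ a → I-neg-≡ (eq′ c e s d w (+ a)))) (evens-shift (w ℤ.- d ℤ.- + 1) _)) ⟩
      evens (w ℤ.- d) + evens (w ℤ.- d ℤ.- + 1)
        ≡⟨ ∑-+ (upTo k) _ _ ⟨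
      (∑[ a ∈ upTo k ] I (w ℤ.- d ℤ.- + 2 ℤ.* + a) + I (w ℤ.- d ℤ.- + 1 ℤ.- + 2 ℤ.* + a))
        ≡⟨ ∑-I-even-odd (w ℤ.- d) ⟩
      2 ∎
      where
      eq : ∀ d w a → ℤ.- (d ℤ.- (w ℤ.- + 0 ℤ.+ (-1ℤ ℤ.- + 1) ℤ.* a)) ≡ w ℤ.- d ℤ.- + 2 ℤ.* a
      eq = ℤ-Solver.solve-∀
      eq′ : ∀ c e s d w a →
        ℤ.- (d ℤ.- (w ℤ.- (+ 2 ℤ.* c ℤ.* s ℤ.+ (+ 1 ℤ.+ + 2 ℤ.* e)) ℤ.+ (-1ℤ ℤ.- + 1) ℤ.* a))
        ≡ w ℤ.- d ℤ.- + 1 ℤ.+ + 2 ℤ.* ℤ.- (c ℤ.* s ℤ.+ e) ℤ.- + 2 ℤ.* a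
      eq′ = ℤ-Solver.solve-∀

consts multiples : List ℤ → List Lin
consts    = map (λ e → + 0 , e)
multiples = map (λ c → c , + 0)

∑-pointwise : (xs : List A) (f : A → ℕ) {ws : List ℕ} → Pointwise (λ x w → f x ≡ w) xs ws → ∑ xs f ≡ sum ws
∑-pointwise []       f []         = refl
∑-pointwise (x ∷ xs) f (eq ∷ eqs) = cong₂ _+_ eq (∑-pointwise xs f eqs)

length-from-two : ∀ l → length (from-two l) ≡ l
length-from-two l = trans (length-map _ (upTo l)) (length-upTo l)

length-from-two-even : ∀ l → length (from-two-even l) ≡ l + l
length-from-two-even l = trans (length-++ (from-two l)) (cong₂ _+_ (length-from-two l)
  (trans (length-map _ (upTo l)) (length-upTo l)))

length-half-range : ∀ v → length (half-range v) ≡ v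
length-half-range v = trans (length-map _ (upTo v)) (length-upTo v)

-- n coprime to 6

-- The progression -2s, ..., 2s is unchanged by s ↦ -s, so half of the parameters suffice. Its
-- differences are s four times, 2s three times, 3s twice and 4s once; each contributes 1 over the
-- half range, which gives λ₀ = 10.
symmetric : List (Shape 1)
symmetric =
  (multiples (-[1+ 1 ] ∷ -1ℤ ∷ + 0 ∷ + 1 ∷ + 2 ∷ []) ∷ []) ∷ []

design-coprime-6 : ∀ h {n λ₁ λ₂} → Units.Unit (1 + (h + h)) 3 →
  n ≡ 1 + (h + h) → λ₁ ≡ 10 * n → 2 * λ₂ ≡ 10 * (n ∸ 1) → GDD₁₅ n λ₁ λ₂
design-coprime-6 h 3-unit n≡k = planned-design ((half-range h , symmetric) ∷ [])
  ((refl ∷ []) ∷ [])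
  (All.universal (λ seg → All.universal balanced₁ (proj₂ seg)) _)
  inner-total
  (λ { zero zero 0≢0 → contradiction refl 0≢0 })
  count
  (trans n≡k (sym (*-identityˡ k)))
  where
  k : ℕ
  k = 1 + (h + h)
  open One-fibre k
  open Residues k
  open Units k
  open HalfRange k h refl
  4-unit : Unit 4
  -- The inverse of 2 is h + 1; its square inverts 4, since (k + 1)² = 1 + (k + 2)k.
  4-unit = has-inverse (suc h * suc h) (2 + k) (eq h)
    where
    eq : ∀ h → 4 * (suc h * suc h) ≡ 1 + (2 + (1 + (h + h))) * (1 + (h + h))
    eq = solve-∀
  inner-total : ∀ d (d≢0 : I d ≡ 0) → (∑[ s ∈ half-range h ] ∑[ L ∈ forms symmetric ] Circulant.K k d d≢0 (⟦ L ⟧ s)) + 0 ≡ 10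
  inner-total d d≢0 = trans (+-identityʳ _) (trans (∑-swap (half-range h) (forms symmetric) (λ s L → K (⟦ L ⟧ s)))
    (∑-const-All (forms symmetric) (λ L → ∑[ s ∈ half-range h ] K (⟦ L ⟧ s))
      (u 1-unit ∷ u 2-unit ∷ u 3-unit ∷ u 4-unit ∷ u 1-unit ∷ u 2-unit ∷ u 3-unit ∷ u 1-unit ∷ u 2-unit ∷ u 1-unit ∷ [])))
    where
    open Circulant k d d≢0
    u : ∀ {c} → Unit c → (∑[ s ∈ half-range h ] K (⟦ + c , + 0 ⟧ s)) ≡ 1
    u = ∑-K-half d d≢0
  count : 4 * (5 * (length (half-range h) * 1 + 0)) + 10 ≡ 1 * k * 10
  count rewrite length-half-range h = eq h
    where
    eq : ∀ h → 4 * (5 * (h * 1 + 0)) + 10 ≡ 1 * (1 + (h + h)) * 10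
    eq = solve-∀

-- n an odd multiple of 3

triple-odd : List (Shape 3)
triple-odd =
  (multiples (-1ℤ ∷ + 0 ∷ + 1 ∷ []) ∷ multiples (+ 0 ∷ + 1 ∷ []) ∷ [] ∷ []) ∷ []

-- Per pair of fibres, the rotations of a 3 + 2 splitting give 6 cross pairs and those of a 2 + 2 +
-- 1 splitting give 8. If x and y of them are used, then up to bounded terms x + y = 3k/2 and 6x +
-- 8y = 10k, so x = k and y = k/2: hence the half range for this shape.
triple-odd-half : List (Shape 3)
triple-odd-half =
  (consts (+ 0 ∷ []) ∷ multiples (+ 0 ∷ + 1 ∷ []) ∷ multiples (+ 0 ∷ + 1 ∷ []) ∷ []) ∷ []

-- Up to sign, the differences of triple-odd at s = 0, ±1 (as for every list named rest
-- below, where s = k/2 is added when k is even).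

triple-odd-rest : List (Shape 3)
triple-odd-rest =
  (consts (+ 0 ∷ []) ∷ consts (+ 0 ∷ + 1 ∷ []) ∷ consts (+ 0 ∷ + 1 ∷ []) ∷ []) ∷
  (consts (+ 0 ∷ []) ∷ consts (+ 0 ∷ + 1 ∷ []) ∷ consts (+ 0 ∷ + 2 ∷ []) ∷ []) ∷
  (consts (+ 1 ∷ + 0 ∷ -1ℤ ∷ []) ∷ consts (+ 0 ∷ -1ℤ ∷ []) ∷ [] ∷ []) ∷ []

design-triple-odd : ∀ w {n λ₁ λ₂} →
  n ≡ 3 * (3 + (w + w)) → λ₁ ≡ 10 * n → 2 * λ₂ ≡ 10 * (n ∸ 1) → GDD₁₅ n λ₁ λ₂
design-triple-odd w = planned-design
  -- Without s = 0 alone, one pattern with 10 cross pairs and no internal differences would be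
  -- missing. Leaving out s = 1 and s = -1 raises this to 22 = 8 + 8 + 6 cross pairs on three
  -- patterns, with eight differences to supply.
  ((from-two (w + w) , triple-odd) ∷ (half-range (suc w) , triple-odd-half) ∷ (+ 0 ∷ [] , triple-odd-rest) ∷ [])
  ((refl ∷ []) ∷ (refl ∷ []) ∷ (refl ∷ refl ∷ refl ∷ []) ∷ [])
  ((bal ∷ []) ∷ (bal ∷ []) ∷ (bal ∷ bal ∷ bal ∷ []) ∷ [])
  inner-total
  (λ _ _ _ → pairs-total)
  count
  where
  k : ℕ
  k = 3 + (w + w)
  k≡1+2v : k ≡ 1 + (suc w + suc w)
  k≡1+2v = cong (λ x → 2 + x) (sym (+-suc w w))
  open Three-fibres k
  open Residues k
  open Units k
  open HalfRange k (suc w) k≡1+2v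
  bal : ∀ {X Y Z} → Balanced (X ∷ Y ∷ Z ∷ [])
  bal {X} {Y} {Z} = balanced₃ {X} {Y} {Z} (good-unit 2-unit Y Z)
  inner-total : ∀ d (d≢0 : I d ≡ 0) → let open Circulant k d d≢0 in
    (∑[ s ∈ from-two (w + w) ] ∑[ L ∈ forms triple-odd ] K (⟦ L ⟧ s))
    + ((∑[ s ∈ half-range (suc w) ] ∑[ L ∈ forms triple-odd-half ] K (⟦ L ⟧ s))
    + ((∑[ L ∈ forms triple-odd-rest ] K (⟦ L ⟧ (+ 0))) + 0 + 0)) ≡ 10
  inner-total d d≢0 = trans (rearrange (∑[ s ∈ from-two (w + w) ] ∑[ L ∈ forms triple-odd ] K (⟦ L ⟧ s))
    (∑[ s ∈ half-range (suc w) ] ∑[ L ∈ forms triple-odd-half ] K (⟦ L ⟧ s)) (∑[ L ∈ forms triple-odd-rest ] K (⟦ L ⟧ (+ 0))))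
    (cong₂ _+_
      -- The closing `refl` evaluates both canonical lists to 1 six times and 2 twice: the forms s,
      -- 2s, s, s at s = 1 and s = -1.
      (trans (∑-except d d≢0 (from-two (w + w)) 0,±1 (forms triple-odd) (forms triple-odd-rest) (partition-odd (w + w)) refl)
        (∑-const-All (forms triple-odd) (λ L → ∑[ s ∈ upTo k ] K (⟦ L ⟧ (+ s)))
        (u 1-unit ∷ u 2-unit ∷ u 1-unit ∷ u 1-unit ∷ [])))
      (trans (∑-swap (half-range (suc w)) (forms triple-odd-half) (λ s L → K (⟦ L ⟧ s)))
        (∑-const-All (forms triple-odd-half) (λ L → ∑[ s ∈ half-range (suc w) ] K (⟦ L ⟧ s))
          (∑-K-half d d≢0 1-unit ∷ ∑-K-half d d≢0 1-unit ∷ []))))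
    where
    open Circulant k d d≢0
    open Exceptions k (+ 0) (divides (+ 0) refl)
    u : ∀ {c} → Unit c → (∑[ s ∈ upTo k ] K (⟦ + c , + 0 ⟧ (+ s))) ≡ 2
    u unit = ∑-K-unit unit (+ 0)
    rearrange : ∀ a b c → a + (b + (c + 0 + 0)) ≡ a + c + b
    rearrange = solve-∀
  pairs-total : length (from-two (w + w)) * 6 + (length (half-range (suc w)) * 8 + 22) ≡ 10 * k
  pairs-total = trans (cong₂ (λ a b → a * 6 + (b * 8 + 22)) (length-from-two (w + w)) (length-half-range (suc w))) (eq w)
    where
    eq : ∀ w → (w + w) * 6 + (suc w * 8 + 22) ≡ 10 * (3 + (w + w))
    eq = solve-∀
  count : 4 * (5 * (length (from-two (w + w)) * 1 + (length (half-range (suc w)) * 1 + 3))) + 10 ≡ 3 * k * 10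
  count = trans (cong₂ (λ a b → 4 * (5 * (a * 1 + (b * 1 + 3))) + 10) (length-from-two (w + w)) (length-half-range (suc w))) (eq w)
    where
    eq : ∀ w → 4 * (5 * ((w + w) * 1 + (suc w * 1 + 3))) + 10 ≡ 3 * (3 + (w + w)) * 10
    eq = solve-∀

-- n twice a number coprime to 6

-- Over both rotations a 4 + 1 splitting has 8 cross pairs and a 3 + 2 splitting 12. One of each per
-- parameter gives 20 = λ₀, and so do the ten internal forms, which contribute 2 each.
double-odd : List (Shape 2)
double-odd =
  (multiples (+ 0 ∷ + 1 ∷ + 2 ∷ + 3 ∷ []) ∷ consts (+ 0 ∷ []) ∷ []) ∷
  (multiples (-1ℤ ∷ + 0 ∷ + 1 ∷ []) ∷ multiples (+ 0 ∷ + 1 ∷ []) ∷ []) ∷ []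

double-odd-rest : List (Shape 2)
double-odd-rest =
  (consts (-1ℤ ∷ + 0 ∷ + 1 ∷ []) ∷ consts (+ 0 ∷ + 1 ∷ []) ∷ []) ∷
  (consts (-1ℤ ∷ + 0 ∷ + 1 ∷ []) ∷ consts (+ 0 ∷ + 1 ∷ []) ∷ []) ∷
  (consts (+ 0 ∷ + 1 ∷ + 2 ∷ []) ∷ consts (+ 0 ∷ + 2 ∷ []) ∷ []) ∷
  (consts (+ 0 ∷ + 1 ∷ + 2 ∷ []) ∷ consts (+ 0 ∷ + 3 ∷ []) ∷ []) ∷
  (consts (+ 0 ∷ + 1 ∷ + 2 ∷ []) ∷ consts (+ 0 ∷ + 3 ∷ []) ∷ []) ∷ []

design-double-odd : ∀ l {n λ₁ λ₂} → Units.Unit (3 + l) 2 → Units.Unit (3 + l) 3 →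
  n ≡ 2 * (3 + l) → λ₁ ≡ 20 * n → 2 * λ₂ ≡ 20 * (n ∸ 1) → GDD₁₅ n λ₁ λ₂
design-double-odd l 2-unit 3-unit = planned-design
  ((from-two l , double-odd) ∷ (+ 0 ∷ [] , double-odd-rest) ∷ [])
  ((refl ∷ refl ∷ []) ∷ (refl ∷ refl ∷ refl ∷ refl ∷ refl ∷ []) ∷ [])
  (All.universal (λ seg → All.universal balanced₂ (proj₂ seg)) _)
  inner-total
  (λ _ _ _ → pairs-total)
  count
  where
  k : ℕ
  k = 3 + l
  open Two-fibres k
  open Residues k
  open Units k
  inner-total : ∀ d (d≢0 : I d ≡ 0) → let open Circulant k d d≢0 in
    (∑[ s ∈ from-two l ] ∑[ L ∈ forms double-odd ] K (⟦ L ⟧ s))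
    + ((∑[ L ∈ forms double-odd-rest ] K (⟦ L ⟧ (+ 0))) + 0 + 0) ≡ 20
  inner-total d d≢0 = trans
    (cong (λ x → (∑[ s ∈ from-two l ] ∑[ L ∈ forms double-odd ] K (⟦ L ⟧ s)) + x) (trans (+-identityʳ _) (+-identityʳ _)))
    (trans (∑-except d d≢0 (from-two l) 0,±1 (forms double-odd) (forms double-odd-rest) (partition-odd l) refl)
      (∑-const-All (forms double-odd) (λ L → ∑[ s ∈ upTo k ] K (⟦ L ⟧ (+ s)))
        (u 1-unit ∷ u 2-unit ∷ u 3-unit ∷ u 1-unit ∷ u 2-unit ∷ u 1-unit
          ∷ u 1-unit ∷ u 2-unit ∷ u 1-unit ∷ u 1-unit ∷ [])))
    where
    open Circulant k d d≢0
    open Exceptions k (+ 0) (divides (+ 0) refl)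
    u : ∀ {c} → Unit c → (∑[ s ∈ upTo k ] K (⟦ + c , + 0 ⟧ (+ s))) ≡ 2
    u unit = ∑-K-unit unit (+ 0)
  pairs-total : length (from-two l) * 20 + 60 ≡ 20 * k
  pairs-total rewrite length-from-two l = eq l
    where
    eq : ∀ l → l * 20 + 60 ≡ 20 * (3 + l)
    eq = solve-∀
  count : 4 * (5 * (length (from-two l) * 2 + 5)) + 20 ≡ 2 * k * 20
  count rewrite length-from-two l = eq l
    where
    eq : ∀ l → 4 * (5 * (l * 2 + 5)) + 20 ≡ 2 * (3 + l) * 20
    eq = solve-∀

-- n divisible by 4 but not by 3

-- The shapes of `double-odd` with two entries altered so that 2s and 2s + 1 each occur twice among
-- the differences. The other forms are s, s + 1, s - 1 and 3s; the forms thus vanish only at s = 0,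
-- 1, -1 and, through 2s, at s = k/2.
double-even : List (Shape 2)
double-even =
  (((+ 0 , + 0) ∷ (+ 1 , + 0) ∷ (+ 2 , + 1) ∷ (+ 3 , + 0) ∷ []) ∷ consts (+ 0 ∷ []) ∷ []) ∷
  (multiples (-1ℤ ∷ + 0 ∷ + 1 ∷ []) ∷ ((+ 0 , + 0) ∷ (+ 2 , + 1) ∷ []) ∷ []) ∷ []

double-even-rest : List (Shape 2)
double-even-rest =
  (((+ 0 , + 0) ∷ (+ 0 , + 1) ∷ (+ 1 , + 0) ∷ (+ 1 , + 1) ∷ []) ∷ consts (+ 0 ∷ []) ∷ []) ∷
  (consts (-1ℤ ∷ + 0 ∷ + 1 ∷ []) ∷ consts (+ 0 ∷ + 3 ∷ []) ∷ []) ∷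
  (consts (-1ℤ ∷ + 0 ∷ + 1 ∷ []) ∷ consts (+ 0 ∷ -1ℤ ∷ []) ∷ []) ∷
  (consts (+ 0 ∷ + 1 ∷ + 2 ∷ []) ∷ consts (+ 0 ∷ + 1 ∷ []) ∷ []) ∷
  (consts (+ 0 ∷ + 1 ∷ + 3 ∷ []) ∷ consts (+ 0 ∷ + 1 ∷ []) ∷ []) ∷
  (consts (+ 0 ∷ + 1 ∷ + 3 ∷ []) ∷ multiples (+ 0 ∷ + 1 ∷ []) ∷ []) ∷
  (consts (+ 0 ∷ + 1 ∷ + 3 ∷ []) ∷ multiples (+ 0 ∷ + 1 ∷ []) ∷ []) ∷ []

design-double-even : ∀ l {n λ₁ λ₂} → Units.Unit (2 + l + (2 + l)) 3 →
  n ≡ 2 * (2 + l + (2 + l)) → λ₁ ≡ 20 * n → 2 * λ₂ ≡ 20 * (n ∸ 1) → GDD₁₅ n λ₁ λ₂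
design-double-even l 3-unit = planned-design
  ((from-two-even l , double-even) ∷ (+ (2 + l) ∷ [] , double-even-rest) ∷ [])
  ((refl ∷ refl ∷ []) ∷ (refl ∷ refl ∷ refl ∷ refl ∷ refl ∷ refl ∷ refl ∷ []) ∷ [])
  (All.universal (λ seg → All.universal balanced₂ (proj₂ seg)) _)
  inner-total
  (λ _ _ _ → pairs-total)
  count
  where
  k : ℕ
  k = 2 + l + (2 + l)
  open Two-fibres k
  open Residues k
  open Units k
  inner-total : ∀ d (d≢0 : I d ≡ 0) → let open Circulant k d d≢0 in
    (∑[ s ∈ from-two-even l ] ∑[ L ∈ forms double-even ] K (⟦ L ⟧ s))
    + ((∑[ L ∈ forms double-even-rest ] K (⟦ L ⟧ (+ (2 + l)))) + 0 + 0) ≡ 20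
  inner-total d d≢0 = trans
    (cong (λ x → (∑[ s ∈ from-two-even l ] ∑[ L ∈ forms double-even ] K (⟦ L ⟧ s)) + x) (trans (+-identityʳ _) (+-identityʳ _)))
    (trans (∑-except d d≢0 (from-two-even l) 0,±1,j (forms double-even) (forms double-even-rest) (partition-even l) refl)
    (trans (∑-pointwise (forms double-even) (λ L → ∑[ s ∈ upTo k ] K (⟦ L ⟧ (+ s)))
        -- The `refl` entries keep the sums for 2s and 2s + 1 unevaluated: for even k they depend on
        -- d, and only their total 4 is constant.
        (u (+ 0) ∷ refl ∷ ∑-K-unit 3-unit (+ 0) ∷ u (+ 1) ∷ refl ∷ u -1ℤ
          ∷ u (+ 0) ∷ refl ∷ u (+ 0) ∷ refl ∷ []))
    (trans (eq _ _) (cong (λ x → 12 + 2 * x) ∑-K-even-odd))))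
    where
    open Circulant k d d≢0
    open Exceptions k (+ (2 + l)) (n+n∣2n (2 + l))
    u : ∀ e → (∑[ s ∈ upTo k ] K (⟦ + 1 , e ⟧ (+ s))) ≡ 2
    u = ∑-K-unit 1-unit
    eq : ∀ a b → 2 + (b + (2 + (2 + (a + (2 + (2 + (a + (2 + (b + 0))))))))) ≡ 12 + 2 * (a + b)
    eq = solve-∀
  pairs-total : length (from-two-even l) * 20 + 80 ≡ 20 * k
  pairs-total rewrite length-from-two-even l = eq l
    where
    eq : ∀ l → (l + l) * 20 + 80 ≡ 20 * (2 + l + (2 + l))
    eq = solve-∀
  count : 4 * (5 * (length (from-two-even l) * 2 + 7)) + 20 ≡ 2 * k * 20
  count rewrite length-from-two-even l = eq l
    where
    eq : ∀ l → 4 * (5 * ((l + l) * 2 + 7)) + 20 ≡ 2 * (2 + l + (2 + l)) * 20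
    eq = solve-∀

-- n divisible by 6

-- The cross pairs per parameter are 6 + 6 + 8 = 20. Two shapes leave the third part empty and so
-- avoid the relative speed 2. The last one meets it and therefore has two points at the odd
-- distance 2s + 1 in its second part; its third part with difference 2s and the entry -s - 1 of the
-- second shape even out 2s against 2s + 1.
triple-even : List (Shape 3)
triple-even =
  (multiples (-1ℤ ∷ + 0 ∷ + 1 ∷ []) ∷ multiples (+ 0 ∷ + 1 ∷ []) ∷ [] ∷ []) ∷
  (((-1ℤ , -1ℤ) ∷ (+ 0 , + 0) ∷ (+ 1 , + 0) ∷ []) ∷ multiples (+ 0 ∷ + 1 ∷ []) ∷ [] ∷ []) ∷
  (consts (+ 0 ∷ []) ∷ ((+ 0 , + 0) ∷ (+ 2 , + 1) ∷ []) ∷ multiples (+ 0 ∷ + 2 ∷ []) ∷ []) ∷ []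

triple-even-rest : List (Shape 3)
triple-even-rest =
  (consts (-1ℤ ∷ + 0 ∷ + 1 ∷ []) ∷ consts (+ 0 ∷ + 1 ∷ []) ∷ [] ∷ []) ∷
  (((-1ℤ , -1ℤ) ∷ (+ 0 , + 0) ∷ (+ 1 , + 0) ∷ []) ∷ multiples (+ 0 ∷ + 1 ∷ []) ∷ [] ∷ []) ∷
  (consts (+ 0 ∷ []) ∷ consts (+ 0 ∷ -1ℤ ∷ []) ∷ consts (+ 0 ∷ -[1+ 1 ] ∷ []) ∷ []) ∷
  (consts (+ 0 ∷ []) ∷ consts (+ 0 ∷ + 1 ∷ []) ∷ multiples (+ 0 ∷ + 1 ∷ []) ∷ []) ∷
  (consts (+ 0 ∷ []) ∷ consts (+ 0 ∷ + 1 ∷ []) ∷ multiples (+ 0 ∷ + 1 ∷ []) ∷ []) ∷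
  (consts (+ 0 ∷ []) ∷ consts (+ 0 ∷ + 1 ∷ []) ∷ multiples (+ 0 ∷ + 1 ∷ []) ∷ []) ∷
  (consts (+ 0 ∷ []) ∷ consts (+ 0 ∷ + 1 ∷ []) ∷ consts (+ 0 ∷ + 1 ∷ []) ∷ []) ∷
  (consts (+ 0 ∷ []) ∷ consts (+ 0 ∷ + 1 ∷ []) ∷ consts (+ 0 ∷ + 1 ∷ []) ∷ []) ∷
  (consts (-1ℤ ∷ + 0 ∷ + 1 ∷ []) ∷ consts (+ 0 ∷ + 1 ∷ []) ∷ [] ∷ []) ∷
  (consts (-[1+ 1 ] ∷ + 0 ∷ + 1 ∷ []) ∷ consts (+ 0 ∷ + 1 ∷ []) ∷ [] ∷ []) ∷
  (consts (+ 0 ∷ []) ∷ consts (+ 0 ∷ + 3 ∷ []) ∷ consts (+ 0 ∷ + 2 ∷ []) ∷ []) ∷ []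

design-triple-even : ∀ l {n λ₁ λ₂} →
  n ≡ 3 * (2 + l + (2 + l)) → λ₁ ≡ 20 * n → 2 * λ₂ ≡ 20 * (n ∸ 1) → GDD₁₅ n λ₁ λ₂
design-triple-even l = planned-design
  ((from-two-even l , triple-even) ∷ (+ (2 + l) ∷ [] , triple-even-rest) ∷ [])
  ((refl ∷ refl ∷ refl ∷ [])
    ∷ (refl ∷ refl ∷ refl ∷ refl ∷ refl ∷ refl ∷ refl ∷ refl ∷ refl ∷ refl ∷ refl ∷ []) ∷ [])
  ((bal[] ∷ bal[] ∷ bal (+ 1) (+ 0) ∷ [])
    ∷ (bal[] ∷ bal[] ∷ bal (+ 0) -1ℤ ∷ bal (+ 0) (+ 0) ∷ bal (+ 0) (+ 0) ∷ bal (+ 0) (+ 0)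
       ∷ bal (+ 0) (+ 0) ∷ bal (+ 0) (+ 0) ∷ bal[] ∷ bal[] ∷ bal (+ 0) (+ 1) ∷ []) ∷ [])
  inner-total
  (λ _ _ _ → pairs-total)
  count
  where
  k : ℕ
  k = 2 + l + (2 + l)
  open Three-fibres k
  open Residues k
  open Units k
  bal[] : ∀ {X Y} → Balanced (X ∷ Y ∷ [] ∷ [])
  bal[] {X} {Y} = balanced₃ {X} {Y} {[]} (good-[] Y)
  bal : ∀ c e {X Z} → Balanced (X ∷ ((+ 0 , + 0) ∷ (+ 2 ℤ.* c , + 1 ℤ.+ + 2 ℤ.* e) ∷ []) ∷ Z ∷ [])
  bal c e {X} {Z} = balanced₃ {X} {_} {Z} (good-odd c e Z)
  inner-total : ∀ d (d≢0 : I d ≡ 0) → let open Circulant k d d≢0 in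
    (∑[ s ∈ from-two-even l ] ∑[ L ∈ forms triple-even ] K (⟦ L ⟧ s))
    + ((∑[ L ∈ forms triple-even-rest ] K (⟦ L ⟧ (+ (2 + l)))) + 0 + 0) ≡ 20
  inner-total d d≢0 = trans
    (cong (λ x → (∑[ s ∈ from-two-even l ] ∑[ L ∈ forms triple-even ] K (⟦ L ⟧ s)) + x) (trans (+-identityʳ _) (+-identityʳ _)))
    (trans (∑-except d d≢0 (from-two-even l) 0,±1,j (forms triple-even) (forms triple-even-rest) (partition-even l) refl)
    (trans (∑-pointwise (forms triple-even) (λ L → ∑[ s ∈ upTo k ] K (⟦ L ⟧ (+ s)))
        (u (+ 0) ∷ refl ∷ u (+ 0) ∷ u (+ 0) ∷ u (+ 1) ∷ refl ∷ u (+ 0) ∷ u (+ 0) ∷ refl ∷ refl ∷ []))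
    (trans (eq _ _) (cong (λ x → 12 + 2 * x) ∑-K-even-odd))))
    where
    open Circulant k d d≢0
    open Exceptions k (+ (2 + l)) (n+n∣2n (2 + l))
    u : ∀ e → (∑[ s ∈ upTo k ] K (⟦ + 1 , e ⟧ (+ s))) ≡ 2
    u = ∑-K-unit 1-unit
    eq : ∀ a b → 2 + (a + (2 + (2 + (2 + (b + (2 + (2 + (b + (a + 0))))))))) ≡ 12 + 2 * (a + b)
    eq = solve-∀
  pairs-total : length (from-two-even l) * 20 + 80 ≡ 20 * k
  pairs-total rewrite length-from-two-even l = eq l
    where
    eq : ∀ l → (l + l) * 20 + 80 ≡ 20 * (2 + l + (2 + l))
    eq = solve-∀
  count : 4 * (5 * (length (from-two-even l) * 3 + 11)) + 20 ≡ 3 * k * 20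
  count rewrite length-from-two-even l = eq l
    where
    eq : ∀ l → 4 * (5 * ((l + l) * 3 + 11)) + 20 ≡ 3 * (2 + l + (2 + l)) * 20
    eq = solve-∀

-- Minimal indices

5-prime : Prime 5
5-prime = from-yes (prime? 5)

5∣-cancelˡ : ∀ {m n} → ¬ 5 ℕ.∣ m → 5 ℕ.∣ m * n → 5 ℕ.∣ n
5∣-cancelˡ {m} {n} 5∤m 5∣mn with euclidsLemma m n 5-prime 5∣mn
... | inj₁ 5∣m = contradiction 5∣m 5∤m
... | inj₂ 5∣n = 5∣n

module Indices (p : ℕ) (5∤1+p : ¬ 5 ℕ.∣ suc p) (5∤p : ¬ 5 ℕ.∣ p) where

  coprime-suc : Coprime (suc p) p
  coprime-suc {d} (d∣1+p , d∣p) = ℕ.∣1⇒≡1 (ℕ.∣m+n∣m⇒∣n (subst (d ℕ.∣_) (+-comm 1 p) d∣1+p) d∣p)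

  -- The ratio condition and gcd(n, n - 1) = 1 give n ∣ μ₁, so μ₁ = c n and 2μ₂ = c(n - 1). The
  -- numerator of the replication number becomes 3nμ₂; as 5 divides neither 3n nor n - 1, it divides
  -- μ₂ and then c.
  scale : ∀ {μ₁ μ₂} → PositiveAdmissible (suc p) μ₁ μ₂ →
    Σ[ c ∈ ℕ ] (0 < c × μ₁ ≡ c * suc p × c * p ≡ 2 * μ₂ × 5 ℕ.∣ c)
  scale {μ₁} {μ₂} (0<μ₁ , _ , ratio , _ , 5∣r)
    with coprime-divisor coprime-suc (ℕ.divides (μ₂ * 2) (trans (*-comm p μ₁) (trans (sym ratio) (sym (*-assoc μ₂ 2 (suc p))))))
  ... | ℕ.divides c refl = c , 0<c c 0<μ₁ , refl , cp≡2μ₂ , 5∣c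
    where
    0<c : ∀ c → 0 < c * suc p → 0 < c
    0<c (suc c) _ = z<s
    cp≡2μ₂ : c * p ≡ 2 * μ₂
    cp≡2μ₂ = *-cancelʳ-≡ (c * p) (2 * μ₂) (suc p) (trans (eq c p (suc p)) (trans (sym ratio) (eq′ μ₂ (suc p))))
      where
      eq : ∀ c p n → c * p * n ≡ c * n * p
      eq = solve-∀
      eq′ : ∀ μ n → μ * (2 * n) ≡ 2 * μ * n
      eq′ = solve-∀
    5∣3nμ₂ : 5 ℕ.∣ 3 * (suc p * μ₂)
    5∣3nμ₂ = subst (5 ℕ.∣_) (trans (cong (_+ μ₂ * suc p) (sym ratio)) (eq μ₂ (suc p))) 5∣r
      where
      eq : ∀ μ n → μ * (2 * n) + μ * n ≡ 3 * (n * μ)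
      eq = solve-∀
    5∣μ₂ : 5 ℕ.∣ μ₂
    5∣μ₂ = 5∣-cancelˡ 5∤1+p (5∣-cancelˡ {3} (from-no (5 ℕ.∣? 3)) 5∣3nμ₂)
    5∣c : 5 ℕ.∣ c
    5∣c = 5∣-cancelˡ 5∤p (subst (5 ℕ.∣_) (trans (sym cp≡2μ₂) (*-comm c p)) (ℕ.∣n⇒∣m*n 2 5∣μ₂))

  minimal : ∀ {a b} → 0 < a → a * p ≡ 2 * b → 0 < b →
    15 ℕ.∣ a * suc p * suc p * p + b * (suc p * suc p) →
    5 ℕ.∣ a * suc p * p + b * suc p →
    (∀ {μ₁ μ₂} → (adm : PositiveAdmissible (suc p) μ₁ μ₂) → a ≤ proj₁ (scale adm)) →
    MinimalIndices (suc p) (a * suc p) b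
  minimal {a} {b} 0<a ap≡2b 0<b 15∣ 5∣ a≤ =
    (*-mono-≤ 0<a (s≤s (z≤n {p})) , 0<b , trans (eq b (suc p)) (trans (cong (_* suc p) (sym ap≡2b)) (eq′ a p (suc p))) , 15∣ , 5∣) , least
    where
    eq : ∀ b n → b * (2 * n) ≡ 2 * b * n
    eq = solve-∀
    eq′ : ∀ a p n → a * p * n ≡ a * n * p
    eq′ = solve-∀
    least : ∀ μ₁ μ₂ → PositiveAdmissible (suc p) μ₁ μ₂ → a * suc p ≤ μ₁ × b ≤ μ₂
    least μ₁ μ₂ adm with scale adm | a≤ adm
    ... | c , _ , refl , cp≡2μ₂ , _ | a≤c = *-monoˡ-≤ (suc p) a≤c ,
      *-cancelˡ-≤ 2 (subst₂ _≤_ ap≡2b cp≡2μ₂ (*-monoˡ-≤ p a≤c))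

minimal-odd : ∀ h → 0 < h → ¬ 5 ℕ.∣ suc (h + h) → ¬ 5 ℕ.∣ h + h →
              MinimalIndices (suc (h + h)) (5 * suc (h + h)) (5 * h)
minimal-odd h 0<h 5∤n 5∤p = minimal z<s (eq₁ h) (*-mono-≤ (z<s {4}) 0<h)
  (ℕ.divides (h * n * n) (eq₂ h n)) (ℕ.divides (3 * h * n) (eq₃ h n))
  (λ adm → ∣-positive (proj₂ (scale adm)))
  where
  n : ℕ
  n = suc (h + h)
  open Indices (h + h) 5∤n 5∤p
  eq₁ : ∀ h → 5 * (h + h) ≡ 2 * (5 * h)
  eq₁ = solve-∀
  eq₂ : ∀ h n → 5 * n * n * (h + h) + 5 * h * (n * n) ≡ h * n * n * 15
  eq₂ = solve-∀
  eq₃ : ∀ h n → 5 * n * (h + h) + 5 * h * n ≡ 3 * h * n * 5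
  eq₃ = solve-∀
  ∣-positive : ∀ {c} {P Q : Set} → 0 < c × P × Q × 5 ℕ.∣ c → 5 ≤ c
  ∣-positive (0<c , _ , _ , 5∣c) = ℕ.∣⇒≤ {{>-nonZero 0<c}} 5∣c

-- For even n the factor n - 1 is odd, so c(n - 1) = 2μ₂ makes c even besides being a multiple of 5;
-- hence 10 instead of 5.
minimal-even : ∀ j → ¬ 5 ℕ.∣ suc (suc (j + j)) → ¬ 5 ℕ.∣ suc (j + j) →
               MinimalIndices (suc (suc (j + j))) (10 * suc (suc (j + j))) (5 * suc (j + j))
minimal-even j 5∤n 5∤p = minimal z<s (*-assoc 2 5 p) z<s
  (ℕ.divides (p * n * n) (eq₂ p n)) (ℕ.divides (3 * p * n) (eq₃ p n))
  (λ {_} {μ₂} adm → ten {μ₂ = μ₂} (proj₂ (scale adm)))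
  where
  p n : ℕ
  p = suc (j + j)
  n = suc p
  open Indices p 5∤n 5∤p
  eq₂ : ∀ p n → 10 * n * n * p + 5 * p * (n * n) ≡ p * n * n * 15
  eq₂ = solve-∀
  eq₃ : ∀ p n → 10 * n * p + 5 * p * n ≡ 3 * p * n * 5
  eq₃ = solve-∀
  ten : ∀ {c μ₂} {P : Set} → 0 < c × P × c * p ≡ 2 * μ₂ × 5 ℕ.∣ c → 10 ≤ c
  ten {μ₂ = μ₂} (0<c , _ , cp≡2μ₂ , ℕ.divides e refl) = *-monoˡ-≤ 5 (2≤e e 0<c cp≡2μ₂)
    where
    2∣p : ∀ {m} → 1 * 5 * p ≡ 2 * m → 2 ℕ.∣ 1
    2∣p {m} eq = ℕ.∣m+n∣m⇒∣n (ℕ.divides m (trans (sym (odd j)) (trans eq (*-comm 2 m)))) (ℕ.divides (2 + 5 * j) refl)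
      where
      odd : ∀ j → 1 * 5 * suc (j + j) ≡ (2 + 5 * j) * 2 + 1
      odd = solve-∀
    2≤e : ∀ e → 0 < e * 5 → e * 5 * p ≡ 2 * μ₂ → 2 ≤ e
    2≤e (suc zero)    _ eq = contradiction (2∣p {μ₂} eq) (from-no (2 ℕ.∣? 1))
    2≤e (suc (suc e)) _ _  = s≤s (s≤s z≤n)

-- Residues modulo 2 and 3

NonTriple : ℕ → Set
NonTriple m = Σ[ w ∈ ℕ ] (m ≡ 1 + 3 * w ⊎ m ≡ 2 + 3 * w)

thirds : ∀ m → (Σ[ t ∈ ℕ ] m ≡ 3 * t) ⊎ NonTriple m
thirds zero = inj₁ (0 , refl)
thirds (suc m) with thirds m
... | inj₁ (t , refl)          = inj₂ (t , inj₁ refl)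
... | inj₂ (w , inj₁ refl)     = inj₂ (w , inj₂ refl)
... | inj₂ (w , inj₂ refl)     = inj₁ (suc w , eq w)
  where
  eq : ∀ w → 3 + 3 * w ≡ 3 * suc w
  eq = solve-∀

halves : ∀ m → (Σ[ j ∈ ℕ ] m ≡ j + j) ⊎ (Σ[ j ∈ ℕ ] m ≡ 1 + (j + j))
halves zero = inj₁ (0 , refl)
halves (suc m) with halves m
... | inj₁ (j , refl) = inj₂ (j , refl)
... | inj₂ (j , refl) = inj₁ (suc j , cong suc (sym (+-suc j j)))

three-unit : ∀ k .{{_ : NonZero k}} → NonTriple k → Units.Unit k 3
three-unit k (w , inj₁ eq) = Units.has-inverse (2 * w + 1) 2 (trans (eq′ w) (cong (λ k → 1 + 2 * k) (sym eq)))
  where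
  eq′ : ∀ w → 3 * (2 * w + 1) ≡ 1 + 2 * (1 + 3 * w)
  eq′ = solve-∀
three-unit k (w , inj₂ eq) = Units.has-inverse (w + 1) 1 (trans (eq′ w) (cong (λ k → 1 + 1 * k) (sym eq)))
  where
  eq′ : ∀ w → 3 * (w + 1) ≡ 1 + 1 * (2 + 3 * w)
  eq′ = solve-∀

-- Choosing the construction for each n.

design-odd : ∀ h → 5 ≤ 1 + (h + h) → GDD₁₅ (1 + (h + h)) (10 * (1 + (h + h))) (5 * (h + h))
design-odd h 5≤n = cases (thirds h)
  where
  n : ℕ
  n = 1 + (h + h)
  coprime : NonTriple n → GDD₁₅ n (10 * n) (5 * (h + h))
  coprime n-non3 = design-coprime-6 h (three-unit n n-non3) refl refl (sym (*-assoc 2 5 (h + h)))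
  cases : (Σ[ t ∈ ℕ ] h ≡ 3 * t) ⊎ NonTriple h → GDD₁₅ n (10 * n) (5 * (h + h))
  cases (inj₁ (t , h≡)) = coprime (t + t , inj₁ (trans (cong (λ h → 1 + (h + h)) h≡) (eq t)))
    where
    eq : ∀ t → 1 + (3 * t + 3 * t) ≡ 1 + 3 * (t + t)
    eq = solve-∀
  cases (inj₂ (t , inj₂ h≡)) = coprime (1 + (t + t) , inj₂ (trans (cong (λ h → 1 + (h + h)) h≡) (eq t)))
    where
    eq : ∀ t → 1 + (2 + 3 * t + (2 + 3 * t)) ≡ 2 + 3 * (1 + (t + t))
    eq = solve-∀
  -- This is n = 3, below the bound; among odd n, h ≡ 1 mod 3 means 3 ∣ n.
  cases (inj₂ (zero , inj₁ h≡)) with subst (λ h → 5 ≤ 1 + (h + h)) h≡ 5≤n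
  ... | s≤s (s≤s (s≤s ()))
  cases (inj₂ (suc w , inj₁ h≡)) = design-triple-odd w
    (trans (cong (λ h → 1 + (h + h)) h≡) (eq w)) refl (sym (*-assoc 2 5 (h + h)))
    where
    eq : ∀ w → 1 + (1 + 3 * suc w + (1 + 3 * suc w)) ≡ 3 * (3 + (w + w))
    eq = solve-∀

design-even : ∀ m → 5 ≤ m + m → ¬ 5 ℕ.∣ m + m ∸ 1 → GDD₁₅ (m + m) (20 * (m + m)) (10 * (m + m ∸ 1))
design-even m 5≤n 5∤p = cases (thirds m)
  where
  n : ℕ
  n = m + m
  λ₂-eq : 2 * (10 * (n ∸ 1)) ≡ 20 * (n ∸ 1)
  λ₂-eq = sym (*-assoc 2 10 (n ∸ 1))
  cases : (Σ[ t ∈ ℕ ] m ≡ 3 * t) ⊎ NonTriple m → GDD₁₅ n (20 * n) (10 * (n ∸ 1))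
  cases (inj₁ (zero , refl)) = contradiction 5≤n λ ()
  -- This is n = 6, which would need fibres of size k = 2, where 0, 1, -1 and k/2 are no longer
  -- distinct; it is excluded because 5 divides n - 1.
  cases (inj₁ (suc zero , refl)) = contradiction (ℕ.divides 1 refl) 5∤p
  cases (inj₁ (suc (suc l) , m≡)) = design-triple-even l (trans (cong (λ m → m + m) m≡) (eq l)) refl λ₂-eq
    where
    eq : ∀ l → 3 * (2 + l) + 3 * (2 + l) ≡ 3 * (2 + l + (2 + l))
    eq = solve-∀
  cases (inj₂ m-non3) with halves m
  ... | inj₁ (zero , refl) = contradiction 5≤n λ ()
  ... | inj₁ (suc zero , refl) = contradiction 5≤n λ { (s≤s (s≤s (s≤s (s≤s ())))) }
  ... | inj₁ (suc (suc l) , refl) = design-double-even l (three-unit m m-non3) (eq m) refl λ₂-eq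
    where
    eq : ∀ m → m + m ≡ 2 * m
    eq = solve-∀
  ... | inj₂ (zero , refl) = contradiction 5≤n λ { (s≤s (s≤s ())) }
  ... | inj₂ (suc j , refl) = design-double-odd (j + j)
    (HalfRange.2-unit k (suc j) k≡m) (three-unit k (subst NonTriple (sym k≡m) m-non3))
    (trans (cong (λ m → m + m) (sym k≡m)) (eq k)) refl λ₂-eq
    where
    k : ℕ
    k = 3 + (j + j)
    k≡m : k ≡ 1 + (suc j + suc j)
    k≡m = cong (λ x → 2 + x) (sym (+-suc j j))
    eq : ∀ m → m + m ≡ 2 * m
    eq = solve-∀

near-minimal-odd : ∀ h → 5 ≤ 1 + (h + h) → ¬ 5 ℕ.∣ 1 + (h + h) → ¬ 5 ℕ.∣ h + h →
  NearMinimalConfig15GDD (1 + (h + h)) (10 * (1 + (h + h))) (5 * (h + h))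
near-minimal-odd zero      (s≤s ())
near-minimal-odd h@(suc _) 5≤n 5∤n 5∤p =
  (5 * n , 5 * h , minimal-odd h z<s 5∤n 5∤p , *-assoc 2 5 n , eq h) , design-odd h 5≤n
  where
  n : ℕ
  n = 1 + (h + h)
  eq : ∀ h → 5 * (h + h) ≡ 2 * (5 * h)
  eq = solve-∀

near-minimal-even : ∀ m → 5 ≤ m + m → ¬ 5 ℕ.∣ m + m → ¬ 5 ℕ.∣ m + m ∸ 1 →
  NearMinimalConfig15GDD (m + m) (20 * (m + m)) (10 * (m + m ∸ 1))
near-minimal-even (suc j) 5≤n 5∤n 5∤p =
  (10 * n , 5 * (n ∸ 1) , subst (λ n → MinimalIndices n (10 * n) (5 * (n ∸ 1))) n≡ minimal-n , *-assoc 2 10 n , *-assoc 2 5 (n ∸ 1))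
  , design-even (suc j) 5≤n 5∤p
  where
  n : ℕ
  n = suc j + suc j
  n≡ : suc (suc (j + j)) ≡ n
  n≡ = cong suc (sym (+-suc j j))
  minimal-n : MinimalIndices (suc (suc (j + j))) (10 * suc (suc (j + j))) (5 * suc (j + j))
  minimal-n = minimal-even j (subst (λ n → ¬ 5 ℕ.∣ n) (sym n≡) 5∤n) (subst (λ n → ¬ 5 ℕ.∣ n ∸ 1) (sym n≡) 5∤p)

5∤-+10* : ∀ {r} q → ¬ 5 ℕ.∣ r → ¬ 5 ℕ.∣ r + q * 10
5∤-+10* {r} q 5∤r 5∣n = 5∤r (ℕ.∣m+n∣m⇒∣n (subst (5 ℕ.∣_) (+-comm r (q * 10)) 5∣n)
  (ℕ.∣n⇒∣m*n q (ℕ.divides 2 refl)))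

odd-residue : ∀ a {n} q → n ≡ 1 + (a + a) + q * 10 → ¬ 5 ℕ.∣ 1 + (a + a) → ¬ 5 ℕ.∣ a + a →
  5 ≤ n → NearMinimalConfig15GDD n (10 * n) (5 * (n ∸ 1))
odd-residue a q refl 5∤r 5∤r-1 5≤n = subst (λ h+h → NearMinimalConfig15GDD (1 + h+h) (10 * (1 + h+h)) (5 * h+h)) h+h≡
  (near-minimal-odd h (subst (λ h+h → 5 ≤ 1 + h+h) (sym h+h≡) 5≤n)
    (subst (λ h+h → ¬ 5 ℕ.∣ 1 + h+h) (sym h+h≡) (5∤-+10* q 5∤r))
    (subst (λ h+h → ¬ 5 ℕ.∣ h+h) (sym h+h≡) (5∤-+10* q 5∤r-1)))
  where
  h : ℕ
  h = a + q * 5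
  h+h≡ : h + h ≡ a + a + q * 10
  h+h≡ = eq a q
    where
    eq : ∀ a q → a + q * 5 + (a + q * 5) ≡ a + a + q * 10
    eq = solve-∀

even-residue : ∀ a {n} q → n ≡ suc a + suc a + q * 10 → ¬ 5 ℕ.∣ suc a + suc a → ¬ 5 ℕ.∣ a + suc a →
  5 ≤ n → NearMinimalConfig15GDD n (20 * n) (10 * (n ∸ 1))
even-residue a q refl 5∤r 5∤r-1 5≤n = subst (λ n → NearMinimalConfig15GDD n (20 * n) (10 * (n ∸ 1))) m+m≡
  (near-minimal-even m (subst (5 ≤_) (sym m+m≡) 5≤n)
    (subst (λ n → ¬ 5 ℕ.∣ n) (sym m+m≡) (5∤-+10* q 5∤r))
    (subst (λ n → ¬ 5 ℕ.∣ n ∸ 1) (sym m+m≡) (5∤-+10* q 5∤r-1)))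
  where
  m : ℕ
  m = suc a + q * 5
  m+m≡ : m + m ≡ suc a + suc a + q * 10
  m+m≡ = eq a q
    where
    eq : ∀ a q → suc a + q * 5 + (suc a + q * 5) ≡ suc a + suc a + q * 10
    eq = solve-∀

mainTheorem12 : (n : ℕ) → 5 ≤ n →
    (n % 10 ∈ 3 ∷ 7 ∷ 9 ∷ [] → NearMinimalConfig15GDD n (10 * n) (5 * (n ∸ 1)))
    × (n % 10 ∈ 2 ∷ 4 ∷ 8 ∷ [] → NearMinimalConfig15GDD n (20 * n) (10 * (n ∸ 1)))
mainTheorem12 n 5≤n = odd , even
  where
  decimal : ∀ {r} → n % 10 ≡ r → n ≡ r + n / 10 * 10
  decimal refl = m≡m%n+[m/n]*n n 10

  odd : n % 10 ∈ 3 ∷ 7 ∷ 9 ∷ [] → NearMinimalConfig15GDD n (10 * n) (5 * (n ∸ 1))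
  odd (here eq) =
    odd-residue 1 (n / 10) (decimal eq) (from-no (5 ℕ.∣? 3)) (from-no (5 ℕ.∣? 2)) 5≤n
  odd (there (here eq)) =
    odd-residue 3 (n / 10) (decimal eq) (from-no (5 ℕ.∣? 7)) (from-no (5 ℕ.∣? 6)) 5≤n
  odd (there (there (here eq))) =
    odd-residue 4 (n / 10) (decimal eq) (from-no (5 ℕ.∣? 9)) (from-no (5 ℕ.∣? 8)) 5≤n

  even : n % 10 ∈ 2 ∷ 4 ∷ 8 ∷ [] → NearMinimalConfig15GDD n (20 * n) (10 * (n ∸ 1))
  even (here eq) =
    even-residue 0 (n / 10) (decimal eq) (from-no (5 ℕ.∣? 2)) (from-no (5 ℕ.∣? 1)) 5≤n
  even (there (here eq)) =
    even-residue 1 (n / 10) (decimal eq) (from-no (5 ℕ.∣? 4)) (from-no (5 ℕ.∣? 3)) 5≤n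
  even (there (there (here eq))) =
    even-residue 3 (n / 10) (decimal eq) (from-no (5 ℕ.∣? 8)) (from-no (5 ℕ.∣? 7)) 5≤n
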